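{- Let $P$ be a (3+1)-free poset with incomparability graph $G(P)$, and let $k\ge1$. Then $X_{G(P)}(x_1,\ldots,x_k)$ is SNP, and its Newton polytope is $\mathcal{P}^{(k)}_{\lambda^{\mathrm{gr}}(P)}$. In particular, $\lambda^{\mathrm{gr}}(P)$ dominates the weight of any proper coloring of $G(P)$.
   Context: All graphs and posets are finite. A coloring $f$ of the vertices of $G$ is proper if adjacent vertices receive different colors. $X_G(x_1,\ldots,x_k)=\sum_f \prod_{v\in V(G)}x_{f(v)}$, summed over all proper colorings $f:V(G)\to[k]=\{1,\dots,k\}$. The weight of a coloring $f$ with values in $\{1,2,\ldots\}$ is $\mathrm{wt}(f)=(|f^{ -1}(1)|,|f^{ -1}(2)|,\ldots)$. For sequences of nonnegative integers of the same total sum, $\beta$ dominates $\gamma$ ($\gamma\preceq\beta$) if $\sum_{i=1}^m\gamma_i\le\sum_{i=1}^m\beta_i$ for all $m$. For $p=\sum_\alpha c_\alpha \mathbf{x}^\alpha\in\mathbb{R}[x_1,\ldots,x_k]$, $\mathrm{supp}(p)=\{\alpha: c_\alpha\ne0\}$ and $\mathrm{Newton}(p)=\mathrm{conv}(\mathrm{supp}(p))$. $p$ is SNP if $\mathrm{supp}(p)=\mathrm{Newton}(p)\cap\mathbb{Z}^k$. For a partition $\lambda$ with exactly $\ell$ positive parts, if $k\ge \ell$ then $\mathcal{P}^{(k)}_\lambda$ is the convex hull in $\mathbb{R}^k$ of all permutations of $(\lambda_1,\ldots,\lambda_\ell,0,\ldots,0)$; if $k<\ell$ then $\mathcal{P}^{(k)}_\lambda=\emptyset$.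 A poset is (3+1)-free if there are no chain $a_1<a_2<a_3$ and element $b$ incomparable to $a_1,a_2,a_3$. The incomparability graph $G(P)$ has the elements of $P$ as vertices and edges joining incomparable pairs. A Dyck path $d$ of length $n$ is a lattice path from $(0,0)$ to $(n,n)$ with steps $\mathsf{n}=(0,1)$ and $\mathsf{e}=(1,0)$ not going below $y=x$. Its Hessenberg function is: $h_d(i)$ is the number of $\mathsf n$ steps preceding the $i$-th $\mathsf e$ step. The indifference graph $G(d)$ has vertex set $[n]$ with an edge between $i<j$ iff $j\le h_d(i)$. The greedy coloring $\mathrm{gr}$ of $G(d)$ processes vertices in the order $1,2,\ldots,n$ and gives each vertex the smallest positive integer not used on its already colored neighbors; $\lambda^{\mathrm{gr}}(d)=\mathrm{wt}(\mathrm{gr})$ (it is a partition of $n$). Definition of $\lambda^{\mathrm{gr}}(P)$. A part listing is a finite word in the letters $v_i$ ($i\ge0$; a single vertex at level $i$) and $b_{i,i+1}(H)$ ($i\ge0$; $H$ a bicolored graph, i.e. a bipartite graph with a given ordered bipartition, whose lower color class is placed at level $i$ and upper color class at level $i+1$). Its associated poset is on the set of all vertices of all the parts, with $x<y$ iff one of the following holds: (i) $x,y$ are at levels $i,j$ with $j-i\ge2$; (ii) $x$ is exactly one level below $y$ and the part containing $x$ appears strictly before the part containing $y$ in the word; (iii) $x$ is exactly one level below $y$ and they are joined by an edge of a bicolored graph $H$ of the listing. It is known that every (3+1)-free poset is isomorphic to the poset of some part listing, and that the poset of a part listing with no letters $b_{i,i+1}(H)$ has incomparability graph isomorphic to $G(d)$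 for some Dyck path $d$. Given a (3+1)-free poset $P$, take a part listing $L$ for $P$. For each part $b_{i,i+1}(H)$ of $L$, with $r$ lower and $s$ upper vertices, let $q_j$ be the probability that $H$ and a uniformly random matching with $\min(r,s)$ edges between lower and upper vertices have exactly $j$ edges in common, let $j$ be the largest index with $q_j\ne0$, and replace the part by the word $v_{i+1}^{s-j}v_i^rv_{i+1}^j$ if $r\ge s$, and by $v_i^jv_{i+1}^sv_i^{r-j}$ if $r<s$. The resulting listing has only letters $v_i$; the incomparability graph of its poset is isomorphic to $G(d)$ for a Dyck path $d$, and $\lambda^{\mathrm{gr}}(P):=\lambda^{\mathrm{gr}}(d)$. The statement is asserted for any such choice of $L$ and $d$. -}

module Defs where

open import Data.Bool using (Bool; true; false; T; T?; _∧_; if_then_else_)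
open import Data.Empty using (⊥)
open import Data.Fin using (Fin; zero; suc; toℕ)
import Data.Fin as Fin
import Data.Fin.Properties as Fin
open import Data.Fin.Permutation using (Permutation′; _⟨$⟩ʳ_)
open import Data.Integer using (ℤ; +_)
open import Data.List using (List; []; _∷_; _++_; length; map; filter; foldr; replicate;
  concatMap; cartesianProduct; cartesianProductWith; allFin; applyUpTo; take; lookup)
import Data.List.Membership.DecPropositional as DecMembership
open import Data.Nat using (ℕ; zero; suc; _+_; _∸_; _⊓_; _≤_; _<_; _≤ᵇ_)
open import Data.Nat.ListAction using (sum)
import Data.Nat.Properties as ℕ
open import Data.Product using (Σ; ∃; _×_; _,_; proj₁; proj₂)
open import Data.Rational using (ℚ; 0ℚ; 1ℚ; ½)
import Data.Rational as ℚ
import Data.Rational.Properties as ℚ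
open import Data.Rational.Solver using (module +-*-Solver)
open import Data.Sum using (_⊎_; inj₁; inj₂)
open import Data.Vec.Functional using (Vector)
import Data.Vec.Functional as Vec
open import Function using (_∘_; _⇔_)
open import Level using (0ℓ)
open import Relation.Binary using (Rel; IsDecStrictPartialOrder; Decidable; Symmetric; Irreflexive)
open import Relation.Binary.Morphism.Structures using (IsOrderIsomorphism)
open import Relation.Binary.PropositionalEquality
open import Relation.Nullary using (¬_; Dec; does; yes; no)
open import Relation.Nullary.Decidable using (¬?; _×-dec_; _⊎-dec_; _→-dec_)
open import Relation.Unary using (Pred)

-- Real numbers are Cauchy sequences of rationals, with equality _≈ᴿ_.

Cauchy : (ℕ → ℚ) → Set
Cauchy x = ∀ ε → 0ℚ ℚ.< ε →
  ∃ λ N → ∀ m n → N ≤ m → N ≤ n → ℚ.∣ x m ℚ.- x n ∣ ℚ.< ε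

record ℝ : Set where
  constructor mkℝ
  field
    seq    : ℕ → ℚ
    cauchy : Cauchy seq

open ℝ public

infix 4 _≈ᴿ_ _≤ᴿ_

_≈ᴿ_ : Rel ℝ 0ℓ
x ≈ᴿ y = ∀ ε → 0ℚ ℚ.< ε →
  ∃ λ N → ∀ n → N ≤ n → ℚ.∣ seq x n ℚ.- seq y n ∣ ℚ.< ε

_≤ᴿ_ : Rel ℝ 0ℓ
x ≤ᴿ y = ∀ ε → 0ℚ ℚ.< ε →
  ∃ λ N → ∀ n → N ≤ n → seq x n ℚ.< seq y n ℚ.+ ε

fromℚ : ℚ → ℝ
fromℚ q = mkℝ (λ _ → q) λ ε 0<ε → 0 , λ _ _ _ _ →
  subst (λ z → ℚ.∣ z ∣ ℚ.< ε) (sym (ℚ.+-inverseʳ q)) 0<ε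

fromℤ : ℤ → ℝ
fromℤ z = fromℚ (z ℚ./ 1)

0ᴿ 1ᴿ : ℝ
0ᴿ = fromℚ 0ℚ
1ᴿ = fromℚ 1ℚ

private
  *-pos : ∀ {p q} → 0ℚ ℚ.< p → 0ℚ ℚ.< q → 0ℚ ℚ.< p ℚ.* q
  *-pos {p} {q} 0<p 0<q = subst (ℚ._< p ℚ.* q) (ℚ.*-zeroˡ q)
    (ℚ.*-monoˡ-<-pos q {{ℚ.positive 0<q}} 0<p)

  half-pos : ∀ {ε} → 0ℚ ℚ.< ε → 0ℚ ℚ.< ε ℚ.* ½
  half-pos 0<ε = *-pos 0<ε (ℚ.positive⁻¹ ½)

  halves : ∀ ε → ε ℚ.* ½ ℚ.+ ε ℚ.* ½ ≡ ε
  halves ε = trans (sym (ℚ.*-distribˡ-+ ε ½ ½)) (ℚ.*-identityʳ ε)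

  absSum : (ℕ → ℚ) → ℕ → ℚ
  absSum x zero    = ℚ.∣ x zero ∣
  absSum x (suc n) = absSum x n ℚ.+ ℚ.∣ x (suc n) ∣

  ≤+ʳ : ∀ p q → 0ℚ ℚ.≤ q → p ℚ.≤ p ℚ.+ q
  ≤+ʳ p q 0≤q = subst (ℚ._≤ p ℚ.+ q) (ℚ.+-identityʳ p) (ℚ.+-monoʳ-≤ p 0≤q)

  ≤+ˡ : ∀ p q → 0ℚ ℚ.≤ p → q ℚ.≤ p ℚ.+ q
  ≤+ˡ p q 0≤p = subst (ℚ._≤ p ℚ.+ q) (ℚ.+-identityˡ q) (ℚ.+-monoˡ-≤ q 0≤p)

  absSum-nonneg : ∀ x n → 0ℚ ℚ.≤ absSum x n
  absSum-nonneg x zero    = ℚ.0≤∣p∣ (x zero)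
  absSum-nonneg x (suc n) =
    ℚ.≤-trans (absSum-nonneg x n) (≤+ʳ (absSum x n) _ (ℚ.0≤∣p∣ (x (suc n))))

  ∣x∣≤absSum : ∀ x {i n} → i ≤ n → ℚ.∣ x i ∣ ℚ.≤ absSum x n
  ∣x∣≤absSum x {n = zero} _≤_.z≤n = ℚ.≤-refl
  ∣x∣≤absSum x {i} {suc n} i≤1+n with ℕ.m≤n⇒m<n∨m≡n i≤1+n
  ... | inj₁ (_≤_.s≤s i≤n) =
    ℚ.≤-trans (∣x∣≤absSum x i≤n) (≤+ʳ (absSum x n) _ (ℚ.0≤∣p∣ (x (suc n))))
  ... | inj₂ refl = ≤+ˡ (absSum x n) _ (absSum-nonneg x n)

  bounded : ∀ x → ∃ λ B → 0ℚ ℚ.< B × (∀ n → ℚ.∣ seq x n ∣ ℚ.≤ B)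
  bounded x with cauchy x 1ℚ (ℚ.positive⁻¹ 1ℚ)
  ... | N , close = B , B-pos , bound
    where
    a = seq x
    S = absSum a N
    B = S ℚ.+ 1ℚ
    B-pos : 0ℚ ℚ.< B
    B-pos = ℚ.+-mono-≤-< (absSum-nonneg a N) (ℚ.positive⁻¹ 1ℚ)
    open ℚ.≤-Reasoning
    bound : ∀ n → ℚ.∣ a n ∣ ℚ.≤ B
    bound n with ℕ.≤-total n N
    ... | inj₁ n≤N = ℚ.≤-trans (∣x∣≤absSum a n≤N) (≤+ʳ S 1ℚ (ℚ.nonNegative⁻¹ 1ℚ))
    ... | inj₂ N≤n = begin
      ℚ.∣ a n ∣
        ≡⟨ cong ℚ.∣_∣ (+-*-Solver.solve 2 (λ p q → p := q :+ (p :- q)) refl (a n) (a N)) ⟩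
      ℚ.∣ a N ℚ.+ (a n ℚ.- a N) ∣
        ≤⟨ ℚ.∣p+q∣≤∣p∣+∣q∣ (a N) (a n ℚ.- a N) ⟩
      ℚ.∣ a N ∣ ℚ.+ ℚ.∣ a n ℚ.- a N ∣
        ≤⟨ ℚ.+-mono-≤ (∣x∣≤absSum a (ℕ.≤-refl {N})) (ℚ.<⇒≤ (close n N N≤n ℕ.≤-refl)) ⟩
      B ∎
      where open +-*-Solver

  +-cauchy : ∀ x y → Cauchy (λ n → seq x n ℚ.+ seq y n)
  +-cauchy x y ε 0<ε with cauchy x (ε ℚ.* ½) (half-pos 0<ε) | cauchy y (ε ℚ.* ½) (half-pos 0<ε)
  ... | M , closeˣ | N , closeʸ = M + N , λ m n M+N≤m M+N≤n → begin-strict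
    ℚ.∣ (a m ℚ.+ b m) ℚ.- (a n ℚ.+ b n) ∣
      ≡⟨ cong ℚ.∣_∣ (+-*-Solver.solve 4
           (λ p q r s → (p :+ q) :- (r :+ s) := (p :- r) :+ (q :- s)) refl (a m) (b m) (a n) (b n)) ⟩
    ℚ.∣ (a m ℚ.- a n) ℚ.+ (b m ℚ.- b n) ∣
      ≤⟨ ℚ.∣p+q∣≤∣p∣+∣q∣ (a m ℚ.- a n) (b m ℚ.- b n) ⟩
    ℚ.∣ a m ℚ.- a n ∣ ℚ.+ ℚ.∣ b m ℚ.- b n ∣
      <⟨ ℚ.+-mono-< (closeˣ m n (ℕ.m+n≤o⇒m≤o M M+N≤m) (ℕ.m+n≤o⇒m≤o M M+N≤n))
                    (closeʸ m n (ℕ.m+n≤o⇒n≤o M M+N≤m) (ℕ.m+n≤o⇒n≤o M M+N≤n)) ⟩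
    ε ℚ.* ½ ℚ.+ ε ℚ.* ½
      ≡⟨ halves ε ⟩
    ε ∎
    where
    open ℚ.≤-Reasoning
    open +-*-Solver
    a = seq x
    b = seq y

  *-cauchy : ∀ x y → Cauchy (λ n → seq x n ℚ.* seq y n)
  *-cauchy x y ε 0<ε with bounded x | bounded y
  ... | B , 0<B , boundˣ | C , 0<C , boundʸ = M + N , λ m n M+N≤m M+N≤n → begin-strict
    ℚ.∣ a m ℚ.* b m ℚ.- a n ℚ.* b n ∣
      ≡⟨ cong ℚ.∣_∣ (+-*-Solver.solve 4
           (λ p q r s → p :* q :- r :* s := p :* (q :- s) :+ (p :- r) :* s) refl
           (a m) (b m) (a n) (b n)) ⟩
    ℚ.∣ a m ℚ.* (b m ℚ.- b n) ℚ.+ (a m ℚ.- a n) ℚ.* b n ∣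
      ≤⟨ ℚ.∣p+q∣≤∣p∣+∣q∣ (a m ℚ.* (b m ℚ.- b n)) ((a m ℚ.- a n) ℚ.* b n) ⟩
    ℚ.∣ a m ℚ.* (b m ℚ.- b n) ∣ ℚ.+ ℚ.∣ (a m ℚ.- a n) ℚ.* b n ∣
      ≡⟨ cong₂ ℚ._+_ (ℚ.∣p*q∣≡∣p∣*∣q∣ (a m) (b m ℚ.- b n))
                     (ℚ.∣p*q∣≡∣p∣*∣q∣ (a m ℚ.- a n) (b n)) ⟩
    ℚ.∣ a m ∣ ℚ.* ℚ.∣ b m ℚ.- b n ∣ ℚ.+ ℚ.∣ a m ℚ.- a n ∣ ℚ.* ℚ.∣ b n ∣
      ≤⟨ ℚ.+-mono-≤
           (ℚ.*-monoʳ-≤-nonNeg ℚ.∣ b m ℚ.- b n ∣ {{ℚ.nonNegative (ℚ.0≤∣p∣ (b m ℚ.- b n))}}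
             (ℚ.≤-trans (boundˣ m) (≤+ʳ B C (ℚ.<⇒≤ 0<C))))
           (ℚ.*-monoˡ-≤-nonNeg ℚ.∣ a m ℚ.- a n ∣ {{ℚ.nonNegative (ℚ.0≤∣p∣ (a m ℚ.- a n))}}
             (ℚ.≤-trans (boundʸ n) (≤+ˡ B C (ℚ.<⇒≤ 0<B)))) ⟩
    D ℚ.* ℚ.∣ b m ℚ.- b n ∣ ℚ.+ ℚ.∣ a m ℚ.- a n ∣ ℚ.* D
      <⟨ ℚ.+-mono-<
           (ℚ.*-monoʳ-<-pos D
             (proj₂ cʸ m n (ℕ.m+n≤o⇒n≤o M M+N≤m) (ℕ.m+n≤o⇒n≤o M M+N≤n)))
           (ℚ.*-monoˡ-<-pos D
             (proj₂ cˣ m n (ℕ.m+n≤o⇒m≤o M M+N≤m) (ℕ.m+n≤o⇒m≤o M M+N≤n))) ⟩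
    D ℚ.* δ ℚ.+ δ ℚ.* D
      ≡⟨ cong₂ ℚ._+_ Dδ (trans (ℚ.*-comm δ D) Dδ) ⟩
    ε ℚ.* ½ ℚ.+ ε ℚ.* ½
      ≡⟨ halves ε ⟩
    ε ∎
    where
    open ℚ.≤-Reasoning
    open +-*-Solver
    a = seq x
    b = seq y
    D = B ℚ.+ C
    instance
      D-pos : ℚ.Positive D
      D-pos = ℚ.positive (ℚ.+-mono-< 0<B 0<C)
      D≢0 : ℚ.NonZero D
      D≢0 = ℚ.pos⇒nonZero D
    1/D-pos : 0ℚ ℚ.< ℚ.1/ D
    1/D-pos = ℚ.positive⁻¹ (ℚ.1/ D) {{ℚ.1/pos⇒pos D}}
    δ = (ℚ.1/ D) ℚ.* (ε ℚ.* ½)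
    Dδ : D ℚ.* δ ≡ ε ℚ.* ½
    Dδ = trans (sym (ℚ.*-assoc D (ℚ.1/ D) (ε ℚ.* ½)))
      (trans (cong (ℚ._* (ε ℚ.* ½)) (ℚ.*-inverseʳ D)) (ℚ.*-identityˡ (ε ℚ.* ½)))
    0<δ : 0ℚ ℚ.< δ
    0<δ = *-pos 1/D-pos (half-pos 0<ε)
    cˣ = cauchy x δ 0<δ
    cʸ = cauchy y δ 0<δ
    M = proj₁ cˣ
    N = proj₁ cʸ

infixl 6 _+ᴿ_
infixl 7 _*ᴿ_

_+ᴿ_ : ℝ → ℝ → ℝ
x +ᴿ y = mkℝ (λ n → seq x n ℚ.+ seq y n) (+-cauchy x y)

_*ᴿ_ : ℝ → ℝ → ℝ
x *ᴿ y = mkℝ (λ n → seq x n ℚ.* seq y n) (*-cauchy x y)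

Σᴿ : ∀ {m} → Vector ℝ m → ℝ
Σᴿ = Vec.foldr _+ᴿ_ 0ᴿ

conv : ∀ {k} → Pred (Vector ℝ k) 0ℓ → Pred (Vector ℝ k) 0ℓ
conv S x = ∃ λ m → Σ (Vector ℝ m) λ w → Σ (Vector (Vector ℝ _) m) λ p →
    (∀ i → 0ᴿ ≤ᴿ w i)
  × Σᴿ w ≈ᴿ 1ᴿ
  × (∀ i → S (p i))
  × (∀ j → x j ≈ᴿ Σᴿ (λ i → w i *ᴿ p i j))

embed : ∀ {k} → Vector ℤ k → Vector ℝ k
embed α i = fromℤ (α i)

embedℕ : ∀ {k} → Vector ℕ k → Vector ℝ k
embedℕ α = embed (λ i → + α i)

image : ∀ {k} → Pred (Vector ℕ k) 0ℓ → Pred (Vector ℝ k) 0ℓ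
image S x = ∃ λ α → S α × (∀ i → x i ≈ᴿ embedℕ α i)

-- Polynomials in ℝ[x₁,…,xₖ] are represented by formal sums of terms c·x^α. An exponent
-- may be repeated in the list; coeff adds up the repetitions.

Poly : ℕ → Set
Poly k = List (ℝ × Vector ℕ k)

coeff : ∀ {k} → Poly k → Vector ℕ k → ℝ
coeff p α = foldr (λ t c → if does (Fin.all? (λ i → proj₂ t i ℕ.≟ α i))
                           then proj₁ t +ᴿ c else c) 0ᴿ p

0ᴾ 1ᴾ : ∀ {k} → Poly k
0ᴾ = []
1ᴾ = (1ᴿ , λ _ → 0) ∷ []

infixl 6 _+ᴾ_
infixl 7 _*ᴾ_

_+ᴾ_ _*ᴾ_ : ∀ {k} → Poly k → Poly k → Poly k
_+ᴾ_ = _++_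
_*ᴾ_ = cartesianProductWith λ s t → proj₁ s *ᴿ proj₁ t , λ i → proj₂ s i + proj₂ t i

var : ∀ {k} → Fin k → Poly k
var i = (1ᴿ , λ j → if does (i Fin.≟ j) then 1 else 0) ∷ []

∏ᴾ : ∀ {k n} → Vector (Poly k) n → Poly k
∏ᴾ = Vec.foldr _*ᴾ_ 1ᴾ

supp : ∀ {k} → Poly k → Pred (Vector ℕ k) 0ℓ
supp p α = ¬ (coeff p α ≈ᴿ 0ᴿ)

Newton : ∀ {k} → Poly k → Pred (Vector ℝ k) 0ℓ
Newton p = conv (image (supp p))

-- The support is viewed inside ℤᵏ via ℕ ⊆ ℤ.
SNP : ∀ {k} → Poly k → Set
SNP {k} p = (α : Vector ℤ k) →
  (∃ λ β → supp p β × (∀ i → α i ≡ + β i)) ⇔ Newton p (embed α)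

-- A sequence (γ₁, γ₂, …) is represented by the function i ↦ γᵢ₊₁ on ℕ.
-- Dominance is only used between sequences with the same total sum.
infix 4 _≼_

_≼_ : Rel (ℕ → ℕ) 0ℓ
γ ≼ β = ∀ m → sum (applyUpTo γ m) ≤ sum (applyUpTo β m)

record IsPartition (ν : ℕ → ℕ) (ℓ : ℕ) : Set where
  field
    nonincreasing : ∀ i → ν (suc i) ≤ ν i
    positive      : ∀ i → i < ℓ → 0 < ν i
    zeroAfter     : ∀ i → ℓ ≤ i → ν i ≡ 0

-- 𝒫_ν^(k), for a partition ν. The number ℓ of positive parts is determined
-- by ν, so the polytope is empty when k < ℓ.
Permutohedron : ∀ k → (ℕ → ℕ) → Pred (Vector ℝ k) 0ℓ
Permutohedron k ν x = ∃ λ ℓ → IsPartition ν ℓ × ℓ ≤ k × conv (image permutationOfν) x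
  where
  permutationOfν : Pred (Vector ℕ k) 0ℓ
  permutationOfν α = Σ (Permutation′ k) λ σ → ∀ i → α i ≡ ν (toℕ (σ ⟨$⟩ʳ i))

-- The colours 1, 2, … are represented by 0, 1, ….

record Graph (n : ℕ) : Set₁ where
  field
    Adj    : Rel (Fin n) 0ℓ
    adj?   : Decidable Adj
    symm   : Symmetric Adj
    irrefl : Irreflexive _≡_ Adj

open Graph public

Proper : ∀ {n} {A : Set} → Graph n → (Fin n → A) → Set
Proper G f = ∀ u v → Adj G u v → f u ≢ f v

proper? : ∀ {n k} (G : Graph n) (f : Fin n → Fin k) → Dec (Proper G f)
proper? G f = Fin.all? λ u → Fin.all? λ v → adj? G u v →-dec ¬? (f u Fin.≟ f v)

wt : ∀ {n} → (Fin n → ℕ) → ℕ → ℕ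
wt {n} f i = length (filter (λ v → f v ℕ.≟ i) (allFin n))

functions : ∀ {A : Set} n → List A → List (Fin n → A)
functions zero    as = Vec.[] ∷ []
functions (suc n) as = cartesianProductWith Vec._∷_ as (functions n as)

X : ∀ {n} → Graph n → ∀ k → Poly k
X {n} G k = foldr (λ f p → ∏ᴾ (λ v → var (f v)) +ᴾ p) 0ᴾ
                  (filter (proper? G) (functions n (allFin k)))

-- The least colour not in the list: among the first 1 + length cs colours
-- at least one is absent, so the search never runs out of fuel early.
leastAbsent : List ℕ → ℕ
leastAbsent cs = search (length cs) 0
  where
  open DecMembership ℕ._≟_ using (_∈?_)
  search : ℕ → ℕ → ℕ
  search zero       c = c
  search (suc fuel) c = if does (c ∈? cs) then search fuel (suc c) else c

-- Colours the vertices in increasing order; used v collects the colours of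
-- the already coloured neighbours of the vertex v.
greedyFrom : ∀ {n} {R : Rel (Fin n) 0ℓ} → Decidable R → (Fin n → List ℕ) → Fin n → ℕ
greedyFrom R? used zero = leastAbsent (used zero)
greedyFrom R? used (suc v) =
  greedyFrom (λ x y → R? (suc x) (suc y))
    (λ x → if does (R? zero (suc x)) then leastAbsent (used zero) ∷ used (suc x)
                                     else used (suc x)) v

greedy : ∀ {n} → Graph n → Fin n → ℕ
greedy G = greedyFrom (adj? G) (λ _ → [])

record FinPoset (n : ℕ) : Set₁ where
  field
    _≺_                     : Rel (Fin n) 0ℓ
    isDecStrictPartialOrder : IsDecStrictPartialOrder _≡_ _≺_

Incomparable : ∀ {A : Set} → Rel A 0ℓ → Rel A 0ℓ
Incomparable _≺_ x y = x ≢ y × ¬ x ≺ y × ¬ y ≺ x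

ThreePlusOneFree : ∀ {A : Set} → Rel A 0ℓ → Set
ThreePlusOneFree _≺_ = ∀ a₁ a₂ a₃ b → a₁ ≺ a₂ → a₂ ≺ a₃ →
  ¬ (Incomparable _≺_ b a₁ × Incomparable _≺_ b a₂ × Incomparable _≺_ b a₃)

incGraph : ∀ {n} → FinPoset n → Graph n
incGraph P = record
  { Adj    = Incomparable _≺_
  ; adj?   = λ x y → ¬? (x Fin.≟ y) ×-dec ¬? (x <? y) ×-dec ¬? (y <? x)
  ; symm   = λ (x≢y , x⊀y , y⊀x) → ≢-sym x≢y , y⊀x , x⊀y
  ; irrefl = λ x≡y (x≢y , _) → x≢y x≡y
  }
  where
  open FinPoset P
  open IsDecStrictPartialOrder isDecStrictPartialOrder using (_<?_)

infix 4 _≅_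

-- Used for strict orders and for adjacency relations.
_≅_ : ∀ {A B : Set} → Rel A 0ℓ → Rel B 0ℓ → Set
R ≅ S = ∃ λ f → IsOrderIsomorphism _≡_ _≡_ R S f

data Step : Set where
  𝕟 𝕖 : Step

#𝕟 #𝕖 : List Step → ℕ
#𝕟 []      = 0
#𝕟 (𝕟 ∷ w) = suc (#𝕟 w)
#𝕟 (𝕖 ∷ w) = #𝕟 w
#𝕖 []      = 0
#𝕖 (𝕟 ∷ w) = #𝕖 w
#𝕖 (𝕖 ∷ w) = suc (#𝕖 w)

record DyckPath (n : ℕ) : Set where
  field
    steps         : List Step
    #𝕟≡n          : #𝕟 steps ≡ n
    #𝕖≡n          : #𝕖 steps ≡ n
    aboveDiagonal : ∀ m → #𝕖 (take m steps) ≤ #𝕟 (take m steps)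

-- Counts the 𝕟 steps before the (i+1)-st 𝕖 step (indices from 0).
northsBefore : List Step → ℕ → ℕ
northsBefore []      i       = 0
northsBefore (𝕟 ∷ w) i       = suc (northsBefore w i)
northsBefore (𝕖 ∷ w) zero    = 0
northsBefore (𝕖 ∷ w) (suc i) = northsBefore w i

-- Vertex i : Fin n stands for i + 1 ∈ [n].
hessenberg : ∀ {n} → DyckPath n → Fin n → ℕ
hessenberg d i = northsBefore (DyckPath.steps d) (toℕ i)

indifferenceGraph : ∀ {n} → DyckPath n → Graph n
indifferenceGraph {n} d = record
  { Adj    = λ i j → E i j ⊎ E j i
  ; adj?   = λ i j → E? i j ⊎-dec E? j i
  ; symm   = λ { (inj₁ e) → inj₂ e ; (inj₂ e) → inj₁ e }
  ; irrefl = λ { refl (inj₁ (i<i , _)) → ℕ.<-irrefl refl i<i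
               ; refl (inj₂ (i<i , _)) → ℕ.<-irrefl refl i<i }
  }
  where
  E : Rel (Fin n) 0ℓ
  E i j = i Fin.< j × suc (toℕ j) ≤ hessenberg d i
  E? : Decidable E
  E? i j = (i Fin.<? j) ×-dec (suc (toℕ j) ℕ.≤? hessenberg d i)

λᵍʳ : ∀ {n} → DyckPath n → ℕ → ℕ
λᵍʳ d = wt (greedy (indifferenceGraph d))

-- H x y says whether the lower vertex x and the upper vertex y are joined.
Bicoloured : ℕ → ℕ → Set
Bicoloured r s = Fin r → Fin s → Bool

data Part : Set where
  v : (i : ℕ) → Part
  b : (i r s : ℕ) (H : Bicoloured r s) → Part

PartListing : Set
PartListing = List Part

PartVertex : Part → Set
PartVertex (v i)       = Fin 1
PartVertex (b i r s H) = Fin r ⊎ Fin s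

partLevel : (p : Part) → PartVertex p → ℕ
partLevel (v i)       _        = i
partLevel (b i r s H) (inj₁ _) = i
partLevel (b i r s H) (inj₂ _) = suc i

PartEdge : (p : Part) → Rel (PartVertex p) 0ℓ
PartEdge (b i r s H) (inj₁ x) (inj₂ y) = T (H x y)
PartEdge _           _        _        = ⊥

module _ (L : PartListing) where

  Vertex : Set
  Vertex = Σ (Fin (length L)) λ p → PartVertex (lookup L p)

  level : Vertex → ℕ
  level (p , x) = partLevel (lookup L p) x

  data Below : Rel Vertex 0ℓ where
    twoLevels  : ∀ {x y} → level x + 2 ≤ level y → Below x y
    partBefore : ∀ {x y} → suc (level x) ≡ level y → proj₁ x Fin.< proj₁ y → Below x y
    edge       : ∀ {p x y} → PartEdge (lookup L p) x y → Below (p , x) (p , y)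

#edges : ∀ {r s} → Bicoloured r s → ℕ
#edges {r} {s} M =
  length (filter (λ e → T? (M (proj₁ e) (proj₂ e))) (cartesianProduct (allFin r) (allFin s)))

IsMatching : ∀ {r s} → Bicoloured r s → Set
IsMatching M = (∀ x y y′ → T (M x y) → T (M x y′) → y ≡ y′)
             × (∀ x x′ y → T (M x y) → T (M x′ y) → x ≡ x′)

isMatching? : ∀ {r s} (M : Bicoloured r s) → Dec (IsMatching M)
isMatching? M =
        (Fin.all? λ x → Fin.all? λ y → Fin.all? λ y′ →
          T? (M x y) →-dec (T? (M x y′) →-dec (y Fin.≟ y′)))
  ×-dec (Fin.all? λ x → Fin.all? λ x′ → Fin.all? λ y →
          T? (M x y) →-dec (T? (M x′ y) →-dec (x Fin.≟ x′)))

maxMatchings : ∀ r s → List (Bicoloured r s)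
maxMatchings r s = filter (λ M → isMatching? M ×-dec (#edges M ℕ.≟ r ⊓ s))
                          (functions r (functions s (true ∷ false ∷ [])))

-- The value at denominator 0 is irrelevant: maxMatchings r s is never empty.
ratio : ℕ → ℕ → ℚ
ratio a zero    = 0ℚ
ratio a (suc c) = + a ℚ./ suc c

q : ∀ {r s} → Bicoloured r s → ℕ → ℚ
q {r} {s} H j =
  ratio (length (filter (λ M → #edges (λ x y → M x y ∧ H x y) ℕ.≟ j) (maxMatchings r s)))
        (length (maxMatchings r s))

-- The largest j ≤ m with f j ≠ 0 (and 0 if there is none).
largestNonzero : (ℕ → ℚ) → ℕ → ℕ
largestNonzero f zero    = zero
largestNonzero f (suc m) = if does (f (suc m) ℚ.≟ 0ℚ) then largestNonzero f m else suc m

-- q H j = 0 for j > r ⊓ s, so the search may start at r ⊓ s.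
largestIndex : ∀ {r s} → Bicoloured r s → ℕ
largestIndex {r} {s} H = largestNonzero (q H) (r ⊓ s)

reducePart : Part → PartListing
reducePart (v i) = v i ∷ []
reducePart (b i r s H) =
  if s ≤ᵇ r
  then replicate (s ∸ j) (v (suc i)) ++ replicate r (v i) ++ replicate j (v (suc i))
  else replicate j (v i) ++ replicate s (v (suc i)) ++ replicate (r ∸ j) (v i)
  where
  j = largestIndex H

reduce : PartListing → PartListing
reduce = concatMap reducePart

{-# OPTIONS --safe #-}

-- A colour class of a poset meets a bicoloured part in at most one vertex of each level, and the
-- outside of the part does not distinguish vertices of the same level. Hence only the colour sets
-- of the two levels matter, and those that occur are the pairs of sets with at most j common
-- elements, j being the size of a largest matching of H. This j is the largest index with q_j ≠ 0,
-- and it is also the matching number of the two-level part that replaces H. So G(P) and G(d) have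
-- colourings of the same weights.
--
-- In G(d) the greedy colouring maximises the number of vertices of colours 1, …, m for every m, and
-- two colour classes can be balanced by exchanging them after a suitable cut. Therefore the weights
-- with k colours are exactly the vectors dominated by λᵍʳ up to rearrangement. They are cut out by
-- linear inequalities, which gives SNP; moving one unit between two entries stays in the convex
-- hull of the rearrangements of λᵍʳ, which identifies the Newton polytope.
module Submission where

open import Defs
open import Algebra.Bundles using (CommutativeSemiring)
import Algebra.Properties.CommutativeSemigroup
open import Algebra.Structures using (IsCommutativeSemiring)
open import Data.Bool using (Bool; true; false; if_then_else_; T; T?; _∧_; _∨_)
open import Data.Empty using (⊥-elim)
open import Data.Fin as Fin using (Fin; zero; suc; toℕ; fromℕ<)
open import Data.Fin.Permutation as Permutation using (Permutation′; _⟨$⟩ʳ_; _⟨$⟩ˡ_; _∘ₚ_)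
import Data.Fin.Properties as Fin
open import Data.Integer as ℤ using (ℤ)
import Data.Integer.Properties as ℤ
open import Data.List.Base as List
  using (List; []; _∷_; _++_; length; map; filter; foldr; tabulate; applyUpTo; upTo; allFin;
    cartesianProduct; replicate; take; drop)
open import Data.List.Membership.Propositional using (_∈_; _∉_; lose; find)
open import Data.List.Membership.Propositional.Properties
open import Data.List.Membership.Propositional.Properties.WithK using (unique∧set⇒bag)
import Data.List.Membership.DecPropositional as DecMembership
import Data.List.Properties as List
open import Data.List.Relation.Binary.BagAndSetEquality using (∼bag⇒↭)
open import Data.List.Relation.Binary.Disjoint.Propositional using (Disjoint)
open import Data.List.Relation.Binary.Permutation.Propositional as Perm
  using (_↭_; ↭⇒↭ₛ; ↭-sym; ↭-trans; ↭-refl; ↭-reflexive; ↭-prep; module PermutationReasoning)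
open import Data.List.Relation.Binary.Permutation.Propositional.Properties as Perm
  using (++⁺; ++⁺ˡ; ++⁺ʳ; map⁺; shift; shifts; ↭-length; ∈-resp-↭; filter-↭)
import Data.List.Relation.Binary.Permutation.Setoid.Properties as PermS
open import Data.List.Relation.Binary.Subset.Propositional using (_⊆_)
open import Data.List.Relation.Unary.All as All using (All; []; _∷_)
import Data.List.Relation.Unary.All.Properties as All
open import Data.List.Relation.Unary.Any as Any using (Any; here; there)
import Data.List.Relation.Unary.Any.Properties as Any
open import Data.List.Relation.Unary.Unique.Propositional using (Unique; []; _∷_)
import Data.List.Relation.Unary.Unique.Propositional.Properties as Unique
open import Data.Nat as ℕ
  using (ℕ; zero; suc; pred; _+_; _∸_; _⊓_; _≤_; _<_; _≤ᵇ_; z≤n; s≤s; _≟_; _≤?_; _<?_)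
open import Data.Nat.Induction using (<-rec)
open import Data.Nat.ListAction using (sum)
import Data.Nat.Properties as ℕ
open import Data.Nat.Solver using () renaming (module +-*-Solver to ℕ-Solver)
open import Data.Product using (Σ; ∃; ∃₂; _×_; _,_; proj₁; proj₂)
open import Data.Rational as ℚ using (ℚ; 0ℚ; 1ℚ; ½)
import Data.Rational.Properties as ℚ
open import Data.Rational.Solver using () renaming (module +-*-Solver to ℚ-Solver)
open import Data.Rational.Unnormalised as ℚᵘ using (mkℚᵘ; *≡*; *≤*)
import Data.Rational.Unnormalised.Properties as ℚᵘ
open import Data.Sum using (_⊎_; inj₁; inj₂; [_,_]′)
import Data.Sum.Properties as Sum
open import Data.Unit using (tt)
open import Data.Vec.Functional using (Vector)
import Data.Vec.Functional as Vec
open import Function using (_∘_; id; _⇔_; mk⇔)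
open import Level using (0ℓ)
open import Relation.Binary using (Rel; Decidable; DecidableEquality; Tri; tri<; tri≈; tri>)
open import Relation.Binary.Morphism.Structures using (IsOrderIsomorphism)
open import Relation.Binary.PropositionalEquality
open import Relation.Nullary using (¬_; Dec; does; yes; no; contradiction)
open import Relation.Nullary.Decidable
  using (¬?; _×-dec_; _⊎-dec_; dec-true; dec-false; decidable-stable)
open import Relation.Unary using (Pred)

-- The replacement of a part changes the number of colourings in general, so the colourings of
-- `G(P)` and `G(d)` are not matched one by one. Every coefficient of X counts colourings and
-- nothing cancels; the support therefore depends only on which weights occur, and a colouring may
-- be reduced to the multiset of its pairs of level and colour. Dominance is used in both
-- directions. The prefix sums of every weight, with its colours in any order, are bounded by those
-- of `λᵍʳ`; these bounds are linear, so they survive convex combinations. Conversely, unit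
-- transfers lead from `λᵍʳ` to every vector within the bounds. This descent is proved once for an
-- abstract predicate, which is taken first to be membership in the hull of the rearrangements and
-- then to be the property of being a weight. Equality of Cauchy reals is not decidable, and `supp`
-- is a negation. Colourings are therefore found by searching finite lists, and inequalities between
-- real prefix sums are brought back to naturals at integer points.

open DecMembership _≟_ using (_∈?_)

-- Greedy colouring

module _ {A : Set} where

  unique-⊆⇒length≤ : ∀ {xs ys : List A} → Unique xs → xs ⊆ ys → length xs ≤ length ys
  unique-⊆⇒length≤ {[]}     _          _  = z≤n
  unique-⊆⇒length≤ {x ∷ xs} (x∉ ∷ uxs) ⊆ys with ∈-∃++ (⊆ys (here refl))
  ... | as , bs , refl = begin
    suc (length xs)         ≤⟨ s≤s (unique-⊆⇒length≤ uxs ⊆as++bs) ⟩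
    suc (length (as ++ bs)) ≡⟨ List.length-++-sucʳ as x bs ⟨
    length (as ++ x ∷ bs)   ∎
    where
    open ℕ.≤-Reasoning
    ⊆as++bs : xs ⊆ as ++ bs
    ⊆as++bs z∈xs with ∈-++⁻ as (⊆ys (there z∈xs))
    ... | inj₁ z∈as         = ∈-++⁺ˡ z∈as
    ... | inj₂ (here refl)  = contradiction refl (All.lookup x∉ z∈xs)
    ... | inj₂ (there z∈bs) = ∈-++⁺ʳ as z∈bs

  unique-set⇒↭ : ∀ {xs ys : List A} → Unique xs → Unique ys → xs ⊆ ys → ys ⊆ xs → xs ↭ ys
  unique-set⇒↭ uxs uys xs⊆ys ys⊆xs = ∼bag⇒↭ (unique∧set⇒bag uxs uys (mk⇔ xs⊆ys ys⊆xs))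

-- The local function `search` of `leastAbsent` cannot be named; `searchFor` recovers it by
-- unification.
mutual
  searchFor : List ℕ → ℕ → ℕ → ℕ
  searchFor = _

  leastAbsent≡searchFor : ∀ cs → leastAbsent cs ≡ searchFor cs (length cs) 0
  -- Turning `length cs` and then `0` into variables makes the constraint on the metavariable a
  -- pattern, which unification solves uniquely.
  leastAbsent≡searchFor cs with length cs
  ... | fuel with 0
  ... | c = refl

-- The invariant makes `c` equal to `length cs` when the fuel is spent. If that colour were in the
-- list as well, `suc c` distinct colours would fit into `c` places.
search∉ : ∀ cs fuel c → fuel + c ≡ length cs → (∀ {i} → i < c → i ∈ cs) →
  searchFor cs fuel c ∉ cs
search∉ cs zero c refl below c∈cs = ℕ.1+n≰n (begin
  suc c                   ≡⟨ List.length-upTo (suc c) ⟨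
  length (upTo (suc c))   ≤⟨ unique-⊆⇒length≤ (Unique.upTo⁺ (suc c)) upTo⊆cs ⟩
  length cs               ∎)
  where
  open ℕ.≤-Reasoning
  upTo⊆cs : upTo (suc c) ⊆ cs
  upTo⊆cs i∈ with ℕ.m≤n⇒m<n∨m≡n (ℕ.≤-pred (∈-upTo⁻ i∈))
  ... | inj₁ i<c  = below i<c
  ... | inj₂ refl = c∈cs
search∉ cs (suc fuel) c eq below with c ∈? cs
... | no c∉cs  = c∉cs
... | yes c∈cs = search∉ cs fuel (suc c) (trans (ℕ.+-suc fuel c) eq) below′
  where
  below′ : ∀ {i} → i < suc c → i ∈ cs
  below′ i<1+c with ℕ.m≤n⇒m<n∨m≡n (ℕ.≤-pred i<1+c)
  ... | inj₁ i<c  = below i<c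
  ... | inj₂ refl = c∈cs

<search⇒∈ : ∀ cs fuel c → (∀ {i} → i < c → i ∈ cs) → ∀ {i} → i < searchFor cs fuel c → i ∈ cs
<search⇒∈ cs zero c below = below
<search⇒∈ cs (suc fuel) c below with c ∈? cs
... | no  _    = below
... | yes c∈cs = <search⇒∈ cs fuel (suc c) below′
  where
  below′ : ∀ {i} → i < suc c → i ∈ cs
  below′ i<1+c with ℕ.m≤n⇒m<n∨m≡n (ℕ.≤-pred i<1+c)
  ... | inj₁ i<c  = below i<c
  ... | inj₂ refl = c∈cs

leastAbsent∉ : ∀ cs → leastAbsent cs ∉ cs
leastAbsent∉ cs = subst (_∉ cs) (sym (leastAbsent≡searchFor cs))
  (search∉ cs (length cs) 0 (ℕ.+-identityʳ _) λ ())

<leastAbsent⇒∈ : ∀ cs {c} → c < leastAbsent cs → c ∈ cs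
<leastAbsent⇒∈ cs c< = <search⇒∈ cs (length cs) 0 (λ ()) (subst (_ <_) (leastAbsent≡searchFor cs) c<)

module _ {n} {R : Rel (Fin (suc n)) 0ℓ} (R? : Decidable R) (used : Fin (suc n) → List ℕ) where

  usedAfter0 : Fin n → List ℕ
  usedAfter0 x = if does (R? zero (suc x)) then leastAbsent (used zero) ∷ used (suc x)
                                           else used (suc x)

  ⊆usedAfter0 : ∀ x → used (suc x) ⊆ usedAfter0 x
  ⊆usedAfter0 x c∈ with R? zero (suc x)
  ... | yes _ = there c∈
  ... | no  _ = c∈

  ∈usedAfter0 : ∀ x → R zero (suc x) → leastAbsent (used zero) ∈ usedAfter0 x
  ∈usedAfter0 x r with R? zero (suc x)
  ... | yes _ = here refl
  ... | no ¬r = contradiction r ¬r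

  ∈usedAfter0⁻ : ∀ x {c} → c ∈ usedAfter0 x →
    (R zero (suc x) × c ≡ leastAbsent (used zero)) ⊎ c ∈ used (suc x)
  ∈usedAfter0⁻ x c∈ with R? zero (suc x) | c∈
  ... | yes r | here eq  = inj₁ (r , eq)
  ... | yes _ | there c∈ = inj₂ c∈
  ... | no  _ | c∈       = inj₂ c∈

-- The list `used` has to stay arbitrary: the recursion deletes vertex `zero`, whose colour survives
-- only as an entry of `used`.
greedyFrom∉used : ∀ {n} {R : Rel (Fin n) 0ℓ} (R? : Decidable R) used w →
  greedyFrom R? used w ∉ used w
greedyFrom∉used R? used zero    = leastAbsent∉ (used zero)
greedyFrom∉used R? used (suc w) = greedyFrom∉used _ (usedAfter0 R? used) w ∘ ⊆usedAfter0 R? used w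

greedyFrom-proper : ∀ {n} {R : Rel (Fin n) 0ℓ} (R? : Decidable R) used {u w} →
  u Fin.< w → R u w → greedyFrom R? used u ≢ greedyFrom R? used w
greedyFrom-proper R? used {zero} {suc w} _ r eq =
  greedyFrom∉used _ (usedAfter0 R? used) w (subst (_∈ usedAfter0 R? used w) eq (∈usedAfter0 R? used w r))
greedyFrom-proper R? used {suc u} {suc w} (s≤s u<w) r = greedyFrom-proper _ (usedAfter0 R? used) u<w r

greedyFrom-first : ∀ {n} {R : Rel (Fin n) 0ℓ} (R? : Decidable R) used w {c} →
  c < greedyFrom R? used w →
  c ∈ used w ⊎ ∃ λ u → u Fin.< w × R u w × greedyFrom R? used u ≡ c
greedyFrom-first R? used zero    c< = inj₁ (<leastAbsent⇒∈ (used zero) c<)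
greedyFrom-first R? used (suc w) c< with greedyFrom-first _ (usedAfter0 R? used) w c<
... | inj₂ (u , u<w , r , eq) = inj₂ (suc u , s≤s u<w , r , eq)
... | inj₁ c∈ with ∈usedAfter0⁻ R? used w c∈
...   | inj₁ (r , refl) = inj₂ (zero , s≤s z≤n , r , refl)
...   | inj₂ c∈used     = inj₁ c∈used

-- Sequences and colour counts

-- The last term is split off because the inductions run over growing prefixes; `sum` splits off the
-- first one, and `Σ<-front` mediates.
Σ< : (ℕ → ℕ) → ℕ → ℕ
Σ< γ zero    = 0
Σ< γ (suc m) = Σ< γ m + γ m

Σ<-front : ∀ γ m → Σ< γ (suc m) ≡ γ 0 + Σ< (γ ∘ suc) m
Σ<-front γ zero    = ℕ.+-comm 0 (γ 0)
Σ<-front γ (suc m) = trans (cong (_+ γ (suc m)) (Σ<-front γ m)) (ℕ.+-assoc (γ 0) _ _)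

sum-applyUpTo : ∀ γ m → sum (applyUpTo γ m) ≡ Σ< γ m
sum-applyUpTo γ zero    = refl
sum-applyUpTo γ (suc m) = trans (cong (γ 0 +_) (sum-applyUpTo (γ ∘ suc) m)) (sym (Σ<-front γ m))

Σ<-cong : ∀ {γ δ} m → (∀ c → c < m → γ c ≡ δ c) → Σ< γ m ≡ Σ< δ m
Σ<-cong zero    eq = refl
Σ<-cong (suc m) eq = cong₂ _+_ (Σ<-cong m λ c c<m → eq c (ℕ.m<n⇒m<1+n c<m)) (eq m ℕ.≤-refl)

Σ<-mono : ∀ {γ δ} m → (∀ c → c < m → γ c ≤ δ c) → Σ< γ m ≤ Σ< δ m
Σ<-mono zero    le = z≤n
Σ<-mono (suc m) le = ℕ.+-mono-≤ (Σ<-mono m λ c c<m → le c (ℕ.m<n⇒m<1+n c<m)) (le m ℕ.≤-refl)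

Σ<-strict : ∀ {γ δ} m {i} → i < m → γ i < δ i → (∀ c → c < m → γ c ≤ δ c) → Σ< γ m < Σ< δ m
Σ<-strict (suc m) i<1+m lt le with ℕ.m≤n⇒m<n∨m≡n (ℕ.≤-pred i<1+m)
... | inj₁ i<m  = ℕ.+-mono-<-≤ (Σ<-strict m i<m lt λ c c<m → le c (ℕ.m<n⇒m<1+n c<m)) (le m ℕ.≤-refl)
... | inj₂ refl = ℕ.+-mono-≤-< (Σ<-mono m λ c c<m → le c (ℕ.m<n⇒m<1+n c<m)) lt

Σ<-+ : ∀ γ δ m → Σ< (λ c → γ c + δ c) m ≡ Σ< γ m + Σ< δ m
Σ<-+ γ δ zero    = refl
Σ<-+ γ δ (suc m) = trans (cong (_+ (γ m + δ m)) (Σ<-+ γ δ m))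
  (ℕ-Solver.solve 4 (λ p q r s → (p :+ q) :+ (r :+ s) := (p :+ r) :+ (q :+ s)) refl
    (Σ< γ m) (Σ< δ m) (γ m) (δ m))
  where open ℕ-Solver

Σ<-suc : ∀ γ m → Σ< (suc ∘ γ) m ≡ m + Σ< γ m
Σ<-suc γ zero    = refl
Σ<-suc γ (suc m) = trans (cong (_+ suc (γ m)) (Σ<-suc γ m))
  (trans (ℕ.+-suc _ (γ m)) (cong suc (ℕ.+-assoc m _ (γ m))))

Σ<-mono-index : ∀ γ {l m} → l ≤ m → Σ< γ l ≤ Σ< γ m
Σ<-mono-index γ {m = zero} z≤n = z≤n
Σ<-mono-index γ {l} {suc m} l≤ with ℕ.m≤n⇒m<n∨m≡n l≤
... | inj₁ l<   = ℕ.≤-trans (Σ<-mono-index γ (ℕ.≤-pred l<)) (ℕ.m≤m+n _ _)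
... | inj₂ refl = ℕ.≤-refl

𝟙 : {P : Set} → Dec P → ℕ
𝟙 d = if does d then 1 else 0

𝟙-true : ∀ {P : Set} (d : Dec P) → P → 𝟙 d ≡ 1
𝟙-true (yes _) _ = refl
𝟙-true (no ¬p) p = contradiction p ¬p

𝟙-false : ∀ {P : Set} (d : Dec P) → ¬ P → 𝟙 d ≡ 0
𝟙-false (yes p) ¬p = contradiction p ¬p
𝟙-false (no _)  _  = refl

𝟙-cong : ∀ {P Q : Set} (d : Dec P) (e : Dec Q) → (P → Q) → (Q → P) → 𝟙 d ≡ 𝟙 e
𝟙-cong (yes p) e to from = sym (𝟙-true e (to p))
𝟙-cong (no ¬p) e to from = sym (𝟙-false e (¬p ∘ from))

Σ<-𝟙 : ∀ a m → Σ< (λ c → 𝟙 (a ≟ c)) m ≡ 𝟙 (a <? m)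
Σ<-𝟙 a zero    = refl
Σ<-𝟙 a (suc m) = trans (cong (_+ 𝟙 (a ≟ m)) (Σ<-𝟙 a m)) (cases (ℕ.<-cmp a m))
  where
  cases : Tri (a < m) (a ≡ m) (m < a) → 𝟙 (a <? m) + 𝟙 (a ≟ m) ≡ 𝟙 (a <? suc m)
  cases (tri< a<m a≢m _) = trans (cong₂ _+_ (𝟙-true (a <? m) a<m) (𝟙-false (a ≟ m) a≢m))
    (sym (𝟙-true (a <? suc m) (ℕ.m<n⇒m<1+n a<m)))
  cases (tri≈ a≮m refl _) = trans (cong₂ _+_ (𝟙-false (a <? m) a≮m) (𝟙-true (a ≟ m) refl))
    (sym (𝟙-true (a <? suc m) ℕ.≤-refl))
  cases (tri> a≮m a≢m m<a) = trans (cong₂ _+_ (𝟙-false (a <? m) a≮m) (𝟙-false (a ≟ m) a≢m))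
    (sym (𝟙-false (a <? suc m) (ℕ.<⇒≱ (s≤s m<a))))

-- Colourings are functions on all of `ℕ` here, so that one `f` can be counted on prefixes of every
-- length `N`.
count : (ℕ → ℕ) → ℕ → ℕ → ℕ
count f N c = Σ< (λ u → 𝟙 (f u ≟ c)) N

module _ (f : ℕ → ℕ) where

  count-∈ : ∀ {N c} → f N ≡ c → count f (suc N) c ≡ suc (count f N c)
  count-∈ {N} {c} eq = trans (cong (count f N c +_) (𝟙-true (f N ≟ c) eq)) (ℕ.+-comm _ 1)

  count-∉ : ∀ {N c} → f N ≢ c → count f (suc N) c ≡ count f N c
  count-∉ {N} {c} neq = trans (cong (count f N c +_) (𝟙-false (f N ≟ c) neq)) (ℕ.+-identityʳ _)

  count-mono : ∀ c {M N} → M ≤ N → count f M c ≤ count f N c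
  count-mono c = Σ<-mono-index _

  count-hit : ∀ {c M u N} → M ≤ u → u < N → f u ≡ c → count f M c < count f N c
  count-hit {c} {M} {u} {N} M≤u u<N eq = begin-strict
    count f M c       ≤⟨ count-mono c M≤u ⟩
    count f u c       <⟨ ℕ.n<1+n _ ⟩
    suc (count f u c) ≡⟨ count-∈ eq ⟨
    count f (suc u) c ≤⟨ count-mono c u<N ⟩
    count f N c       ∎
    where open ℕ.≤-Reasoning

  count-avoid : ∀ c {M N} → M ≤ N → (∀ u → M ≤ u → u < N → f u ≢ c) → count f N c ≡ count f M c
  count-avoid c {N = zero} z≤n avoid = refl
  count-avoid c {M} {suc N} M≤ avoid with ℕ.m≤n⇒m<n∨m≡n M≤
  ... | inj₂ refl = refl
  ... | inj₁ M<   = trans (count-∉ (avoid N (ℕ.≤-pred M<) ℕ.≤-refl))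
    (count-avoid c (ℕ.≤-pred M<) λ u M≤u u<N → avoid u M≤u (ℕ.m<n⇒m<1+n u<N))

  count-atMostOne : ∀ c {M N} → M ≤ N →
    (∀ {i j} → M ≤ i → i < j → j < N → f i ≡ c → f j ≢ c) → count f N c ≤ suc (count f M c)
  count-atMostOne c {N = zero} z≤n _ = z≤n
  count-atMostOne c {M} {suc N} M≤ one with ℕ.m≤n⇒m<n∨m≡n M≤ | f N ≟ c
  ... | inj₂ refl | _      = ℕ.n≤1+n _
  ... | inj₁ M<   | yes eq = ℕ.≤-reflexive (trans (count-∈ eq)
    (cong suc (count-avoid c (ℕ.≤-pred M<) λ u M≤u u<N fu≡c → one M≤u u<N ℕ.≤-refl fu≡c eq)))
  ... | inj₁ M<   | no neq = subst (_≤ suc (count f M c)) (sym (count-∉ neq))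
    (count-atMostOne c (ℕ.≤-pred M<) λ M≤i i<j j<N → one M≤i i<j (ℕ.m<n⇒m<1+n j<N))

  Σ<-count-suc : ∀ N m → Σ< (count f (suc N)) m ≡ Σ< (count f N) m + 𝟙 (f N <? m)
  Σ<-count-suc N m = trans (Σ<-+ (count f N) (λ c → 𝟙 (f N ≟ c)) m) (cong (Σ< (count f N) m +_) (Σ<-𝟙 (f N) m))

  Σ<-count≤ : ∀ N m → Σ< (count f N) m ≤ N
  Σ<-count≤ zero    m = ℕ.≤-reflexive (zeros m)
    where
    zeros : ∀ m → Σ< (λ _ → 0) m ≡ 0
    zeros zero    = refl
    zeros (suc m) = trans (ℕ.+-identityʳ _) (zeros m)
  Σ<-count≤ (suc N) m = begin
    Σ< (count f (suc N)) m            ≡⟨ Σ<-count-suc N m ⟩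
    Σ< (count f N) m + 𝟙 (f N <? m)   ≤⟨ ℕ.+-mono-≤ (Σ<-count≤ N m) (𝟙≤1 (f N <? m)) ⟩
    N + 1                             ≡⟨ ℕ.+-comm N 1 ⟩
    suc N                             ∎
    where
    open ℕ.≤-Reasoning
    𝟙≤1 : ∀ {P : Set} (d : Dec P) → 𝟙 d ≤ 1
    𝟙≤1 (yes _) = ℕ.≤-refl
    𝟙≤1 (no _)  = z≤n

  Σ<-count-all : ∀ N m → (∀ u → u < N → f u < m) → Σ< (count f N) m ≡ N
  Σ<-count-all zero    m _   = ℕ.n≤0⇒n≡0 (Σ<-count≤ zero m)
  Σ<-count-all (suc N) m all = trans (Σ<-count-suc N m)
    (trans (cong₂ _+_ (Σ<-count-all N m λ u u<N → all u (ℕ.m<n⇒m<1+n u<N))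
                      (𝟙-true (f N <? m) (all N ℕ.≤-refl)))
           (ℕ.+-comm N 1))

-- Serves two purposes. For a weight vector the padding by 0 is the right continuation; for a
-- colouring it is a dummy colour that no count sees, as counting stops at `n`.
ext : ∀ {n} → (Fin n → ℕ) → ℕ → ℕ
ext {zero}  f _       = 0
ext {suc n} f zero    = f zero
ext {suc n} f (suc i) = ext (f ∘ suc) i

ext-toℕ : ∀ {n} (f : Fin n → ℕ) i → ext f (toℕ i) ≡ f i
ext-toℕ f zero    = refl
ext-toℕ f (suc i) = ext-toℕ (f ∘ suc) i

ext-beyond : ∀ {n} (f : Fin n → ℕ) {i} → n ≤ i → ext f i ≡ 0
ext-beyond {zero}  f n≤i       = refl
ext-beyond {suc n} f (s≤s n≤i) = ext-beyond (f ∘ suc) n≤i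

ext-cong : ∀ {n} {f g : Fin n → ℕ} → f ≗ g → ext f ≗ ext g
ext-cong {zero}  eq _       = refl
ext-cong {suc n} eq zero    = eq zero
ext-cong {suc n} eq (suc i) = ext-cong (eq ∘ suc) i

wt≡count : ∀ {n} (f : Fin n → ℕ) c → wt f c ≡ count (ext f) n c
wt≡count f c = go f id
  where
  go : ∀ {m n} (f : Fin m → ℕ) (g : Fin n → Fin m) →
    length (filter (λ u → f u ≟ c) (tabulate g)) ≡ count (ext (f ∘ g)) n c
  go {n = zero}  f g = refl
  go {n = suc n} f g = trans head (trans (cong (𝟙 (f (g zero) ≟ c) +_) (go f (g ∘ suc)))
      (sym (Σ<-front (λ u → 𝟙 (ext (f ∘ g) u ≟ c)) n)))
    where
    head : length (filter (λ u → f u ≟ c) (tabulate g))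
         ≡ 𝟙 (f (g zero) ≟ c) + length (filter (λ u → f u ≟ c) (tabulate (g ∘ suc)))
    head with f (g zero) ℕ.≡ᵇ c
    ... | true  = refl
    ... | false = refl

module _ {P : ℕ → Set} (P? : ∀ u → Dec (P u)) where

  leastWith : ∀ n → P n → ∃ λ a → a ≤ n × P a × (∀ u → u < a → ¬ P u)
  leastWith = <-rec _ λ n rec Pn → search n rec Pn (Fin.any? λ (i : Fin n) → P? (toℕ i))
    where
    search : ∀ n → (∀ {m} → m < n → P m → ∃ λ a → a ≤ m × P a × (∀ u → u < a → ¬ P u)) → P n →
      Dec (∃ λ (i : Fin n) → P (toℕ i)) → ∃ λ a → a ≤ n × P a × (∀ u → u < a → ¬ P u)
    search n rec Pn (yes (i , Pi)) with rec (Fin.toℕ<n i) Pi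
    ... | a , a≤i , Pa , least = a , ℕ.≤-trans a≤i (ℕ.<⇒≤ (Fin.toℕ<n i)) , Pa , least
    search n rec Pn (no none) = n , ℕ.≤-refl , Pn , λ u u<n Pu →
      none (Fin.fromℕ< u<n , subst P (sym (Fin.toℕ-fromℕ< u<n)) Pu)

  lastWith : ∀ n → P 0 → ∃ λ a → a ≤ n × P a × (∀ u → a < u → u ≤ n → ¬ P u)
  lastWith zero    P0 = 0 , z≤n , P0 , λ u 0<u u≤0 → contradiction u≤0 (ℕ.<⇒≱ 0<u)
  lastWith (suc n) P0 with P? (suc n) | lastWith n P0
  ... | yes Pn | _ = suc n , ℕ.≤-refl , Pn , λ u n<u u≤n → contradiction u≤n (ℕ.<⇒≱ n<u)
  ... | no ¬Pn | a , a≤n , Pa , last = a , ℕ.m≤n⇒m≤1+n a≤n , Pa , last′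
    where
    last′ : ∀ u → a < u → u ≤ suc n → ¬ P u
    last′ u a<u u≤ with ℕ.m≤n⇒m<n∨m≡n u≤
    ... | inj₁ u<   = last u a<u (ℕ.≤-pred u<)
    ... | inj₂ refl = ¬Pn

swap : ℕ → ℕ → ℕ → ℕ
swap a a′ c with c ≟ a
... | yes _ = a′
... | no  _ with c ≟ a′
...   | yes _ = a
...   | no  _ = c

swap-left : ∀ a a′ → swap a a′ a ≡ a′
swap-left a a′ with a ≟ a
... | yes _  = refl
... | no neq = contradiction refl neq

swap-right : ∀ a a′ → swap a a′ a′ ≡ a
swap-right a a′ with a′ ≟ a
... | yes b≡a = b≡a
... | no _ with a′ ≟ a′
...   | yes _  = refl
...   | no neq = contradiction refl neq

swap-other : ∀ {a a′ c} → c ≢ a → c ≢ a′ → swap a a′ c ≡ c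
swap-other {a} {a′} {c} c≢a c≢b with c ≟ a
... | yes eq = contradiction eq c≢a
... | no _ with c ≟ a′
...   | yes eq = contradiction eq c≢b
...   | no _   = refl

swap-involutive : ∀ a a′ c → swap a a′ (swap a a′ c) ≡ c
swap-involutive a a′ c with c ≟ a
... | yes refl = swap-right a a′
... | no c≢a with c ≟ a′
...   | yes refl = swap-left a a′
...   | no c≢b   = swap-other c≢a c≢b

swap-injective : ∀ {a a′ c d} → swap a a′ c ≡ swap a a′ d → c ≡ d
swap-injective {a} {a′} {c} {d} eq =
  trans (sym (swap-involutive a a′ c)) (trans (cong (swap a a′) eq) (swap-involutive a a′ d))

𝟙-swap : ∀ a a′ d c → 𝟙 (swap a a′ d ≟ c) ≡ 𝟙 (d ≟ swap a a′ c)
𝟙-swap a a′ d c = 𝟙-cong (_ ≟ _) (_ ≟ _)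
  (λ eq → trans (sym (swap-involutive a a′ d)) (cong (swap a a′) eq))
  (λ eq → trans (cong (swap a a′) eq) (swap-involutive a a′ c))

count-swap : ∀ a a′ f N c → count (swap a a′ ∘ f) N c ≡ count f N (swap a a′ c)
count-swap a a′ f N c = Σ<-cong N λ u _ → 𝟙-swap a a′ (f u) c

-- One unit moves from `a` to `a′`. The truncation in `pred` is harmless, since transfers are made
-- only where `γ a` is positive.
transfer : ℕ → ℕ → (ℕ → ℕ) → ℕ → ℕ
transfer a a′ γ c with c ≟ a
... | yes _ = pred (γ c)
... | no  _ with c ≟ a′
...   | yes _ = suc (γ c)
...   | no  _ = γ c

transfer-left : ∀ a a′ γ → transfer a a′ γ a ≡ pred (γ a)
transfer-left a a′ γ with a ≟ a
... | yes _  = refl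
... | no neq = contradiction refl neq

transfer-right : ∀ {a a′} γ → a′ ≢ a → transfer a a′ γ a′ ≡ suc (γ a′)
transfer-right {a} {a′} γ b≢a with a′ ≟ a
... | yes b≡a = contradiction b≡a b≢a
... | no _ with a′ ≟ a′
...   | yes _  = refl
...   | no neq = contradiction refl neq

transfer-other : ∀ {a a′ c} γ → c ≢ a → c ≢ a′ → transfer a a′ γ c ≡ γ c
transfer-other {a} {a′} {c} γ c≢a c≢b with c ≟ a
... | yes eq = contradiction eq c≢a
... | no _ with c ≟ a′
...   | yes eq = contradiction eq c≢b
...   | no _   = refl

-- Proper and first-fit colourings of unit interval graphs

module UnitInterval (n : ℕ) (h : ℕ → ℕ) (h-step : ∀ i → h i ≤ h (suc i)) where

  h-mono : ∀ {i j} → i ≤ j → h i ≤ h j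
  h-mono {j = zero} z≤n = ℕ.≤-refl
  h-mono {i} {suc j} i≤ with ℕ.m≤n⇒m<n∨m≡n i≤
  ... | inj₁ i<   = ℕ.≤-trans (h-mono (ℕ.≤-pred i<)) (h-step j)
  ... | inj₂ refl = ℕ.≤-refl

  -- The edges are the pairs `i < j < h i`. By `h-mono` an edge from `i` to `j` makes the whole
  -- interval from `i` to `j` a clique.
  IsProper : (ℕ → ℕ) → Set
  IsProper f = ∀ {i j} → i < j → j < n → j < h i → f i ≢ f j

  IsFirstFit : (ℕ → ℕ) → Set
  IsFirstFit g = ∀ {u c} → u < n → c < g u → ∃ λ i → i < u × u < h i × g i ≡ c

  module _ {f g : ℕ → ℕ} (f-proper : IsProper f) (g-first : IsFirstFit g) (m : ℕ) where

    -- If u gets a colour below m from f but not from g, then the neighbours of u before u form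
    -- an interval on which g uses each of the m colours, while f uses each at most once on that
    -- interval and u together.
    firstFit-dominates : ∀ N → N ≤ n → Σ< (count f N) m ≤ Σ< (count g N) m
    firstFit-dominates = <-rec _ step
      where
      open ℕ.≤-Reasoning
      step : ∀ N → (∀ {M} → M < N → M ≤ n → Σ< (count f M) m ≤ Σ< (count g M) m) →
        N ≤ n → Σ< (count f N) m ≤ Σ< (count g N) m
      step zero    _   _   = ℕ.≤-refl
      step (suc u) rec u<n with f u <? m | g u <? m
      ... | no f≥ | _ = begin
        Σ< (count f (suc u)) m ≡⟨ Σ<-count-suc f u m ⟩
        Σ< (count f u) m + 𝟙 (f u <? m) ≡⟨ cong (Σ< (count f u) m +_) (𝟙-false (f u <? m) f≥) ⟩
        Σ< (count f u) m + 0   ≡⟨ ℕ.+-identityʳ _ ⟩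
        Σ< (count f u) m       ≤⟨ rec ℕ.≤-refl (ℕ.<⇒≤ u<n) ⟩
        Σ< (count g u) m       ≤⟨ Σ<-mono m (λ c _ → count-mono g c (ℕ.n≤1+n u)) ⟩
        Σ< (count g (suc u)) m ∎
      ... | yes f< | yes g< = begin
        Σ< (count f (suc u)) m ≡⟨ Σ<-count-suc f u m ⟩
        Σ< (count f u) m + 𝟙 (f u <? m) ≡⟨ cong (Σ< (count f u) m +_) (𝟙-true (f u <? m) f<) ⟩
        Σ< (count f u) m + 1   ≤⟨ ℕ.+-monoˡ-≤ 1 (rec ℕ.≤-refl (ℕ.<⇒≤ u<n)) ⟩
        Σ< (count g u) m + 1   ≡⟨ cong (Σ< (count g u) m +_) (𝟙-true (g u <? m) g<) ⟨
        Σ< (count g u) m + 𝟙 (g u <? m) ≡⟨ Σ<-count-suc g u m ⟨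
        Σ< (count g (suc u)) m ∎
      -- `a` is the first vertex of the closed neighbourhood of `u`; the disjunct `i ≟ u` guarantees
      -- that the search succeeds.
      ... | yes _ | no g≥ with leastWith (λ i → (i ≟ u) ⊎-dec (u <? h i)) u (inj₁ refl)
      ...   | a , a≤u , Pa , least = begin
        Σ< (count f (suc u)) m    ≤⟨ Σ<-mono m (λ c _ → count-atMostOne f c (ℕ.m≤n⇒m≤1+n a≤u) (one c)) ⟩
        Σ< (suc ∘ count f a) m    ≡⟨ Σ<-suc (count f a) m ⟩
        m + Σ< (count f a) m      ≤⟨ ℕ.+-monoʳ-≤ m (rec (s≤s a≤u) (ℕ.≤-trans a≤u (ℕ.<⇒≤ u<n))) ⟩
        m + Σ< (count g a) m      ≡⟨ Σ<-suc (count g a) m ⟨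
        Σ< (suc ∘ count g a) m    ≤⟨ Σ<-mono m hit ⟩
        Σ< (count g u) m          ≤⟨ Σ<-mono m (λ c _ → count-mono g c (ℕ.n≤1+n u)) ⟩
        Σ< (count g (suc u)) m    ∎
        where
        u<ha : ∀ {i} → a ≤ i → i < u → u < h i
        u<ha a≤i i<u =
          [ (λ a≡u → contradiction (subst (_≤ _) a≡u a≤i) (ℕ.<⇒≱ i<u))
          , (λ u<ha → ℕ.<-≤-trans u<ha (h-mono a≤i)) ]′ Pa
        one : ∀ c {i j} → a ≤ i → i < j → j < suc u → f i ≡ c → f j ≢ c
        one c a≤i i<j j<1+u fi fj = f-proper i<j (ℕ.<-≤-trans j<1+u u<n)
          (ℕ.≤-<-trans (ℕ.≤-pred j<1+u) (u<ha a≤i (ℕ.<-≤-trans i<j (ℕ.≤-pred j<1+u))))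
          (trans fi (sym fj))
        hit : ∀ c → c < m → count g a c < count g u c
        hit c c<m with g-first u<n (ℕ.<-≤-trans c<m (ℕ.≮⇒≥ g≥))
        ... | i , i<u , u<hi , gi = count-hit g (ℕ.≮⇒≥ λ i<a → least i i<a (inj₂ u<hi)) i<u gi

  swap-proper : ∀ a a′ {f} → IsProper f → IsProper (swap a a′ ∘ f)
  swap-proper a a′ f-proper i<j j<n j<hi = f-proper i<j j<n j<hi ∘ swap-injective

  -- Exchanging the colours `c` and `suc c` in `g` gives another proper colouring, which `g`
  -- dominates. The first `c` classes agree, so the bound on `suc c` classes compares the next ones.
  firstFit-nonincreasing : ∀ {g} → IsProper g → IsFirstFit g → ∀ c → count g n (suc c) ≤ count g n c
  firstFit-nonincreasing {g} g-proper g-first c = ℕ.+-cancelˡ-≤ (Σ< (count g n) c) _ _ (begin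
    Σ< (count g n) c + count g n (suc c)
      ≡⟨ cong₂ _+_ (Σ<-cong c λ d d<c → sym (trans (count-swap c (suc c) g n d)
           (cong (count g n) (swap-other (ℕ.<⇒≢ d<c) (ℕ.<⇒≢ (ℕ.m<n⇒m<1+n d<c))))))
         (sym (trans (count-swap c (suc c) g n c) (cong (count g n) (swap-left c (suc c))))) ⟩
    Σ< (count (swap c (suc c) ∘ g) n) (suc c)
      ≤⟨ firstFit-dominates (swap-proper c (suc c) g-proper) g-first (suc c) n ℕ.≤-refl ⟩
    Σ< (count g n) c + count g n c ∎)
    where open ℕ.≤-Reasoning

  HasColouring : (ℕ → ℕ) → Set
  HasColouring γ = ∃ λ f → IsProper f × count f n ≗ γ

  -- Let p be the last position before which the excess of a over a′ is at most its final value
  -- minus 2. Then p has colour a, and exchanging a and a′ after p moves one vertex from a to a′. No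
  -- edge across the cut joins the two colours: the interval property of the graph would make such an edge
  -- put a second position of low excess after p.
  module Balance {f} (f-proper : IsProper f) {a a′} (a≢b : a ≢ a′)
    (big : 2 + count f n a′ ≤ count f n a) where

    -- This is `count f u a − count f u a′ ≤ count f n a − count f n a′ − 2`, rearranged to avoid
    -- truncated subtraction.
    Low : ℕ → Set
    Low u = count f u a + (2 + count f n a′) ≤ count f n a + count f u a′

    low-0 : Low 0
    low-0 = subst (2 + count f n a′ ≤_) (sym (ℕ.+-identityʳ _)) big

    ¬low-n : ¬ Low n
    ¬low-n le = ℕ.1+n≰n (ℕ.m+n≤o⇒n≤o 1 (ℕ.+-cancelˡ-≤ (count f n a) _ _ le))

    lastLow : ∃ λ p → p ≤ n × Low p × (∀ u → p < u → u ≤ n → ¬ Low u)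
    lastLow = lastWith (λ u → _ ≤? _) n low-0

    p : ℕ
    p = proj₁ lastLow
    low-p : Low p
    low-p = proj₁ (proj₂ (proj₂ lastLow))
    p<n : p < n
    p<n with ℕ.m≤n⇒m<n∨m≡n (proj₁ (proj₂ lastLow))
    ... | inj₁ p<n = p<n
    ... | inj₂ p≡n = contradiction (subst Low p≡n low-p) ¬low-n
    ¬low-after : ∀ u → p < u → u ≤ n → ¬ Low u
    ¬low-after = proj₂ (proj₂ (proj₂ lastLow))

    fp≡a : f p ≡ a
    fp≡a with f p ≟ a
    ... | yes eq = eq
    ... | no neq = contradiction
      (subst (λ z → z + (2 + count f n a′) ≤ count f n a + count f (suc p) a′) (sym (count-∉ f neq))
        (ℕ.≤-trans low-p (ℕ.+-monoʳ-≤ (count f n a) (count-mono f a′ (ℕ.n≤1+n p)))))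
      (¬low-after (suc p) ℕ.≤-refl p<n)

    -- Position `p` raises the excess by exactly 1 and thereby ends lowness, so the bound in `Low`
    -- is attained at `p`.
    tight : count f p a + (2 + count f n a′) ≡ count f n a + count f p a′
    tight = ℕ.≤-antisym low-p (ℕ.≤-pred (begin
      suc (count f n a + count f p a′)       ≡⟨ cong (λ z → suc (count f n a + z)) (count-∉ f fp≢b) ⟨
      suc (count f n a + count f (suc p) a′) ≤⟨ ℕ.≰⇒> (¬low-after (suc p) ℕ.≤-refl p<n) ⟩
      count f (suc p) a + (2 + count f n a′) ≡⟨ cong (_+ (2 + count f n a′)) (count-∈ f fp≡a) ⟩
      suc (count f p a + (2 + count f n a′)) ∎))
      where
      open ℕ.≤-Reasoning
      fp≢b : f p ≢ a′
      fp≢b fp≡b = a≢b (trans (sym fp≡a) fp≡b)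

    fp≢b : f p ≢ a′
    fp≢b fp≡b = a≢b (trans (sym fp≡a) fp≡b)

    f′ : ℕ → ℕ
    f′ u with u ≤? p
    ... | yes _ = f u
    ... | no  _ = swap a a′ (f u)

    f′-≤ : ∀ {u} → u ≤ p → f′ u ≡ f u
    f′-≤ {u} u≤p with u ≤? p
    ... | yes _   = refl
    ... | no  u≰p = contradiction u≤p u≰p

    f′-> : ∀ {u} → p < u → f′ u ≡ swap a a′ (f u)
    f′-> {u} p<u with u ≤? p
    ... | yes u≤p = contradiction u≤p (ℕ.<⇒≱ p<u)
    ... | no  _   = refl

    f′-proper : IsProper f′
    f′-proper {i} {j} i<j j<n j<hi eq with j ≤? p | i ≤? p
    ... | yes j≤p | yes i≤p = f-proper i<j j<n j<hi eq
    ... | yes j≤p | no  i≰p = i≰p (ℕ.≤-trans (ℕ.<⇒≤ i<j) j≤p)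
    ... | no  j≰p | no  i≰p = f-proper i<j j<n j<hi (swap-injective eq)
    ... | no  j≰p | yes i≤p with f j ≟ a
    -- Here `i ≤ p < j < h i ≤ h p`, so `p` and `j` are adjacent and cannot both have colour `a`.
    ...   | yes fj≡a = f-proper p<j j<n (ℕ.<-≤-trans j<hi (h-mono i≤p)) (trans fp≡a (sym fj≡a))
      where p<j = ℕ.≰⇒> j≰p
    ...   | no  fj≢a with f j ≟ a′
    ...     | no  fj≢b = f-proper i<j j<n j<hi eq
    ...     | yes fj≡b with ℕ.m≤n⇒m<n∨m≡n i≤p
    -- The clash means `f i ≡ a`. Lying between `i` and `j`, the position `p` is a neighbour of `i`,
    -- and it has colour `a` too.
    ...       | inj₁ i<p  = f-proper i<p p<n (ℕ.<-trans (ℕ.≰⇒> j≰p) j<hi) (trans eq (sym fp≡a))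
    -- All positions after `p` up to `j` are neighbours of `p`, so none of them has colour `a`,
    -- while `j` has colour `a′`. The excess after `j` is thus back to at most its value at `p`.
    ...       | inj₂ refl = ¬low-after (suc j) (ℕ.m<n⇒m<1+n i<j) j<n (begin
      count f (suc j) a + (2 + count f n a′)  ≡⟨ cong (_+ (2 + count f n a′)) (count-avoid f a (ℕ.m<n⇒m<1+n i<j) avoid) ⟩
      count f (suc p) a + (2 + count f n a′)  ≡⟨ cong (_+ (2 + count f n a′)) (count-∈ f fp≡a) ⟩
      suc (count f p a + (2 + count f n a′))  ≡⟨ cong suc tight ⟩
      suc (count f n a + count f p a′)        ≡⟨ ℕ.+-suc _ _ ⟨
      count f n a + suc (count f p a′)        ≤⟨ ℕ.+-monoʳ-≤ _ (count-hit f (ℕ.<⇒≤ i<j) ℕ.≤-refl fj≡b) ⟩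
      count f n a + count f (suc j) a′        ∎)
      where
      open ℕ.≤-Reasoning
      avoid : ∀ u → suc p ≤ u → u < suc j → f u ≢ a
      avoid u p<u u<1+j fu≡a = f-proper p<u (ℕ.≤-<-trans (ℕ.≤-pred u<1+j) j<n)
        (ℕ.≤-<-trans (ℕ.≤-pred u<1+j) j<hi) (trans fp≡a (sym fu≡a))

    -- Beyond the cut, the class of `c` under `f′` is the class of `swap a a′ c` under `f`. Counts
    -- beyond the cut are differences of prefix counts, so each side is completed by the prefix it
    -- lacks.
    count-f′ : ∀ c {N} → suc p ≤ N →
      count f′ N c + count f (suc p) (swap a a′ c) ≡ count f (suc p) c + count f N (swap a a′ c)
    count-f′ c {suc N} p<N with ℕ.m≤n⇒m<n∨m≡n p<N
    ... | inj₂ refl = cong (_+ count f (suc p) (swap a a′ c))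
      (Σ<-cong (suc p) λ u u<1+p → cong (λ z → 𝟙 (z ≟ c)) (f′-≤ (ℕ.≤-pred u<1+p)))
    ... | inj₁ p<  = begin
      count f′ N c + 𝟙 (f′ N ≟ c) + S
        ≡⟨ cong (λ z → count f′ N c + z + S)
             (trans (cong (λ z → 𝟙 (z ≟ c)) (f′-> (ℕ.≤-pred p<))) (𝟙-swap a a′ (f N) c)) ⟩
      count f′ N c + 𝟙 (f N ≟ swap a a′ c) + S
        ≡⟨ ℕ-Solver.solve 3 (λ x y z → (x :+ y) :+ z := (x :+ z) :+ y) refl
             (count f′ N c) (𝟙 (f N ≟ swap a a′ c)) S ⟩
      count f′ N c + S + 𝟙 (f N ≟ swap a a′ c)
        ≡⟨ cong (_+ 𝟙 (f N ≟ swap a a′ c)) (count-f′ c (ℕ.≤-pred p<)) ⟩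
      count f (suc p) c + count f N (swap a a′ c) + 𝟙 (f N ≟ swap a a′ c)
        ≡⟨ ℕ.+-assoc (count f (suc p) c) _ _ ⟩
      count f (suc p) c + count f (suc N) (swap a a′ c) ∎
      where
      open ≡-Reasoning
      open ℕ-Solver
      S = count f (suc p) (swap a a′ c)

    private
      A B Ap Bp : ℕ
      A  = count f n a
      B  = count f n a′
      Ap = count f p a
      Bp = count f p a′

    count-f′-a : suc (count f′ n a) ≡ A
    count-f′-a = ℕ.+-cancelʳ-≡ Bp _ _ (begin
      suc (count f′ n a) + Bp                                  ≡⟨ cong (λ z → suc (count f′ n a + z)) (count-∉ f fp≢b) ⟨
      suc (count f′ n a + count f (suc p) a′)                   ≡⟨ cong (λ z → suc (count f′ n a + count f (suc p) z)) (swap-left a a′) ⟨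
      suc (count f′ n a + count f (suc p) (swap a a′ a))        ≡⟨ cong suc (count-f′ a p<n) ⟩
      suc (count f (suc p) a + count f n (swap a a′ a))         ≡⟨ cong₂ (λ y z → suc (y + count f n z)) (count-∈ f fp≡a) (swap-left a a′) ⟩
      suc (suc Ap + B)                                         ≡⟨ ℕ-Solver.solve 2 (λ y z → con 1 :+ ((con 1 :+ y) :+ z) := y :+ (con 2 :+ z)) refl Ap B ⟩
      Ap + (2 + B)                                             ≡⟨ tight ⟩
      A + Bp                                                   ∎)
      where
      open ≡-Reasoning
      open ℕ-Solver

    count-f′-b : count f′ n a′ ≡ suc B
    count-f′-b = ℕ.+-cancelʳ-≡ (suc Ap) _ _ (begin
      count f′ n a′ + suc Ap                              ≡⟨ cong (count f′ n a′ +_) (count-∈ f fp≡a) ⟨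
      count f′ n a′ + count f (suc p) a                   ≡⟨ cong (λ z → count f′ n a′ + count f (suc p) z) (swap-right a a′) ⟨
      count f′ n a′ + count f (suc p) (swap a a′ a′)        ≡⟨ count-f′ a′ p<n ⟩
      count f (suc p) a′ + count f n (swap a a′ a′)         ≡⟨ cong₂ (λ y z → y + count f n z) (count-∉ f fp≢b) (swap-right a a′) ⟩
      Bp + A                                             ≡⟨ ℕ.+-comm Bp A ⟩
      A + Bp                                             ≡⟨ tight ⟨
      Ap + (2 + B)                                       ≡⟨ ℕ-Solver.solve 2 (λ y z → y :+ (con 2 :+ z) := (con 1 :+ z) :+ (con 1 :+ y)) refl Ap B ⟩
      suc B + suc Ap                                     ∎)
      where
      open ≡-Reasoning
      open ℕ-Solver

    count-f′-other : ∀ {c} → c ≢ a → c ≢ a′ → count f′ n c ≡ count f n c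
    count-f′-other {c} c≢a c≢b = ℕ.+-cancelʳ-≡ (count f (suc p) c) _ _ (begin
      count f′ n c + count f (suc p) c               ≡⟨ cong (λ z → count f′ n c + count f (suc p) z) (swap-other c≢a c≢b) ⟨
      count f′ n c + count f (suc p) (swap a a′ c)    ≡⟨ count-f′ c p<n ⟩
      count f (suc p) c + count f n (swap a a′ c)     ≡⟨ cong (λ z → count f (suc p) c + count f n z) (swap-other c≢a c≢b) ⟩
      count f (suc p) c + count f n c                ≡⟨ ℕ.+-comm (count f (suc p) c) _ ⟩
      count f n c + count f (suc p) c                ∎)
      where open ≡-Reasoning

  transfer-colouring : ∀ {γ a a′} → a ≢ a′ → 2 + γ a′ ≤ γ a → HasColouring γ → HasColouring (transfer a a′ γ)
  transfer-colouring {γ} {a} {a′} a≢b big (f , f-proper , f-count) = f′ , f′-proper , counts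
    where
    open Balance f-proper a≢b (subst₂ (λ y z → 2 + y ≤ z) (sym (f-count a′)) (sym (f-count a)) big)
    counts : ∀ c → count f′ n c ≡ transfer a a′ γ c
    counts c with c ≟ a
    ... | yes refl = trans (cong pred count-f′-a) (cong pred (f-count a))
    ... | no c≢a with c ≟ a′
    ...   | yes refl = trans count-f′-b (cong suc (f-count a′))
    ...   | no c≢b   = trans (count-f′-other c≢a c≢b) (f-count c)

-- Dominance

Σ<-transfer : ∀ {a a′} γ m → a ≢ a′ → 0 < γ a →
  Σ< (transfer a a′ γ) m + 𝟙 (a <? m) ≡ Σ< γ m + 𝟙 (a′ <? m)
Σ<-transfer {a} {a′} γ m a≢b 0<γa = begin
  Σ< (transfer a a′ γ) m + 𝟙 (a <? m)                ≡⟨ cong (Σ< (transfer a a′ γ) m +_) (Σ<-𝟙 a m) ⟨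
  Σ< (transfer a a′ γ) m + Σ< (λ c → 𝟙 (a ≟ c)) m    ≡⟨ Σ<-+ (transfer a a′ γ) _ m ⟨
  Σ< (λ c → transfer a a′ γ c + 𝟙 (a ≟ c)) m         ≡⟨ Σ<-cong m (λ c _ → pointwise c) ⟩
  Σ< (λ c → γ c + 𝟙 (a′ ≟ c)) m                      ≡⟨ Σ<-+ γ _ m ⟩
  Σ< γ m + Σ< (λ c → 𝟙 (a′ ≟ c)) m                   ≡⟨ cong (Σ< γ m +_) (Σ<-𝟙 a′ m) ⟩
  Σ< γ m + 𝟙 (a′ <? m)                               ∎
  where
  open ≡-Reasoning
  pointwise : ∀ c → transfer a a′ γ c + 𝟙 (a ≟ c) ≡ γ c + 𝟙 (a′ ≟ c)
  pointwise c = cases (c ≟ a) (c ≟ a′)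
    where
    cases : Dec (c ≡ a) → Dec (c ≡ a′) → transfer a a′ γ c + 𝟙 (a ≟ c) ≡ γ c + 𝟙 (a′ ≟ c)
    cases (yes refl) _ = begin
      transfer a a′ γ a + 𝟙 (a ≟ a)   ≡⟨ cong₂ _+_ (transfer-left a a′ γ) (𝟙-true (a ≟ a) refl) ⟩
      pred (γ a) + 1                 ≡⟨ ℕ.+-comm _ 1 ⟩
      suc (pred (γ a))               ≡⟨ ℕ.suc-pred (γ a) {{ℕ.>-nonZero 0<γa}} ⟩
      γ a                            ≡⟨ ℕ.+-identityʳ _ ⟨
      γ a + 0                        ≡⟨ cong (γ a +_) (𝟙-false (a′ ≟ a) (≢-sym a≢b)) ⟨
      γ a + 𝟙 (a′ ≟ a)                ∎
    cases (no b≢a) (yes refl) = begin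
      transfer a a′ γ a′ + 𝟙 (a ≟ a′)   ≡⟨ cong₂ _+_ (transfer-right γ b≢a) (𝟙-false (a ≟ a′) a≢b) ⟩
      suc (γ a′) + 0                  ≡⟨ ℕ.+-identityʳ _ ⟩
      suc (γ a′)                      ≡⟨ ℕ.+-comm 1 _ ⟩
      γ a′ + 1                        ≡⟨ cong (γ a′ +_) (𝟙-true (a′ ≟ a′) refl) ⟨
      γ a′ + 𝟙 (a′ ≟ a′)                ∎
    cases (no c≢a) (no c≢b) = cong₂ _+_ (transfer-other γ c≢a c≢b)
      (trans (𝟙-false (a ≟ c) (≢-sym c≢a)) (sym (𝟙-false (a′ ≟ c) (≢-sym c≢b))))

Σ<-≡⇒≗ : ∀ {γ δ} m → (∀ c → c < m → γ c ≤ δ c) → Σ< γ m ≡ Σ< δ m → ∀ c → c < m → γ c ≡ δ c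
Σ<-≡⇒≗ m le eq c c<m with ℕ.m≤n⇒m<n∨m≡n (le c c<m)
... | inj₁ lt = contradiction (Σ<-strict m c<m lt le) (ℕ.<-irrefl eq)
... | inj₂ eq = eq

-- Any sequence dominated by one in Q is reached by transfers: take the first j with α j < β j and
-- some i < j with β i < α i; moving a unit from i to j preserves dominance and decreases Σ (α ∸ β).
module _ (k : ℕ) (Q : (ℕ → ℕ) → Set)
  (resp : ∀ {γ δ} → γ ≗ δ → Q γ → Q δ)
  (step : ∀ {γ i j} → i < j → j < k → 2 + γ j ≤ γ i → Q γ → Q (transfer i j γ))
  {β : ℕ → ℕ} (β-noninc : ∀ {i j} → i ≤ j → j < k → β j ≤ β i) where

  private
    Dominates : (ℕ → ℕ) → Set
    Dominates α = (∀ c → k ≤ c → α c ≡ β c) × Σ< β k ≡ Σ< α k × (∀ m → m ≤ k → Σ< β m ≤ Σ< α m)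

    excess : (ℕ → ℕ) → ℕ
    excess α = Σ< (λ c → α c ∸ β c) k

    module Move {α} (dom : Dominates α) {i j} (j<k : j < k) (αj<βj : α j < β j)
      (first : ∀ u → u < j → ¬ α u < β u) (i<j : i < j) (βi<αi : β i < α i) where

      α′ : ℕ → ℕ
      α′ = transfer i j α

      i<k : i < k
      i<k = ℕ.<-trans i<j j<k

      i≢j : i ≢ j
      i≢j = ℕ.<⇒≢ i<j

      -- The chain `α j < β j ≤ β i < α i`, with the monotonicity of `β` in the middle, contains two
      -- strict steps.
      gap : 2 + α j ≤ α i
      gap = ℕ.≤-trans (s≤s αj<βj) (ℕ.≤-trans (s≤s (β-noninc (ℕ.<⇒≤ i<j) j<k)) βi<αi)

      Σ<-α′ : ∀ m → Σ< α′ m + 𝟙 (i <? m) ≡ Σ< α m + 𝟙 (j <? m)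
      Σ<-α′ m = Σ<-transfer α m i≢j (ℕ.<-≤-trans (s≤s z≤n) gap)

      unmoved : ∀ m {x} → 𝟙 (i <? m) ≡ x → 𝟙 (j <? m) ≡ x → Σ< α′ m ≡ Σ< α m
      unmoved m {x} p q = ℕ.+-cancelʳ-≡ x _ _
        (trans (cong (Σ< α′ m +_) (sym p)) (trans (Σ<-α′ m) (cong (Σ< α m +_) q)))

      -- Only a prefix that contains `i` but not `j` loses a unit. On it `β ≤ α` everywhere because
      -- `j` is the first deficit, and strictly at `i`, so there is a unit to spare.
      dominates : ∀ m → m ≤ k → Σ< β m ≤ Σ< α′ m
      dominates m m≤k with i <? m | j <? m
      ... | no i≮m  | yes j<m = contradiction (ℕ.<-trans i<j j<m) i≮m
      ... | no i≮m  | no j≮m  = subst (Σ< β m ≤_)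
        (sym (unmoved m (𝟙-false (i <? m) i≮m) (𝟙-false (j <? m) j≮m))) (proj₂ (proj₂ dom) m m≤k)
      ... | yes i<m | yes j<m = subst (Σ< β m ≤_)
        (sym (unmoved m (𝟙-true (i <? m) i<m) (𝟙-true (j <? m) j<m))) (proj₂ (proj₂ dom) m m≤k)
      ... | yes i<m | no j≮m = ℕ.≤-pred (begin-strict
        Σ< β m                  <⟨ Σ<-strict m i<m βi<αi (λ c c<m → ℕ.≮⇒≥ (first c (ℕ.<-≤-trans c<m (ℕ.≮⇒≥ j≮m)))) ⟩
        Σ< α m                  ≡⟨ ℕ.+-identityʳ _ ⟨
        Σ< α m + 0              ≡⟨ cong (Σ< α m +_) (𝟙-false (j <? m) j≮m) ⟨
        Σ< α m + 𝟙 (j <? m)     ≡⟨ Σ<-α′ m ⟨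
        Σ< α′ m + 𝟙 (i <? m)    ≡⟨ cong (Σ< α′ m +_) (𝟙-true (i <? m) i<m) ⟩
        Σ< α′ m + 1             ≡⟨ ℕ.+-comm _ 1 ⟩
        suc (Σ< α′ m)           ∎)
        where open ℕ.≤-Reasoning

      dominates′ : Dominates α′
      dominates′ =
          (λ c k≤c → trans (transfer-other α (≢-sym (ℕ.<⇒≢ (ℕ.<-≤-trans i<k k≤c)))
                                             (≢-sym (ℕ.<⇒≢ (ℕ.<-≤-trans j<k k≤c))))
                           (proj₁ dom c k≤c))
        , trans (proj₁ (proj₂ dom)) (sym (unmoved k (𝟙-true (i <? k) i<k) (𝟙-true (j <? k) j<k)))
        , dominates

      -- The surplus at `i` shrinks by one. At `j` none arises, since the deficit there was at least
      -- one.
      decreases : excess α′ < excess α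
      decreases = Σ<-strict k i<k strict λ c _ → cases c (c ≟ i) (c ≟ j)
        where
        strict : α′ i ∸ β i < α i ∸ β i
        strict = ℕ.∸-monoˡ-< (subst (_< α i) (sym (transfer-left i j α))
            (ℕ.≤-reflexive (ℕ.suc-pred (α i) {{ℕ.>-nonZero (ℕ.≤-<-trans z≤n βi<αi)}})))
          (subst (β i ≤_) (sym (transfer-left i j α)) (ℕ.<⇒≤pred βi<αi))
        cases : ∀ c → Dec (c ≡ i) → Dec (c ≡ j) → α′ c ∸ β c ≤ α c ∸ β c
        cases c (yes refl) _ = ℕ.<⇒≤ strict
        cases c (no _) (yes refl) = subst (λ z → z ∸ β j ≤ α j ∸ β j) (sym (transfer-right α (≢-sym i≢j)))
          (subst (_≤ α j ∸ β j) (sym (ℕ.m≤n⇒m∸n≡0 αj<βj)) z≤n)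
        cases c (no c≢i) (no c≢j) = ℕ.≤-reflexive (cong (_∸ β c) (transfer-other α c≢i c≢j))

    search< : ∀ (γ δ : ℕ → ℕ) m → (∃ λ c → c < m × γ c < δ c) ⊎ (∀ c → c < m → ¬ γ c < δ c)
    search< γ δ m with Fin.any? (λ (c : Fin m) → γ (toℕ c) <? δ (toℕ c))
    ... | yes (c , lt) = inj₁ (toℕ c , Fin.toℕ<n c , lt)
    ... | no none = inj₂ λ c c<m lt → none (fromℕ< c<m ,
      subst (λ z → γ z < δ z) (sym (Fin.toℕ-fromℕ< c<m)) lt)

  dominated⇒∈ : ∀ {α} → Q α → (∀ c → k ≤ c → α c ≡ β c) → Σ< β k ≡ Σ< α k →
    (∀ m → m ≤ k → Σ< β m ≤ Σ< α m) → Q β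
  dominated⇒∈ {α} Qα beyond total prefix = go (excess α) α refl Qα (beyond , total , prefix)
    where
    go : ∀ e α → excess α ≡ e → Q α → Dominates α → Q β
    go = <-rec _ λ e rec α eq Qα dom → case α rec eq Qα dom (search< α β k)
      where
      case : ∀ {e} α → (∀ {e′} → e′ < e → ∀ α → excess α ≡ e′ → Q α → Dominates α → Q β) →
        excess α ≡ e → Q α → Dominates α →
        (∃ λ c → c < k × α c < β c) ⊎ (∀ c → c < k → ¬ α c < β c) → Q β
      case α rec refl Qα (beyond , total , _) (inj₂ none) = resp (sym ∘ β≗α) Qα
        where
        β≗α : β ≗ α
        β≗α c with c <? k
        ... | yes c<k = Σ<-≡⇒≗ k (λ c c<k → ℕ.≮⇒≥ (none c c<k)) total c c<k
        ... | no  c≮k = sym (beyond c (ℕ.≮⇒≥ c≮k))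
      case α rec refl Qα dom (inj₁ (j₀ , j₀<k , lt)) with leastWith (λ c → α c <? β c) j₀ lt
      ... | j , j≤j₀ , αj<βj , first with search< β α j
      ...   | inj₁ (i , i<j , βi<αi) = rec decreases α′ refl (step i<j j<k gap Qα) dominates′
        where
        j<k : j < k
        j<k = ℕ.≤-<-trans j≤j₀ j₀<k
        open Move dom j<k αj<βj first i<j βi<αi
      -- Without a surplus before the deficit at `j`, the prefix sum of `α` through `j` would fall
      -- below that of `β`.
      ...   | inj₂ none = contradiction (proj₂ (proj₂ dom) (suc j) (ℕ.≤-<-trans j≤j₀ j₀<k))
        (ℕ.<⇒≱ (ℕ.+-mono-≤-< (Σ<-mono j λ c c<j → ℕ.≮⇒≥ (none c c<j)) αj<βj))

argmax : ∀ {n} (β : Fin (suc n) → ℕ) → ∃ λ i → ∀ j → β j ≤ β i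
argmax {zero}  β = zero , λ { zero → ℕ.≤-refl }
argmax {suc n} β with argmax (β ∘ suc)
... | i , max with ℕ.≤-total (β zero) (β (suc i))
...   | inj₁ le = suc i , λ { zero → le ; (suc j) → max j }
...   | inj₂ ge = zero , λ { zero → ℕ.≤-refl ; (suc j) → ℕ.≤-trans (max j) ge }

-- Selection sort: a transposition brings a largest entry to the front, and the rest is sorted by a
-- permutation that fixes `zero`.
sorting : ∀ {k} (β : Fin k → ℕ) → Σ (Permutation′ k) λ σ →
  ∀ {i j} → i ≤ j → j < k → ext (β ∘ (σ ⟨$⟩ʳ_)) j ≤ ext (β ∘ (σ ⟨$⟩ʳ_)) i
sorting {zero}  β = Permutation.id , λ _ ()
sorting {suc k} β with argmax β
... | i₀ , max with sorting (λ j → β (Permutation.transpose zero i₀ ⟨$⟩ʳ suc j))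
...   | τ , sorted = σ , sorted′
  where
  σ = Permutation.lift₀ τ ∘ₚ Permutation.transpose zero i₀
  γ : Fin (suc k) → ℕ
  γ = β ∘ (σ ⟨$⟩ʳ_)
  ext≤γ0 : ∀ {j} → j < suc k → ext γ j ≤ γ zero
  ext≤γ0 j< = subst (λ z → ext γ z ≤ γ zero) (Fin.toℕ-fromℕ< j<) (subst (_≤ γ zero)
    (sym (ext-toℕ γ (fromℕ< j<))) (max _))
  sorted′ : ∀ {i j} → i ≤ j → j < suc k → ext γ j ≤ ext γ i
  sorted′ {zero}          _         j<        = ext≤γ0 j<
  sorted′ {suc i} {suc j} (s≤s i≤j) (s≤s j<k) = sorted i≤j j<k

-- Indifference graphs of Dyck paths

northsBefore-step : ∀ w i → northsBefore w i ≤ northsBefore w (suc i)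
northsBefore-step []      i       = z≤n
northsBefore-step (𝕟 ∷ w) i       = s≤s (northsBefore-step w i)
northsBefore-step (𝕖 ∷ w) zero    = z≤n
northsBefore-step (𝕖 ∷ w) (suc i) = northsBefore-step w i

HasWeight : ∀ {n} → Graph n → (ℕ → ℕ) → Set
HasWeight {n} G γ = Σ (Fin n → ℕ) λ f → Proper G f × wt f ≗ γ

module Indifference {n} (d : DyckPath n) where

  open UnitInterval n (northsBefore (DyckPath.steps d)) (northsBefore-step (DyckPath.steps d)) public

  private
    G = indifferenceGraph d

  IsProper-ext : ∀ {f} → Proper G f → IsProper (ext f)
  IsProper-ext {f} f-proper {i} {j} i<j j<n j<hi eq =
    f-proper u w (inj₁ (subst₂ _<_ (sym u≡i) (sym w≡j) i<j , edge′))
      (trans (sym (ext-toℕ f u)) (trans (cong (ext f) u≡i)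
        (trans eq (trans (cong (ext f) (sym w≡j)) (ext-toℕ f w)))))
    where
    u w : Fin n
    u = fromℕ< (ℕ.<-trans i<j j<n)
    w = fromℕ< j<n
    u≡i : toℕ u ≡ i
    u≡i = Fin.toℕ-fromℕ< _
    w≡j : toℕ w ≡ j
    w≡j = Fin.toℕ-fromℕ< _
    edge′ : suc (toℕ w) ≤ hessenberg d u
    edge′ = subst₂ (λ y z → y < northsBefore (DyckPath.steps d) z) (sym w≡j) (sym u≡i) j<hi

  HasWeight⇒HasColouring : ∀ {γ} → HasWeight G γ → HasColouring γ
  HasWeight⇒HasColouring (f , f-proper , f-wt) =
    ext f , IsProper-ext f-proper , λ c → trans (sym (wt≡count f c)) (f-wt c)

  HasColouring⇒HasWeight : ∀ {γ} → HasColouring γ → HasWeight G γ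
  HasColouring⇒HasWeight {γ} (F , F-proper , F-count) = f , proper , counts
    where
    f : Fin n → ℕ
    f u = F (toℕ u)
    proper : Proper G f
    proper u w (inj₁ (u<w , w<hu)) = F-proper u<w (Fin.toℕ<n w) w<hu
    proper u w (inj₂ (w<u , u<hw)) = F-proper w<u (Fin.toℕ<n u) u<hw ∘ sym
    ext≡F : ∀ u → u < n → ext f u ≡ F u
    ext≡F u u<n = trans (cong (ext f) (sym eq)) (trans (ext-toℕ f (fromℕ< u<n)) (cong F eq))
      where eq = Fin.toℕ-fromℕ< u<n
    counts : wt f ≗ γ
    counts c = trans (wt≡count f c)
      (trans (Σ<-cong n λ u u<n → cong (λ z → 𝟙 (z ≟ c)) (ext≡F u u<n)) (F-count c))

  greedy-proper : Proper G (greedy G)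
  greedy-proper u w r eq with ℕ.<-cmp (toℕ u) (toℕ w)
  ... | tri< u<w _ _ = greedyFrom-proper (adj? G) (λ _ → []) u<w r eq
  ... | tri> _ _ w<u = greedyFrom-proper (adj? G) (λ _ → []) w<u (symm G {u} {w} r) (sym eq)
  ... | tri≈ _ u≡w _ = irrefl G {u} {w} (Fin.toℕ-injective u≡w) r

  greedy-first : IsFirstFit (ext (greedy G))
  greedy-first {u} {c} u<n c< with greedyFrom-first (adj? G) (λ _ → []) (fromℕ< u<n)
    (subst (c <_) (trans (cong (ext (greedy G)) (sym (Fin.toℕ-fromℕ< u<n))) (ext-toℕ (greedy G) _)) c<)
  ... | inj₁ ()
  ... | inj₂ (i , i<u , inj₁ (_ , u<hi) , eq) = toℕ i
    , subst (toℕ i <_) (Fin.toℕ-fromℕ< u<n) i<u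
    , subst (_< hessenberg d i) (Fin.toℕ-fromℕ< u<n) u<hi
    , trans (ext-toℕ (greedy G) i) eq
  ... | inj₂ (i , i<u , inj₂ (u<i , _) , eq) = contradiction u<i (ℕ.<-asym i<u)

  λᵍʳ-colouring : HasColouring (λᵍʳ d)
  λᵍʳ-colouring = HasWeight⇒HasColouring (greedy G , greedy-proper , λ _ → refl)

  λᵍʳ≡count : λᵍʳ d ≗ count (ext (greedy G)) n
  λᵍʳ≡count = wt≡count (greedy G)

  λᵍʳ-dominates : ∀ {γ} → HasColouring γ → ∀ m → Σ< γ m ≤ Σ< (λᵍʳ d) m
  λᵍʳ-dominates {γ} (f , f-proper , f-count) m = begin
    Σ< γ m                            ≡⟨ Σ<-cong m (λ c _ → f-count c) ⟨
    Σ< (count f n) m                  ≤⟨ firstFit-dominates f-proper greedy-first m n ℕ.≤-refl ⟩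
    Σ< (count (ext (greedy G)) n) m   ≡⟨ Σ<-cong m (λ c _ → λᵍʳ≡count c) ⟨
    Σ< (λᵍʳ d) m                      ∎
    where open ℕ.≤-Reasoning

  λᵍʳ-nonincreasing : ∀ c → λᵍʳ d (suc c) ≤ λᵍʳ d c
  λᵍʳ-nonincreasing c = subst₂ _≤_ (sym (λᵍʳ≡count (suc c))) (sym (λᵍʳ≡count c))
    (firstFit-nonincreasing (IsProper-ext greedy-proper) greedy-first c)

  λᵍʳ-antitone : ∀ {i j} → i ≤ j → λᵍʳ d j ≤ λᵍʳ d i
  λᵍʳ-antitone {j = zero} z≤n = ℕ.≤-refl
  λᵍʳ-antitone {i} {suc j} i≤ with ℕ.m≤n⇒m<n∨m≡n i≤
  ... | inj₁ i<   = ℕ.≤-trans (λᵍʳ-nonincreasing j) (λᵍʳ-antitone (ℕ.≤-pred i<))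
  ... | inj₂ refl = ℕ.≤-refl

  colouring-total≤ : ∀ {γ} → HasColouring γ → ∀ m → Σ< γ m ≤ n
  colouring-total≤ (f , _ , f-count) m =
    subst (_≤ n) (Σ<-cong m λ c _ → f-count c) (Σ<-count≤ f n m)

  colouring-total : ∀ {γ} → HasColouring γ → ∀ {k} → (∀ c → k ≤ c → γ c ≡ 0) → Σ< γ k ≡ n
  colouring-total (f , _ , f-count) {k} zeros =
    trans (sym (Σ<-cong k λ c _ → f-count c)) (Σ<-count-all f n k below)
    where
    below : ∀ u → u < n → f u < k
    below u u<n = ℕ.≰⇒> λ k≤fu → ℕ.n≮0 (subst (_ <_) (trans (f-count (f u)) (zeros (f u) k≤fu))
      (count-hit f {M = 0} z≤n u<n refl))

  λᵍʳ-partition : ∃ λ ℓ → IsPartition (λᵍʳ d) ℓ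
  λᵍʳ-partition with leastWith (λ c → λᵍʳ d c ≟ 0) n λn≡0
    where
    -- By monotonicity, a positive entry at index `n` would make `n + 1` entries positive, more than
    -- there are vertices.
    λn≡0 : λᵍʳ d n ≡ 0
    λn≡0 with λᵍʳ d n in eq
    ... | zero   = refl
    ... | suc _  = contradiction (colouring-total≤ λᵍʳ-colouring (suc n)) (ℕ.<⇒≱ (begin
      suc n                           ≡⟨ ℕ.+-identityʳ _ ⟨
      suc n + 0                       ≤⟨ ℕ.+-monoʳ-≤ (suc n) z≤n ⟩
      suc n + Σ< (λ _ → 0) (suc n)    ≡⟨ Σ<-suc (λ _ → 0) (suc n) ⟨
      Σ< (λ _ → 1) (suc n)            ≤⟨ Σ<-mono (suc n) (λ c c≤n → ℕ.≤-trans (subst (1 ≤_) (sym eq) (s≤s z≤n)) (λᵍʳ-antitone (ℕ.≤-pred c≤n))) ⟩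
      Σ< (λᵍʳ d) (suc n)              ∎))
      where open ℕ.≤-Reasoning
  ... | ℓ , _ , λℓ≡0 , least = ℓ , record
    { nonincreasing = λᵍʳ-nonincreasing
    ; positive      = λ i i<ℓ → ℕ.n≢0⇒n>0 (least i i<ℓ)
    ; zeroAfter     = λ i ℓ≤i → ℕ.n≤0⇒n≡0 (subst (λᵍʳ d i ≤_) λℓ≡0 (λᵍʳ-antitone ℓ≤i))
    }

  -- Otherwise the first k parts of λᵍʳ would miss its positive part ℓ, hence have sum less than n.
  length≤colours : ∀ {ℓ k γ} → IsPartition (λᵍʳ d) ℓ → HasColouring γ → (∀ c → k ≤ c → γ c ≡ 0) → ℓ ≤ k
  length≤colours {ℓ} {k} {γ} part col zeros = ℕ.≮⇒≥ λ k<ℓ → ℕ.<-irrefl refl (begin-strict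
    n                      ≡⟨ colouring-total col zeros ⟨
    Σ< γ k                 ≤⟨ λᵍʳ-dominates col k ⟩
    Σ< (λᵍʳ d) k           <⟨ ℕ.m<m+n _ (IsPartition.positive part k k<ℓ) ⟩
    Σ< (λᵍʳ d) (suc k)     ≤⟨ colouring-total≤ λᵍʳ-colouring (suc k) ⟩
    n                      ∎)
    where open ℕ.≤-Reasoning

  -- This is `dominated⇒∈` started at `λᵍʳ d`, for vectors of length `k`. By `ℓ ≤ k` the cut after
  -- `k` entries loses no part, so `λᵍʳ d` and `ext β` agree beyond `k` and both have total `n`.
  dominated⇒vector∈ : ∀ {k ℓ} → IsPartition (λᵍʳ d) ℓ → ℓ ≤ k →
    (Q : (Fin k → ℕ) → Set) → (∀ {γ δ} → γ ≗ δ → Q γ → Q δ) →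
    (∀ {γ} {i j : Fin k} → i ≢ j → 2 + γ j ≤ γ i → Q γ → Q (λ c → transfer (toℕ i) (toℕ j) (ext γ) (toℕ c))) →
    Q (λ c → λᵍʳ d (toℕ c)) →
    ∀ β → (∀ {i j} → i ≤ j → j < k → ext β j ≤ ext β i) → Σ< (ext β) k ≡ n →
    (∀ m → m ≤ k → Σ< (ext β) m ≤ Σ< (λᵍʳ d) m) → Q β
  dominated⇒vector∈ {k} {ℓ} part ℓ≤k Q resp step Qλ β sorted total prefix =
    resp (ext-toℕ β) (dominated⇒∈ k (λ γ → Q (restrict γ)) (λ eq → resp (λ c → eq (toℕ c))) step′ sorted Qλ
      (λ c k≤c → trans (zeroAfter part c (ℕ.≤-trans ℓ≤k k≤c)) (sym (ext-beyond β k≤c)))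
      (trans total (sym (colouring-total λᵍʳ-colouring λ c k≤c → zeroAfter part c (ℕ.≤-trans ℓ≤k k≤c))))
      prefix)
    where
    open IsPartition
    restrict : (ℕ → ℕ) → Fin k → ℕ
    restrict γ c = γ (toℕ c)
    step′ : ∀ {γ i j} → i < j → j < k → 2 + γ j ≤ γ i → Q (restrict γ) → Q (restrict (transfer i j γ))
    step′ {γ} {i} {j} i<j j<k gap Qγ = resp eq (step {i = i′} {j′} i′≢j′
      (subst₂ (λ y z → 2 + γ y ≤ γ z) (sym j≡) (sym i≡) gap) Qγ)
      where
      i′ j′ : Fin k
      i′ = fromℕ< (ℕ.<-trans i<j j<k)
      j′ = fromℕ< j<k
      i≡ : toℕ i′ ≡ i
      i≡ = Fin.toℕ-fromℕ< _
      j≡ : toℕ j′ ≡ j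
      j≡ = Fin.toℕ-fromℕ< _
      i′≢j′ : i′ ≢ j′
      i′≢j′ eq = ℕ.<⇒≢ i<j (trans (sym i≡) (trans (cong toℕ eq) j≡))
      eq : ∀ c → transfer (toℕ i′) (toℕ j′) (ext (restrict γ)) (toℕ c) ≡ transfer i j γ (toℕ c)
      eq c rewrite i≡ | j≡ with toℕ c ≟ i
      ... | yes _ = cong pred (ext-toℕ (restrict γ) c)
      ... | no  _ with toℕ c ≟ j
      ...   | yes _ = cong suc (ext-toℕ (restrict γ) c)
      ...   | no  _ = ext-toℕ (restrict γ) c

-- Matchings of a bicoloured graph

Unique-map-∈ : ∀ {A B : Set} {f : A → B} {xs} → (∀ {x y} → x ∈ xs → y ∈ xs → f x ≡ f y → x ≡ y) →
  Unique xs → Unique (map f xs)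
Unique-map-∈ {xs = []}     inj []         = []
Unique-map-∈ {f = f} {xs = x ∷ xs} inj (x∉ ∷ uxs) =
  All.tabulate fresh ∷ Unique-map-∈ (λ x∈ y∈ → inj (there x∈) (there y∈)) uxs
  where
  fresh : ∀ {z} → z ∈ map f xs → f x ≢ z
  fresh z∈ fx≡z with ∈-map⁻ f z∈
  ... | y , y∈ , refl = All.lookup x∉ y∈ (inj (here refl) (there y∈) fx≡z)

missing : ∀ {n} (xs : List (Fin n)) → length xs < n → ∃ λ x → x ∉ xs
missing {n} xs short with Fin.any? (λ x → ¬? (x ∈ᶠ? xs))
  where open DecMembership Fin._≟_ using () renaming (_∈?_ to _∈ᶠ?_)
... | yes x∉  = x∉
... | no none = contradiction
  (subst (_≤ length xs) (List.length-tabulate {n = n} id)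
    (unique-⊆⇒length≤ (Unique.allFin⁺ n) λ {x} _ → decidable-stable (x ∈ᶠ? xs) λ x∉ → none (x , x∉)))
  (ℕ.<⇒≱ short)
  where open DecMembership Fin._≟_ using () renaming (_∈?_ to _∈ᶠ?_)

module _ {r s : ℕ} where

  edges : Bicoloured r s → List (Fin r × Fin s)
  edges M = filter (λ e → T? (M (proj₁ e) (proj₂ e))) (cartesianProduct (allFin r) (allFin s))

  ∈-edges⁺ : ∀ M {x y} → T (M x y) → (x , y) ∈ edges M
  ∈-edges⁺ M {x} {y} = ∈-filter⁺ _ (∈-cartesianProduct⁺ (∈-allFin x) (∈-allFin y))

  ∈-edges⁻ : ∀ M {x y} → (x , y) ∈ edges M → T (M x y)
  ∈-edges⁻ M e∈ = proj₂ (∈-filter⁻ (λ e → T? (M (proj₁ e) (proj₂ e))) {xs = cartesianProduct (allFin r) (allFin s)} e∈)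

  edges-unique : ∀ M → Unique (edges M)
  edges-unique M = Unique.filter⁺ _ (Unique.cartesianProduct⁺ (Unique.allFin⁺ r) (Unique.allFin⁺ s))

  #edges-mono : ∀ {M N : Bicoloured r s} → (∀ {x y} → T (M x y) → T (N x y)) → #edges M ≤ #edges N
  #edges-mono {M} {N} M⊆N = unique-⊆⇒length≤ (edges-unique M) (λ e∈ → ∈-edges⁺ N (M⊆N (∈-edges⁻ M e∈)))

  #edges-cong : ∀ {M N : Bicoloured r s} → (∀ x y → M x y ≡ N x y) → #edges M ≡ #edges N
  #edges-cong M≗N = ℕ.≤-antisym (#edges-mono λ {x} {y} → subst T (M≗N x y))
                                (#edges-mono λ {x} {y} → subst T (sym (M≗N x y)))

  module _ {M : Bicoloured r s} (matching : IsMatching M) where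

    lowerEnds-unique : Unique (map proj₁ (edges M))
    lowerEnds-unique = Unique-map-∈ (λ { {x , y} {_ , y′} e∈ e′∈ refl →
      cong (x ,_) (proj₁ matching x y y′ (∈-edges⁻ M e∈) (∈-edges⁻ M e′∈)) }) (edges-unique M)

    upperEnds-unique : Unique (map proj₂ (edges M))
    upperEnds-unique = Unique-map-∈ (λ { {x , y} {x′ , _} e∈ e′∈ refl →
      cong (_, y) (proj₂ matching x x′ y (∈-edges⁻ M e∈) (∈-edges⁻ M e′∈)) }) (edges-unique M)

    #edges≤ : #edges M ≤ r ⊓ s
    #edges≤ = ℕ.⊓-glb
      (subst₂ _≤_ (List.length-map proj₁ (edges M)) (List.length-tabulate {n = r} id)
        (unique-⊆⇒length≤ lowerEnds-unique λ _ → ∈-allFin _))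
      (subst₂ _≤_ (List.length-map proj₂ (edges M)) (List.length-tabulate {n = s} id)
        (unique-⊆⇒length≤ upperEnds-unique λ _ → ∈-allFin _))

  addEdge : Fin r → Fin s → Bicoloured r s → Bicoloured r s
  addEdge x y M x′ y′ = M x′ y′ ∨ (does (x′ Fin.≟ x) ∧ does (y′ Fin.≟ y))

  addEdge⁻ : ∀ {x y} M x′ y′ → T (addEdge x y M x′ y′) → T (M x′ y′) ⊎ (x′ ≡ x × y′ ≡ y)
  addEdge⁻ {x} {y} M x′ y′ t with M x′ y′ | x′ Fin.≟ x | y′ Fin.≟ y
  ... | true  | _      | _      = inj₁ tt
  ... | false | yes x≡ | yes y≡ = inj₂ (x≡ , y≡)

  addEdge-old : ∀ {x y} M {x′ y′} → T (M x′ y′) → T (addEdge x y M x′ y′)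
  addEdge-old M {x′} {y′} t with M x′ y′
  ... | true = tt

  addEdge-new : ∀ {x y} M → T (addEdge x y M x y)
  addEdge-new {x} {y} M with M x y | x Fin.≟ x | y Fin.≟ y
  ... | true  | _      | _      = tt
  ... | false | yes _  | yes _  = tt
  ... | false | yes _  | no y≢y = y≢y refl
  ... | false | no x≢x | _      = x≢x refl

  -- With fewer than `r ⊓ s` edges a vertex is left free on either side, and any two such vertices
  -- may be joined: the random matchings are not confined to the edges of the bicoloured graph.
  extendMatching : ∀ M → IsMatching M → #edges M < r ⊓ s → ∃ λ N →
    IsMatching N × (∀ {x y} → T (M x y) → T (N x y)) × #edges M < #edges N
  extendMatching M matching short with
      missing (map proj₁ (edges M)) (subst (_< r) (sym (List.length-map proj₁ (edges M))) (ℕ.<-≤-trans short (ℕ.m⊓n≤m r s)))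
    | missing (map proj₂ (edges M)) (subst (_< s) (sym (List.length-map proj₂ (edges M))) (ℕ.<-≤-trans short (ℕ.m⊓n≤n r s)))
  ... | x , x∉ | y , y∉ = N , (lower , upper) , addEdge-old M ,
    unique-⊆⇒length≤ (All.tabulate fresh ∷ edges-unique M)
      λ { (here refl) → ∈-edges⁺ N (addEdge-new M) ; (there e∈) → ∈-edges⁺ N (addEdge-old M (∈-edges⁻ M e∈)) }
    where
    N = addEdge x y M
    x-free : ∀ {y′} → ¬ T (M x y′)
    x-free t = x∉ (∈-map⁺ proj₁ (∈-edges⁺ M t))
    y-free : ∀ {x′} → ¬ T (M x′ y)
    y-free t = y∉ (∈-map⁺ proj₂ (∈-edges⁺ M t))
    fresh : ∀ {e} → e ∈ edges M → (x , y) ≢ e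
    fresh e∈ refl = x-free (∈-edges⁻ M e∈)
    lower : ∀ x′ y₁ y₂ → T (N x′ y₁) → T (N x′ y₂) → y₁ ≡ y₂
    lower x′ y₁ y₂ t₁ t₂ with addEdge⁻ M x′ y₁ t₁ | addEdge⁻ M x′ y₂ t₂
    ... | inj₁ m₁          | inj₁ m₂          = proj₁ matching x′ y₁ y₂ m₁ m₂
    ... | inj₁ m₁          | inj₂ (refl , _)  = ⊥-elim (x-free m₁)
    ... | inj₂ (refl , _)  | inj₁ m₂          = ⊥-elim (x-free m₂)
    ... | inj₂ (_ , refl)  | inj₂ (_ , refl)  = refl
    upper : ∀ x₁ x₂ y′ → T (N x₁ y′) → T (N x₂ y′) → x₁ ≡ x₂
    upper x₁ x₂ y′ t₁ t₂ with addEdge⁻ M x₁ y′ t₁ | addEdge⁻ M x₂ y′ t₂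
    ... | inj₁ m₁          | inj₁ m₂          = proj₂ matching x₁ x₂ y′ m₁ m₂
    ... | inj₁ m₁          | inj₂ (_ , refl)  = ⊥-elim (y-free m₁)
    ... | inj₂ (_ , refl)  | inj₁ m₂          = ⊥-elim (y-free m₂)
    ... | inj₂ (refl , _)  | inj₂ (refl , _)  = refl

  completeMatching : ∀ M → IsMatching M → ∃ λ N →
    IsMatching N × (∀ {x y} → T (M x y) → T (N x y)) × #edges N ≡ r ⊓ s
  completeMatching M matching = go (r ⊓ s ∸ #edges M) M matching ℕ.≤-refl
    where
    go : ∀ fuel M → IsMatching M → r ⊓ s ∸ #edges M ≤ fuel → ∃ λ N →
      IsMatching N × (∀ {x y} → T (M x y) → T (N x y)) × #edges N ≡ r ⊓ s
    go fuel M matching le with ℕ.m≤n⇒m<n∨m≡n (#edges≤ matching)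
    ... | inj₂ full  = M , matching , id , full
    ... | inj₁ short with extendMatching M matching short | fuel
    ...   | _ | zero = contradiction (ℕ.m∸n≡0⇒m≤n (ℕ.n≤0⇒n≡0 le)) (ℕ.<⇒≱ short)
    ...   | N , N-matching , M⊆N , more | suc fuel
      with go fuel N N-matching (ℕ.≤-pred (ℕ.<-≤-trans (ℕ.∸-monoʳ-< more (#edges≤ N-matching)) le))
    ...     | N′ , N′-matching , N⊆N′ , full = N′ , N′-matching , (λ t → N⊆N′ (M⊆N t)) , full

-- `R` replaces equality because a listed function agrees with the given one only pointwise. For
-- tables of Booleans, whose rows are functions again, `R` is itself pointwise agreement of rows.
functions-complete : ∀ {A B : Set} {R : A → B → Set} {as} n (f : Fin n → B) →
  (∀ i → Any (λ a → R a (f i)) as) → Any (λ g → ∀ i → R (g i) (f i)) (functions n as)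
functions-complete zero    f any = here λ ()
functions-complete {R = R} (suc n) f any = Any.cartesianProductWith⁺ _ (λ { p q zero → p ; p q (suc i) → q i })
  (any zero) (functions-complete {R = R} n (f ∘ suc) (any ∘ suc))

module _ {r s : ℕ} where

  ∈-maxMatchings⁺ : ∀ (M : Bicoloured r s) → IsMatching M → #edges M ≡ r ⊓ s →
    ∃ λ N → N ∈ maxMatchings r s × (∀ x y → N x y ≡ M x y)
  ∈-maxMatchings⁺ M matching full with find (functions-complete {R = λ f g → ∀ y → f y ≡ g y} r M λ x →
    functions-complete {R = _≡_} s (M x) λ y → bool∈ (M x y))
    where
    bool∈ : ∀ t → Any (_≡ t) (true ∷ false ∷ [])
    bool∈ true  = here refl
    bool∈ false = there (here refl)
  ... | N , N∈ , N≗M = N , ∈-filter⁺ (λ M → isMatching? M ×-dec (#edges M ≟ r ⊓ s)) N∈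
    ( ( (λ x y y′ t t′ → proj₁ matching x y y′ (subst T (N≗M x y) t) (subst T (N≗M x y′) t′))
      , (λ x x′ y t t′ → proj₂ matching x x′ y (subst T (N≗M x y) t) (subst T (N≗M x′ y) t′)))
    , trans (#edges-cong N≗M) full) , N≗M

  ∈-maxMatchings⁻ : ∀ {M} → M ∈ maxMatchings r s → IsMatching M
  ∈-maxMatchings⁻ M∈ = proj₁ (proj₂ (∈-filter⁻ (λ M → isMatching? M ×-dec (#edges M ≟ r ⊓ s))
    {xs = functions r (functions s (true ∷ false ∷ []))} M∈))

ratio-nonzero : ∀ {a c} → 0 < a → 0 < c → ratio a c ≢ 0ℚ
ratio-nonzero {suc a} {suc c} _ _ eq = contradiction (subst ℚ.Positive eq (ℚ.normalize-pos (suc a) (suc c))) λ ()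

ratio-zero : ∀ c → ratio 0 c ≡ 0ℚ
ratio-zero zero    = refl
ratio-zero (suc c) = ℚ.0/n≡0 (suc c)

module _ (f : ℕ → ℚ) where

  largestNonzero≤ : ∀ m → largestNonzero f m ≤ m
  largestNonzero≤ zero = z≤n
  largestNonzero≤ (suc m) with f (suc m) ℚ.≟ 0ℚ
  ... | yes _ = ℕ.m≤n⇒m≤1+n (largestNonzero≤ m)
  ... | no  _ = ℕ.≤-refl

  ≤largestNonzero : ∀ m {t} → t ≤ m → f t ≢ 0ℚ → t ≤ largestNonzero f m
  ≤largestNonzero zero    t≤m ft = t≤m
  ≤largestNonzero (suc m) t≤m ft with f (suc m) ℚ.≟ 0ℚ
  ... | no  _ = t≤m
  ... | yes eq with ℕ.m≤n⇒m<n∨m≡n t≤m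
  ...   | inj₁ t<   = ≤largestNonzero m (ℕ.≤-pred t<) ft
  ...   | inj₂ refl = contradiction eq ft

  largestNonzero-nonzero : ∀ m → largestNonzero f m ≡ 0 ⊎ f (largestNonzero f m) ≢ 0ℚ
  largestNonzero-nonzero zero = inj₁ refl
  largestNonzero-nonzero (suc m) with f (suc m) ℚ.≟ 0ℚ
  ... | yes _ = largestNonzero-nonzero m
  ... | no ¬z = inj₂ ¬z

module _ {r s : ℕ} (H : Bicoloured r s) where

  private
    meet : Bicoloured r s → Bicoloured r s
    meet M x y = M x y ∧ H x y

    meet⁻ : ∀ M {x y} → T (meet M x y) → T (M x y) × T (H x y)
    meet⁻ M {x} {y} t with M x y | H x y
    ... | true | true = tt , tt

    meet⁺ : ∀ M {x y} → T (M x y) → T (H x y) → T (meet M x y)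
    meet⁺ M {x} {y} t u with M x y | H x y
    ... | true | true = tt

    meet-matching : ∀ {M} → IsMatching M → IsMatching (meet M)
    meet-matching {M} matching =
        (λ x y y′ t t′ → proj₁ matching x y y′ (proj₁ (meet⁻ M t)) (proj₁ (meet⁻ M t′)))
      , (λ x x′ y t t′ → proj₂ matching x x′ y (proj₁ (meet⁻ M t)) (proj₁ (meet⁻ M t′)))

  largestIndex≤ : largestIndex H ≤ r ⊓ s
  largestIndex≤ = largestNonzero≤ (q H) (r ⊓ s)

  -- A matching inside `H` extends to one with `r ⊓ s` edges. The extension may leave `H`, but it
  -- meets `H` in at least as many edges, and this number of common edges has positive probability.
  matching≤largestIndex : ∀ {M : Bicoloured r s} → IsMatching M → (∀ {x y} → T (M x y) → T (H x y)) →
    #edges M ≤ largestIndex H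
  matching≤largestIndex {M} matching M⊆H with completeMatching M matching
  ... | N , N-matching , M⊆N , full with ∈-maxMatchings⁺ N N-matching full
  ...   | N′ , N′∈ , N′≗N = ℕ.≤-trans
    (#edges-mono λ {x} {y} t → meet⁺ N′ (subst T (sym (N′≗N x y)) (M⊆N t)) (M⊆H t))
    (≤largestNonzero (q H) (r ⊓ s) (#edges≤ (meet-matching (∈-maxMatchings⁻ N′∈)))
      (ratio-nonzero (∈-length (∈-filter⁺ (λ M → #edges (meet M) ≟ #edges (meet N′)) N′∈ refl))
                     (∈-length N′∈)))

  nonzero⇒∈ : ∀ j → q H j ≢ 0ℚ → ∃ λ M → M ∈ maxMatchings r s × #edges (meet M) ≡ j
  nonzero⇒∈ j q≢0 = decide (Any.any? hit? (maxMatchings r s))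
    where
    hit? : ∀ M → Dec (#edges (meet M) ≡ j)
    hit? M = #edges (meet M) ≟ j
    decide : Dec (Any (λ M → #edges (meet M) ≡ j) (maxMatchings r s)) →
      ∃ λ M → M ∈ maxMatchings r s × #edges (meet M) ≡ j
    decide (yes any) = find any
    decide (no none) = contradiction
      (trans (cong (λ l → ratio (length l) (length (maxMatchings r s)))
               (List.filter-none hit? (All.¬Any⇒All¬ (maxMatchings r s) none)))
             (ratio-zero (length (maxMatchings r s))))
      q≢0

  -- Conversely, if a matching has exactly `j` edges in common with `H`, these edges form a matching
  -- of `H`. So the largest index is the size of some matching.
  largestMatching : ∃ λ (M : Bicoloured r s) →
    IsMatching M × (∀ {x y} → T (M x y) → T (H x y)) × #edges M ≡ largestIndex H
  largestMatching with largestNonzero-nonzero (q H) (r ⊓ s)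
  -- The value 0 may be the default of the search, which says nothing about `q H 0`; the empty
  -- matching serves in any case.
  ... | inj₁ j≡0 = (λ _ _ → false) , ((λ _ _ _ ()) , (λ _ _ _ ())) , (λ ()) ,
    trans (cong length (List.filter-none (λ e → T? false) {xs = cartesianProduct (allFin r) (allFin s)}
      (All.universal (λ _ ()) _))) (sym j≡0)
  ... | inj₂ q≢0 with nonzero⇒∈ (largestIndex H) q≢0
  ...   | M , M∈ , size = meet M , meet-matching (∈-maxMatchings⁻ M∈) , (proj₂ ∘ meet⁻ M) , size

-- Part listings

module _ {A : Set} where

  Unique-resp-↭ : ∀ {xs ys : List A} → xs ↭ ys → Unique xs → Unique ys
  Unique-resp-↭ p = PermS.Unique-resp-↭ (setoid A) (↭⇒↭ₛ p)

  Unique-++⁻ : ∀ (xs : List A) {ys} → Unique (xs ++ ys) → Unique xs × Unique ys × Disjoint xs ys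
  Unique-++⁻ []       uys          = [] , uys , λ ()
  Unique-++⁻ (x ∷ xs) (x∉ ∷ uxsys) with Unique-++⁻ xs uxsys | All.++⁻ xs x∉
  ... | uxs , uys , disj | x∉xs , x∉ys = x∉xs ∷ uxs , uys ,
    λ { (here refl , z∈) → All.lookup x∉ys z∈ refl ; (there z∈xs , z∈ys) → disj (z∈xs , z∈ys) }

  filter-++-complement-↭ : ∀ {P : A → Set} (P? : ∀ x → Dec (P x)) xs →
    xs ↭ filter P? xs ++ filter (¬? ∘ P?) xs
  filter-++-complement-↭ P? [] = ↭-refl
  filter-++-complement-↭ P? (x ∷ xs) with P? x
  ... | yes _ = ↭-prep x (filter-++-complement-↭ P? xs)
  ... | no  _ = ↭-trans (↭-prep x (filter-++-complement-↭ P? xs)) (↭-sym (shift x (filter P? xs) _))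

  drop-++ˡ-⊆ : ∀ m (xs : List A) {ys} → length xs ≤ m → drop m (xs ++ ys) ⊆ ys
  drop-++ˡ-⊆ zero    []       _        z∈ = z∈
  drop-++ˡ-⊆ (suc m) []       _ {x}       z∈ = drop-⊆ (suc m) _ z∈
    where
    drop-⊆ : ∀ m (xs : List A) → drop m xs ⊆ xs
    drop-⊆ zero    xs       z∈ = z∈
    drop-⊆ (suc m) (x ∷ xs) z∈ = there (drop-⊆ m xs z∈)
  drop-++ˡ-⊆ (suc m) (x ∷ xs) (s≤s le) z∈ = drop-++ˡ-⊆ m xs le z∈

  ↭-split : ∀ {xs : List A} (as {bs} : List A) → xs ↭ as ++ bs → as ⊆ xs × bs ⊆ xs
  ↭-split as p = (λ z∈ → ∈-resp-↭ (↭-sym p) (∈-++⁺ˡ z∈)) , (λ z∈ → ∈-resp-↭ (↭-sym p) (∈-++⁺ʳ as z∈))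

common : List ℕ → List ℕ → List ℕ
common cs ds = filter (_∈? ds) cs

-- The colours shared with `ds` are listed first. There are at most `j` of them, so the first `j`
-- entries contain them all and the remaining ones avoid `ds`.
splitOff : ∀ {cs ds j} → Unique cs → j ≤ length cs → length (common cs ds) ≤ j → ∃₂ λ as bs →
  cs ↭ as ++ bs × length as ≡ j × length bs ≡ length cs ∸ j × Disjoint bs ds
splitOff {cs} {ds} {j} ucs j≤ few = take j cs′ , drop j cs′
  , ↭-trans p (↭-reflexive (sym (List.take++drop≡id j cs′)))
  , trans (List.length-take j cs′) (ℕ.m≤n⇒m⊓n≡m (subst (j ≤_) (↭-length p) j≤))
  , trans (List.length-drop j cs′) (cong (_∸ j) (sym (↭-length p)))
  , λ (z∈bs , z∈ds) → proj₂ (∈-filter⁻ (¬? ∘ (_∈? ds)) {xs = cs} (drop-++ˡ-⊆ j (common cs ds) few z∈bs)) z∈ds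
  where
  cs′ : List ℕ
  cs′ = common cs ds ++ filter (¬? ∘ (_∈? ds)) cs
  p : cs ↭ cs′
  p = filter-++-complement-↭ (_∈? ds) cs

-- The pair (i , c) stands for a vertex at level i of colour c.
Letter : Set
Letter = ℕ × ℕ

-- The first letter belongs to the vertex in the earlier part.
Clash : Letter → Letter → Set
Clash (i , c) (i′ , c′) = c ≡ c′ × i′ ≤ i × i ≤ suc i′

NoClash : List Letter → List Letter → Set
NoClash A B = ∀ {x y} → x ∈ A → y ∈ B → ¬ Clash x y

partVertices : ∀ p → List (PartVertex p)
partVertices (v i)       = zero ∷ []
partVertices (b i r s H) = map inj₁ (allFin r) ++ map inj₂ (allFin s)

partLetter : ∀ p → (PartVertex p → ℕ) → PartVertex p → Letter
partLetter p g x = partLevel p x , g x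

PartProper : ∀ p → (PartVertex p → ℕ) → Set
PartProper p g = ∀ x y → Incomparable (PartEdge p) x y → g x ≢ g y

PartColouring : Part → List Letter → Set
PartColouring p A = Σ (PartVertex p → ℕ) λ g → PartProper p g × map (partLetter p g) (partVertices p) ↭ A

-- The list stands for a multiset: which vertex carries which letter is forgotten, since the
-- vertices of a part and of its replacement do not correspond.
Colouring : PartListing → List Letter → Set
Colouring []      A = A ↭ []
Colouring (p ∷ L) A = ∃₂ λ B C → A ↭ B ++ C × PartColouring p B × NoClash B C × Colouring L C

Colouring-resp : ∀ L {A B} → A ↭ B → Colouring L A → Colouring L B
Colouring-resp []      A↭B A↭[]                = ↭-trans (↭-sym A↭B) A↭[]
Colouring-resp (p ∷ L) A↭B (C , D , A↭CD , rest) = C , D , ↭-trans (↭-sym A↭B) A↭CD , rest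

PartColouring-resp : ∀ p {A B} → A ↭ B → PartColouring p A → PartColouring p B
PartColouring-resp p A↭B (g , proper , eq) = g , proper , ↭-trans eq A↭B

NoClash-⊆ : ∀ {A A′ B B′} → A′ ⊆ A → B′ ⊆ B → NoClash A B → NoClash A′ B′
NoClash-⊆ A′⊆ B′⊆ nc x∈ y∈ = nc (A′⊆ x∈) (B′⊆ y∈)

Colouring-++⁻ : ∀ K {L A} → Colouring (K ++ L) A → ∃₂ λ B C →
  A ↭ B ++ C × Colouring K B × NoClash B C × Colouring L C
Colouring-++⁻ []      {A = A} col = [] , A , ↭-refl , ↭-refl , (λ ()) , col
Colouring-++⁻ (p ∷ K) (B , C , A↭BC , part , nc , rest) with Colouring-++⁻ K rest
... | D , E , C↭DE , colK , nc′ , colL = B ++ D , E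
  , ↭-trans A↭BC (↭-trans (++⁺ˡ B C↭DE) (↭-sym (Perm.++-assoc B D E)))
  , (B , D , ↭-refl , part , NoClash-⊆ id D⊆C nc , colK)
  , nc″ , colL
  where
  D⊆C : D ⊆ C
  D⊆C = proj₁ (↭-split D C↭DE)
  nc″ : NoClash (B ++ D) E
  nc″ x∈ y∈ with ∈-++⁻ B x∈
  ... | inj₁ x∈B = nc x∈B (proj₂ (↭-split D C↭DE) y∈)
  ... | inj₂ x∈D = nc′ x∈D y∈

Colouring-++⁺ : ∀ K {L B C} → Colouring K B → NoClash B C → Colouring L C → Colouring (K ++ L) (B ++ C)
Colouring-++⁺ []      {L} {B} {C} B↭[] nc col = Colouring-resp L (++⁺ʳ C (↭-sym B↭[])) col
Colouring-++⁺ (p ∷ K) {L} {B} {C} (D , E , B↭DE , part , nc′ , colK) nc colL =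
  D , E ++ C , ↭-trans (++⁺ʳ C B↭DE) (Perm.++-assoc D E C) , part , nc″ ,
  Colouring-++⁺ K colK (NoClash-⊆ (proj₂ (↭-split D B↭DE)) id nc) colL
  where
  nc″ : NoClash D (E ++ C)
  nc″ x∈ y∈ with ∈-++⁻ E y∈
  ... | inj₁ y∈E = nc′ x∈ y∈E
  ... | inj₂ y∈C = nc (proj₁ (↭-split D B↭DE) x∈) y∈C

atLevel : ℕ → List ℕ → List Letter
atLevel i = map (i ,_)

∈-atLevel⁻ : ∀ {i cs j c} → (j , c) ∈ atLevel i cs → j ≡ i × c ∈ cs
∈-atLevel⁻ {i} x∈ with ∈-map⁻ (i ,_) x∈
... | c , c∈ , refl = refl , c∈

disjoint⇒noClash : ∀ {i j cs ds} → Disjoint cs ds → NoClash (atLevel i cs) (atLevel j ds)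
disjoint⇒noClash disj x∈ y∈ (refl , _) = disj (proj₂ (∈-atLevel⁻ x∈) , proj₂ (∈-atLevel⁻ y∈))

noClash⇒disjoint : ∀ {i j cs ds} → j ≤ i → i ≤ suc j → NoClash (atLevel i cs) (atLevel j ds) → Disjoint cs ds
noClash⇒disjoint {i} {j} j≤i i≤1+j nc (c∈cs , c∈ds) =
  nc (∈-map⁺ (i ,_) c∈cs) (∈-map⁺ (j ,_) c∈ds) (refl , j≤i , i≤1+j)

noClash-rising : ∀ {i cs ds} → NoClash (atLevel i cs) (atLevel (suc i) ds)
noClash-rising x∈ y∈ (_ , j≤i , _) with ∈-atLevel⁻ x∈ | ∈-atLevel⁻ y∈
... | refl , _ | refl , _ = ℕ.1+n≰n j≤i

noClash-++ʳ : ∀ {A} B {C} → NoClash A B → NoClash A C → NoClash A (B ++ C)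
noClash-++ʳ B nc nc′ x∈ y∈ with ∈-++⁻ B y∈
... | inj₁ y∈B = nc x∈ y∈B
... | inj₂ y∈C = nc′ x∈ y∈C

-- Vertices of equal level in different parts are incomparable, so their letters clash as soon as
-- the colours agree.
replicate-colouring⁻ : ∀ k {i A} → Colouring (replicate k (v i)) A → ∃ λ cs →
  A ↭ atLevel i cs × length cs ≡ k × Unique cs
replicate-colouring⁻ zero    A↭[] = [] , A↭[] , refl , []
replicate-colouring⁻ (suc k) {i} (B , C , A↭BC , (g , _ , p) , nc , col) with replicate-colouring⁻ k col
... | cs , C↭ , len , ucs = g zero ∷ cs
  , ↭-trans A↭BC (Perm.++⁺ (↭-sym p) C↭)
  , cong suc len
  , All.tabulate (λ c∈ g0≡c → nc (∈-resp-↭ p (here refl)) (∈-resp-↭ (↭-sym C↭) (∈-map⁺ (i ,_) c∈))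
      (g0≡c , ℕ.≤-refl , ℕ.n≤1+n _)) ∷ ucs

replicate-colouring⁺ : ∀ {k i} cs → length cs ≡ k → Unique cs → Colouring (replicate k (v i)) (atLevel i cs)
replicate-colouring⁺ []       refl []         = ↭-refl
replicate-colouring⁺ {i = i} (c ∷ cs) refl (c∉ ∷ ucs) =
  (i , c) ∷ [] , atLevel i cs , ↭-refl ,
  ((λ _ → c) , (λ { zero zero (x≢x , _) → contradiction refl x≢x }) , ↭-refl) ,
  disjoint⇒noClash {cs = c ∷ []} (λ { (here refl , c∈) → All.lookup c∉ c∈ refl }) ,
  replicate-colouring⁺ cs refl ucs

-- What the rest of the listing can see of a part: the colour sets of its levels, with a bound on
-- their overlap. A bicoloured part with matching number `j` and its replacement realise exactly the
-- same multisets of this kind.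
record TwoLevels (i r s j : ℕ) (A : List Letter) : Set where
  field
    lower upper  : List ℕ
    lower-unique : Unique lower
    upper-unique : Unique upper
    lower-length : length lower ≡ r
    upper-length : length upper ≡ s
    few-common   : length (common upper lower) ≤ j
    letters      : A ↭ atLevel i lower ++ atLevel (suc i) upper

common-unique : ∀ {cs} ds → Unique cs → Unique (common cs ds)
common-unique ds = Unique.filter⁺ (_∈? ds)

∈-common⁻ : ∀ {cs} ds {c} → c ∈ common cs ds → c ∈ cs × c ∈ ds
∈-common⁻ {cs} ds = ∈-filter⁻ (_∈? ds) {xs = cs}

common-⊆⇒few : ∀ {cs ds es} → Unique cs → (∀ {c} → c ∈ cs → c ∈ ds → c ∈ es) → length (common cs ds) ≤ length es
common-⊆⇒few {cs} {ds} ucs sub = unique-⊆⇒length≤ (common-unique ds ucs) λ c∈ →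
  sub (proj₁ (∈-common⁻ {cs} ds c∈)) (proj₂ (∈-common⁻ {cs} ds c∈))

module _ {i r s j : ℕ} where

  -- the case s ≤ r of the replacement
  manyLower⁻ : ∀ {A} → j ≤ s →
    Colouring (replicate (s ∸ j) (v (suc i)) ++ replicate r (v i) ++ replicate j (v (suc i))) A →
    TwoLevels i r s j A
  manyLower⁻ {A} j≤s col with Colouring-++⁻ (replicate (s ∸ j) (v (suc i))) col
  ... | B , CD , A↭ , colB , ncB , colCD with Colouring-++⁻ (replicate r (v i)) colCD
  ... | C , D , CD↭ , colC , ncC , colD
    with replicate-colouring⁻ (s ∸ j) colB | replicate-colouring⁻ r colC | replicate-colouring⁻ j colD
  ... | us , B↭ , us-len , us! | ls , C↭ , ls-len , ls! | us′ , D↭ , us′-len , us′! = record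
    { lower = ls ; upper = us ++ us′
    ; lower-unique = ls!
    ; upper-unique = Unique.++⁺ us! us′! (noClash⇒disjoint ℕ.≤-refl (ℕ.n≤1+n _) nc-us-us′)
    ; lower-length = ls-len
    ; upper-length = trans (List.length-++ us) (trans (cong₂ _+_ us-len us′-len) (ℕ.m∸n+n≡m j≤s))
    ; few-common   = subst (length (common (us ++ us′) ls) ≤_) us′-len
        (common-⊆⇒few (Unique.++⁺ us! us′! (noClash⇒disjoint ℕ.≤-refl (ℕ.n≤1+n _) nc-us-us′)) sub)
    ; letters = begin
        A                                                          ↭⟨ A↭ ⟩
        B ++ CD                                                    ↭⟨ ++⁺ B↭ (↭-trans CD↭ (++⁺ C↭ D↭)) ⟩
        atLevel (suc i) us ++ atLevel i ls ++ atLevel (suc i) us′  ↭⟨ shifts (atLevel (suc i) us) (atLevel i ls) ⟩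
        atLevel i ls ++ atLevel (suc i) us ++ atLevel (suc i) us′  ≡⟨ cong (atLevel i ls ++_) (List.map-++ _ us us′) ⟨
        atLevel i ls ++ atLevel (suc i) (us ++ us′)                ∎
    }
    where
    open PermutationReasoning
    C⊆ = proj₁ (↭-split C CD↭)
    D⊆ = proj₂ (↭-split C CD↭)
    nc-us-us′ : NoClash (atLevel (suc i) us) (atLevel (suc i) us′)
    nc-us-us′ = NoClash-⊆ (∈-resp-↭ (↭-sym B↭)) (D⊆ ∘ ∈-resp-↭ (↭-sym D↭)) ncB
    us-ls : Disjoint us ls
    us-ls = noClash⇒disjoint {suc i} {i} (ℕ.n≤1+n i) ℕ.≤-refl
      (NoClash-⊆ (∈-resp-↭ (↭-sym B↭)) (C⊆ ∘ ∈-resp-↭ (↭-sym C↭)) ncB)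
    sub : ∀ {c} → c ∈ us ++ us′ → c ∈ ls → c ∈ us′
    sub c∈ c∈ls with ∈-++⁻ us c∈
    ... | inj₁ c∈us  = ⊥-elim (us-ls (c∈us , c∈ls))
    ... | inj₂ c∈us′ = c∈us′

  -- The last `j` upper vertices lie above all lower ones and may share their colours; the first
  -- `s ∸ j` are incomparable to all lower ones. Hence the common colours go to the last block.
  manyLower⁺ : ∀ {A} → j ≤ s → TwoLevels i r s j A →
    Colouring (replicate (s ∸ j) (v (suc i)) ++ replicate r (v i) ++ replicate j (v (suc i))) A
  manyLower⁺ {A} j≤s two with splitOff upper-unique (subst (j ≤_) (sym upper-length) j≤s) few-common
    where open TwoLevels two
  ... | us′ , us , upper↭ , us′-len , us-len , us-lower = Colouring-resp _ (↭-sym (begin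
        A                                                             ↭⟨ letters ⟩
        atLevel i lower ++ atLevel (suc i) upper                      ↭⟨ ++⁺ˡ _ (map⁺ (suc i ,_) (↭-trans upper↭ (Perm.++-comm us′ us))) ⟩
        atLevel i lower ++ atLevel (suc i) (us ++ us′)                ≡⟨ cong (atLevel i lower ++_) (List.map-++ _ us us′) ⟩
        atLevel i lower ++ atLevel (suc i) us ++ atLevel (suc i) us′  ↭⟨ shifts (atLevel i lower) (atLevel (suc i) us) ⟩
        atLevel (suc i) us ++ atLevel i lower ++ atLevel (suc i) us′  ∎))
    (Colouring-++⁺ (replicate (s ∸ j) (v (suc i)))
      (replicate-colouring⁺ us (trans us-len (cong (_∸ j) upper-length)) (proj₁ (proj₂ unique)))
      (noClash-++ʳ (atLevel i lower) (disjoint⇒noClash us-lower)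
        (disjoint⇒noClash λ (c∈us , c∈us′) → proj₂ (proj₂ unique) (c∈us′ , c∈us)))
      (Colouring-++⁺ (replicate r (v i)) (replicate-colouring⁺ lower lower-length lower-unique) noClash-rising
        (replicate-colouring⁺ us′ us′-len (proj₁ unique))))
    where
    open TwoLevels two
    open PermutationReasoning
    unique : Unique us′ × Unique us × Disjoint us′ us
    unique = Unique-++⁻ us′ (Unique-resp-↭ upper↭ upper-unique)

  -- the case r < s of the replacement
  manyUpper⁻ : ∀ {A} → j ≤ r →
    Colouring (replicate j (v i) ++ replicate s (v (suc i)) ++ replicate (r ∸ j) (v i)) A →
    TwoLevels i r s j A
  manyUpper⁻ {A} j≤r col with Colouring-++⁻ (replicate j (v i)) col
  ... | B , CD , A↭ , colB , ncB , colCD with Colouring-++⁻ (replicate s (v (suc i))) colCD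
  ... | C , D , CD↭ , colC , ncC , colD
    with replicate-colouring⁻ j colB | replicate-colouring⁻ s colC | replicate-colouring⁻ (r ∸ j) colD
  ... | ls , B↭ , ls-len , ls! | us , C↭ , us-len , us! | ls′ , D↭ , ls′-len , ls′! = record
    { lower = ls ++ ls′ ; upper = us
    ; lower-unique = Unique.++⁺ ls! ls′! (noClash⇒disjoint ℕ.≤-refl (ℕ.n≤1+n _)
        (NoClash-⊆ (∈-resp-↭ (↭-sym B↭)) (D⊆ ∘ ∈-resp-↭ (↭-sym D↭)) ncB))
    ; upper-unique = us!
    ; lower-length = trans (List.length-++ ls) (trans (cong₂ _+_ ls-len ls′-len) (ℕ.m+[n∸m]≡n j≤r))
    ; upper-length = us-len
    ; few-common   = subst (length (common us (ls ++ ls′)) ≤_) ls-len (common-⊆⇒few us! sub)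
    ; letters = begin
        A                                                          ↭⟨ A↭ ⟩
        B ++ CD                                                    ↭⟨ ++⁺ B↭ (↭-trans CD↭ (++⁺ C↭ D↭)) ⟩
        atLevel i ls ++ atLevel (suc i) us ++ atLevel i ls′        ↭⟨ ++⁺ˡ (atLevel i ls) (Perm.++-comm (atLevel (suc i) us) _) ⟩
        atLevel i ls ++ atLevel i ls′ ++ atLevel (suc i) us        ↭⟨ Perm.++-assoc (atLevel i ls) _ _ ⟨
        (atLevel i ls ++ atLevel i ls′) ++ atLevel (suc i) us      ≡⟨ cong (_++ atLevel (suc i) us) (List.map-++ _ ls ls′) ⟨
        atLevel i (ls ++ ls′) ++ atLevel (suc i) us                ∎
    }
    where
    open PermutationReasoning
    D⊆ = proj₂ (↭-split C CD↭)
    us-ls′ : Disjoint us ls′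
    us-ls′ = noClash⇒disjoint {suc i} {i} (ℕ.n≤1+n i) ℕ.≤-refl
      (NoClash-⊆ (∈-resp-↭ (↭-sym C↭)) (∈-resp-↭ (↭-sym D↭)) ncC)
    sub : ∀ {c} → c ∈ us → c ∈ ls ++ ls′ → c ∈ ls
    sub c∈us c∈ with ∈-++⁻ ls c∈
    ... | inj₁ c∈ls  = c∈ls
    ... | inj₂ c∈ls′ = ⊥-elim (us-ls′ (c∈us , c∈ls′))

  -- The first `j` lower vertices lie below all upper ones, the last `r ∸ j` are incomparable to all
  -- of them. Hence the common colours go to the first block.
  manyUpper⁺ : ∀ {A} → j ≤ r → TwoLevels i r s j A →
    Colouring (replicate j (v i) ++ replicate s (v (suc i)) ++ replicate (r ∸ j) (v i)) A
  manyUpper⁺ {A} j≤r two with splitOff lower-unique (subst (j ≤_) (sym lower-length) j≤r)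
      -- `few-common` counts the common colours as entries of `upper`, whereas here they are picked
      -- out of `lower`.
      (ℕ.≤-trans (common-⊆⇒few {es = common upper lower} lower-unique λ c∈l c∈u → ∈-filter⁺ (_∈? lower) c∈u c∈l) few-common)
    where open TwoLevels two
  ... | ls , ls′ , lower↭ , ls-len , ls′-len , ls′-upper = Colouring-resp _ (↭-sym (begin
        A                                                             ↭⟨ letters ⟩
        atLevel i lower ++ atLevel (suc i) upper                      ↭⟨ ++⁺ʳ _ (map⁺ (i ,_) lower↭) ⟩
        atLevel i (ls ++ ls′) ++ atLevel (suc i) upper                ≡⟨ cong (_++ atLevel (suc i) upper) (List.map-++ _ ls ls′) ⟩
        (atLevel i ls ++ atLevel i ls′) ++ atLevel (suc i) upper      ↭⟨ Perm.++-assoc (atLevel i ls) _ _ ⟩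
        atLevel i ls ++ atLevel i ls′ ++ atLevel (suc i) upper        ↭⟨ ++⁺ˡ (atLevel i ls) (Perm.++-comm (atLevel i ls′) _) ⟩
        atLevel i ls ++ atLevel (suc i) upper ++ atLevel i ls′        ∎))
    (Colouring-++⁺ (replicate j (v i)) (replicate-colouring⁺ ls ls-len (proj₁ unique))
      (noClash-++ʳ (atLevel (suc i) upper) noClash-rising (disjoint⇒noClash (proj₂ (proj₂ unique))))
      (Colouring-++⁺ (replicate s (v (suc i))) (replicate-colouring⁺ upper upper-length upper-unique)
        (disjoint⇒noClash λ (c∈u , c∈l) → ls′-upper (c∈l , c∈u))
        (replicate-colouring⁺ ls′ (trans ls′-len (cong (_∸ j) lower-length)) (proj₁ (proj₂ unique)))))
    where
    open TwoLevels two
    open PermutationReasoning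
    unique : Unique ls × Unique ls′ × Disjoint ls ls′
    unique = Unique-++⁻ ls (Unique-resp-↭ lower↭ lower-unique)

module _ {A : Set} (_≟ᴬ_ : DecidableEquality A) where

  open DecMembership _≟ᴬ_ using () renaming (_∈?_ to _∈ᴬ?_)

  _╲_ : List A → List A → List A
  xs ╲ ys = filter (¬? ∘ (_∈ᴬ? ys)) xs

  ⊆⇒↭-++-╲ : ∀ {xs ys} → Unique xs → Unique ys → ys ⊆ xs → xs ↭ ys ++ (xs ╲ ys)
  ⊆⇒↭-++-╲ {xs} {ys} uxs uys ys⊆xs = unique-set⇒↭ uxs
    (Unique.++⁺ uys (Unique.filter⁺ _ uxs) λ (z∈ys , z∈rest) → proj₂ (∈-filter⁻ _ {xs = xs} z∈rest) z∈ys)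
    split
    (λ z∈ → [ ys⊆xs , (λ z∈rest → proj₁ (∈-filter⁻ _ {xs = xs} z∈rest)) ]′ (∈-++⁻ ys z∈))
    where
    split : xs ⊆ ys ++ (xs ╲ ys)
    split {z} z∈xs with z ∈ᴬ? ys
    ... | yes z∈ys = ∈-++⁺ˡ z∈ys
    ... | no  z∉ys = ∈-++⁺ʳ ys (∈-filter⁺ _ z∈xs z∉ys)

  assign : ∀ (xs : List A) (cs : List ℕ) → Unique xs → length xs ≡ length cs → ∃ λ g → map g xs ≡ cs
  assign []       []       _          _   = (λ _ → 0) , refl
  assign (x ∷ xs) (c ∷ cs) (x∉ ∷ uxs) len with assign xs cs uxs (ℕ.suc-injective len)
  ... | g , map-g = g′ , cong₂ _∷_ g′-x (trans (List.map-cong-local (All.tabulate g′-rest)) map-g)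
    where
    g′ : A → ℕ
    g′ y with y ≟ᴬ x
    ... | yes _ = c
    ... | no  _ = g y
    g′-x : g′ x ≡ c
    g′-x with x ≟ᴬ x
    ... | yes _  = refl
    ... | no x≢x = contradiction refl x≢x
    g′-rest : ∀ {y} → y ∈ xs → g′ y ≡ g y
    g′-rest {y} y∈ with y ≟ᴬ x
    ... | yes refl = contradiction refl (All.lookup x∉ y∈)
    ... | no  _    = refl

module _ {A B : Set} where

  ++-injectiveˡ : ∀ (as cs : List A) {bs ds} → length as ≡ length cs → as ++ bs ≡ cs ++ ds → as ≡ cs
  ++-injectiveˡ []       []       _   _  = refl
  ++-injectiveˡ (a ∷ as) (c ∷ cs) len eq = cong₂ _∷_ (List.∷-injectiveˡ eq)
    (++-injectiveˡ as cs (ℕ.suc-injective len) (List.∷-injectiveʳ eq))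

  map-≡⇒≡ : ∀ {f g : A → B} {xs} → map f xs ≡ map g xs → ∀ {x} → x ∈ xs → f x ≡ g x
  map-≡⇒≡ eq (here refl) = List.∷-injectiveˡ eq
  map-≡⇒≡ eq (there x∈)  = map-≡⇒≡ (List.∷-injectiveʳ eq) x∈

  Unique-map⇒injective : ∀ {f : A → B} {xs} → Unique (map f xs) →
    ∀ {x y} → x ∈ xs → y ∈ xs → f x ≡ f y → x ≡ y
  Unique-map⇒injective         (f∉ ∷ _) (here refl) (here refl) eq = refl
  Unique-map⇒injective {f = f} (f∉ ∷ _) (here refl) (there y∈)  eq = contradiction eq (All.lookup f∉ (∈-map⁺ f y∈))
  Unique-map⇒injective {f = f} (f∉ ∷ _) (there x∈)  (here refl) eq = contradiction (sym eq) (All.lookup f∉ (∈-map⁺ f x∈))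
  Unique-map⇒injective         (_ ∷ u)  (there x∈)  (there y∈)  eq = Unique-map⇒injective u x∈ y∈ eq

module _ {i r s : ℕ} (H : Bicoloured r s) where

  private
    letters-≡ : ∀ (g : Fin r ⊎ Fin s → ℕ) → map (partLetter (b i r s H) g) (partVertices (b i r s H))
      ≡ atLevel i (map (g ∘ inj₁) (allFin r)) ++ atLevel (suc i) (map (g ∘ inj₂) (allFin s))
    letters-≡ g = trans (List.map-++ (partLetter (b i r s H) g) (map inj₁ (allFin r)) (map inj₂ (allFin s))) (cong₂ _++_
      (trans (sym (List.map-∘ (allFin r))) (List.map-∘ (allFin r)))
      (trans (sym (List.map-∘ (allFin s))) (List.map-∘ (allFin s))))

  -- Each level is coloured injectively, so the pairs of a lower and an upper vertex of equal colour
  -- form a matching. Such a pair is comparable, hence an edge of `H`, and every common colour comes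
  -- from one.
  bicoloured⇒twoLevels : ∀ {A} → PartColouring (b i r s H) A → TwoLevels i r s (largestIndex H) A
  bicoloured⇒twoLevels {A} (g , proper , eq) = record
    { lower = lower ; upper = upper
    ; lower-unique = Unique.map⁺ lower-injective (Unique.allFin⁺ r)
    ; upper-unique = upper!
    ; lower-length = trans (List.length-map (g ∘ inj₁) (allFin r)) (List.length-tabulate {n = r} id)
    ; upper-length = trans (List.length-map (g ∘ inj₂) (allFin s)) (List.length-tabulate {n = s} id)
    ; few-common   = ℕ.≤-trans (subst (length (common upper lower) ≤_) (List.length-map (g ∘ inj₁ ∘ proj₁) (edges M)) (common-⊆⇒few {ds = lower} upper! sub))
        (matching≤largestIndex H matching M⊆H)
    ; letters      = ↭-trans (↭-sym eq) (↭-reflexive (letters-≡ g))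
    }
    where
    lower upper : List ℕ
    lower = map (g ∘ inj₁) (allFin r)
    upper = map (g ∘ inj₂) (allFin s)
    lower-injective : ∀ {x y} → g (inj₁ x) ≡ g (inj₁ y) → x ≡ y
    lower-injective {x} {y} eq = decidable-stable (x Fin.≟ y) λ x≢y →
      proper (inj₁ x) (inj₁ y) ((x≢y ∘ Sum.inj₁-injective) , (λ ()) , λ ()) eq
    upper-injective : ∀ {x y} → g (inj₂ x) ≡ g (inj₂ y) → x ≡ y
    upper-injective {x} {y} eq = decidable-stable (x Fin.≟ y) λ x≢y →
      proper (inj₂ x) (inj₂ y) ((x≢y ∘ Sum.inj₂-injective) , (λ ()) , λ ()) eq
    upper! : Unique upper
    upper! = Unique.map⁺ upper-injective (Unique.allFin⁺ s)
    M : Bicoloured r s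
    M x y = g (inj₁ x) ℕ.≡ᵇ g (inj₂ y)
    M⁻ : ∀ {x y} → T (M x y) → g (inj₁ x) ≡ g (inj₂ y)
    M⁻ = ℕ.≡ᵇ⇒≡ _ _
    matching : IsMatching M
    matching = (λ x y y′ t t′ → upper-injective (trans (sym (M⁻ t)) (M⁻ t′)))
             , (λ x x′ y t t′ → lower-injective (trans (M⁻ t) (sym (M⁻ t′))))
    M⊆H : ∀ {x y} → T (M x y) → T (H x y)
    M⊆H {x} {y} t = decidable-stable (T? (H x y)) λ ¬h →
      proper (inj₁ x) (inj₂ y) ((λ ()) , ¬h , λ ()) (M⁻ t)
    sub : ∀ {c} → c ∈ upper → c ∈ lower → c ∈ map (g ∘ inj₁ ∘ proj₁) (edges M)
    sub c∈upper c∈lower with ∈-map⁻ (g ∘ inj₂) c∈upper | ∈-map⁻ (g ∘ inj₁) c∈lower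
    ... | y , _ , eq-y | x , _ , refl = ∈-map⁺ (g ∘ inj₁ ∘ proj₁) (∈-edges⁺ M {x} {y} (ℕ.≡⇒≡ᵇ _ _ eq-y))

  -- The common colours are put on the edges of a largest matching.
  twoLevels⇒bicoloured : ∀ {A} → TwoLevels i r s (largestIndex H) A → PartColouring (b i r s H) A
  twoLevels⇒bicoloured {A} two with largestMatching H
  ... | M , matching , M⊆H , size = g , proper ,
    ↭-trans (↭-reflexive (letters-≡ g)) (↭-trans (++⁺ (map⁺ (i ,_) map-gˡ↭) (map⁺ (suc i ,_) map-gᵘ↭)) (↭-sym letters))
    where
    open TwoLevels two
    K : List ℕ
    K = common upper lower
    K! : Unique K
    K! = common-unique lower upper-unique
    E : List (Fin r × Fin s)
    E = take (length K) (edges M)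
    E-length : length E ≡ length K
    E-length = trans (List.length-take (length K) (edges M)) (ℕ.m≤n⇒m⊓n≡m (subst (length K ≤_) (sym size) few-common))
    E⊆ : ∀ {x y} → (x , y) ∈ E → T (H x y)
    E⊆ e∈ = M⊆H (∈-edges⁻ M (subst (_ ∈_) (List.take++drop≡id (length K) (edges M)) (∈-++⁺ˡ e∈)))

    module Side {n} (end : Fin r × Fin s → Fin n) (ends! : Unique (map end (edges M)))
      (cs : List ℕ) (cs! : Unique cs) (cs-length : length cs ≡ n) (K⊆cs : K ⊆ cs) where

      Ends : List (Fin n)
      Ends = map end E
      Ends! : Unique Ends
      Ends! = subst Unique (List.take-map {f = end} (length K) (edges M)) (Unique.take⁺ (length K) ends!)
      vertices↭ : allFin n ↭ Ends ++ _╲_ Fin._≟_ (allFin n) Ends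
      vertices↭ = ⊆⇒↭-++-╲ Fin._≟_ (Unique.allFin⁺ n) Ends! (λ _ → ∈-allFin _)
      colours↭ : cs ↭ K ++ _╲_ _≟_ cs K
      colours↭ = ⊆⇒↭-++-╲ _≟_ cs! K! K⊆cs
      assignment : ∃ λ f → map f (Ends ++ _╲_ Fin._≟_ (allFin n) Ends) ≡ K ++ _╲_ _≟_ cs K
      assignment = assign Fin._≟_ _ _ (Unique-resp-↭ vertices↭ (Unique.allFin⁺ n))
        (trans (sym (↭-length vertices↭)) (trans (List.length-tabulate {n = n} id) (trans (sym cs-length) (↭-length colours↭))))
      f : Fin n → ℕ
      f = proj₁ assignment
      map-f↭ : map f (allFin n) ↭ cs
      map-f↭ = ↭-trans (map⁺ f vertices↭) (↭-trans (↭-reflexive (proj₂ assignment)) (↭-sym colours↭))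
      f-injective : ∀ {x y} → f x ≡ f y → x ≡ y
      f-injective = Unique-map⇒injective (Unique-resp-↭ (↭-sym map-f↭) cs!) (∈-allFin _) (∈-allFin _)
      -- An equality of lists, with the same `K` in the same order on both sides: this is what gives
      -- the two ends of each edge in `E` the same colour.
      f-E : map (f ∘ end) E ≡ K
      f-E = trans (List.map-∘ E) (++-injectiveˡ {B = ℕ} (map f Ends) K
        (trans (List.length-map f Ends) (trans (List.length-map end E) E-length))
        (trans (sym (List.map-++ f Ends _)) (proj₂ assignment)))
      f∈cs : ∀ x → f x ∈ cs
      f∈cs x = ∈-resp-↭ map-f↭ (∈-map⁺ f (∈-allFin x))

    module Lower = Side proj₁ (lowerEnds-unique matching) lower lower-unique lower-length
      (proj₂ ∘ ∈-common⁻ {upper} lower)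
    module Upper = Side proj₂ (upperEnds-unique matching) upper upper-unique upper-length
      (proj₁ ∘ ∈-common⁻ {upper} lower)

    g : Fin r ⊎ Fin s → ℕ
    g = [ Lower.f , Upper.f ]′

    map-gˡ↭ : map (g ∘ inj₁) (allFin r) ↭ lower
    map-gˡ↭ = Lower.map-f↭
    map-gᵘ↭ : map (g ∘ inj₂) (allFin s) ↭ upper
    map-gᵘ↭ = Upper.map-f↭

    -- A colour on both levels belongs to `K`, hence sits on an edge in `E`. Injectivity on either
    -- side identifies `x` and `y` with the ends of that edge.
    same⇒edge : ∀ x y → Lower.f x ≡ Upper.f y → T (H x y)
    same⇒edge x y eq with ∈-map⁻ (Lower.f ∘ proj₁) (subst (Lower.f x ∈_) (sym Lower.f-E)
      (∈-filter⁺ _ (subst (_∈ upper) (sym eq) (Upper.f∈cs y)) (Lower.f∈cs x)))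
    ... | e , e∈ , eq′ = subst₂ (λ x y → T (H x y))
      (sym (Lower.f-injective eq′))
      (sym (Upper.f-injective (trans (sym eq) (trans eq′ (map-≡⇒≡ (trans Lower.f-E (sym Upper.f-E)) e∈)))))
      (E⊆ e∈)

    proper : PartProper (b i r s H) g
    proper (inj₁ x) (inj₁ y) (x≢y , _)    eq = x≢y (cong inj₁ (Lower.f-injective eq))
    proper (inj₂ x) (inj₂ y) (x≢y , _)    eq = x≢y (cong inj₂ (Upper.f-injective eq))
    proper (inj₁ x) (inj₂ y) (_ , ¬h , _) eq = ¬h (same⇒edge x y eq)
    proper (inj₂ x) (inj₁ y) (_ , _ , ¬h) eq = ¬h (same⇒edge y x (sym eq))

reducePart-colouring⁻ : ∀ p {A} → Colouring (reducePart p) A → PartColouring p A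
reducePart-colouring⁻ (v i) (B , C , A↭BC , part , _ , C↭[]) =
  PartColouring-resp (v i) (↭-sym (↭-trans A↭BC (↭-trans (++⁺ˡ B C↭[]) (Perm.++-identityʳ B)))) part
reducePart-colouring⁻ (b i r s H) col with s ≤ᵇ r
... | true  = twoLevels⇒bicoloured H (manyLower⁻ (ℕ.≤-trans (largestIndex≤ H) (ℕ.m⊓n≤n r s)) col)
... | false = twoLevels⇒bicoloured H (manyUpper⁻ (ℕ.≤-trans (largestIndex≤ H) (ℕ.m⊓n≤m r s)) col)

reducePart-colouring⁺ : ∀ p {A} → PartColouring p A → Colouring (reducePart p) A
reducePart-colouring⁺ (v i) {A} part = A , [] , ↭-sym (Perm.++-identityʳ A) , part , (λ _ ()) , ↭-refl
reducePart-colouring⁺ (b i r s H) part with s ≤ᵇ r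
... | true  = manyLower⁺ (ℕ.≤-trans (largestIndex≤ H) (ℕ.m⊓n≤n r s)) (bicoloured⇒twoLevels H part)
... | false = manyUpper⁺ (ℕ.≤-trans (largestIndex≤ H) (ℕ.m⊓n≤m r s)) (bicoloured⇒twoLevels H part)

reduce-colouring⁻ : ∀ L {A} → Colouring (reduce L) A → Colouring L A
reduce-colouring⁻ []      col = col
reduce-colouring⁻ (p ∷ L) col with Colouring-++⁻ (reducePart p) col
... | B , C , A↭BC , colB , nc , colC = B , C , A↭BC , reducePart-colouring⁻ p colB , nc , reduce-colouring⁻ L colC

reduce-colouring⁺ : ∀ L {A} → Colouring L A → Colouring (reduce L) A
reduce-colouring⁺ []      col = col
reduce-colouring⁺ (p ∷ L) (B , C , A↭BC , part , nc , col) = Colouring-resp (reduce (p ∷ L)) (↭-sym A↭BC)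
  (Colouring-++⁺ (reducePart p) (reducePart-colouring⁺ p part) nc (reduce-colouring⁺ L col))

-- Proper colourings of the poset of a part listing

partVertices-unique : ∀ p → Unique (partVertices p)
partVertices-unique (v i)       = [] ∷ []
partVertices-unique (b i r s H) = Unique.++⁺
  (Unique.map⁺ Sum.inj₁-injective (Unique.allFin⁺ r)) (Unique.map⁺ Sum.inj₂-injective (Unique.allFin⁺ s))
  disjoint
  where
  disjoint : ∀ {z} → ¬ (z ∈ map inj₁ (allFin r) × z ∈ map inj₂ (allFin s))
  disjoint (z∈ , z∈′) with ∈-map⁻ inj₁ z∈ | ∈-map⁻ inj₂ z∈′
  ... | _ , _ , refl | _ , _ , ()

partVertices-complete : ∀ p x → x ∈ partVertices p
partVertices-complete (v i)       zero     = here refl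
partVertices-complete (b i r s H) (inj₁ x) = ∈-++⁺ˡ (∈-map⁺ inj₁ (∈-allFin x))
partVertices-complete (b i r s H) (inj₂ y) = ∈-++⁺ʳ (map inj₁ (allFin r)) (∈-map⁺ inj₂ (∈-allFin y))

later : ∀ {p L} → Vertex L → Vertex (p ∷ L)
later (i , x) = suc i , x

vertices : ∀ L → List (Vertex L)
vertices []      = []
vertices (p ∷ L) = map (zero ,_) (partVertices p) ++ map later (vertices L)

vertices-unique : ∀ L → Unique (vertices L)
vertices-unique []      = []
vertices-unique (p ∷ L) = Unique.++⁺
  (Unique.map⁺ (λ { refl → refl }) (partVertices-unique p))
  (Unique.map⁺ (λ { refl → refl }) (vertices-unique L))
  disjoint
  where
  disjoint : ∀ {z} → ¬ (z ∈ map (zero ,_) (partVertices p) × z ∈ map later (vertices L))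
  disjoint (z∈ , z∈′) with ∈-map⁻ _ z∈ | ∈-map⁻ later z∈′
  ... | _ , _ , refl | _ , _ , ()

vertices-complete : ∀ L x → x ∈ vertices L
vertices-complete (p ∷ L) (zero  , x) = ∈-++⁺ˡ (∈-map⁺ _ (partVertices-complete p x))
vertices-complete (p ∷ L) (suc i , x) = ∈-++⁺ʳ (map _ (partVertices p)) (∈-map⁺ later (vertices-complete L (i , x)))

letter : ∀ L → (Vertex L → ℕ) → Vertex L → Letter
letter L g x = level L x , g x

IsProperColouring : ∀ L → (Vertex L → ℕ) → Set
IsProperColouring L g = ∀ x y → Incomparable (Below L) x y → g x ≢ g y

-- Levels inside one part differ by at most 1 and no part precedes itself, which leaves only the
-- edges.
below-head⁻ : ∀ {p L x y} → Below (p ∷ L) (zero , x) (zero , y) → PartEdge p x y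
below-head⁻ {v i}       (twoLevels le) = contradiction le (ℕ.m+1+n≰m i)
below-head⁻ {b i r s H} {x = inj₁ _} {inj₁ _} (twoLevels le) = contradiction le (ℕ.m+1+n≰m i)
below-head⁻ {b i r s H} {x = inj₁ _} {inj₂ _} (twoLevels le) =
  contradiction (subst (_≤ suc i) (ℕ.+-suc i 1) le) (ℕ.m+1+n≰m (suc i))
below-head⁻ {b i r s H} {x = inj₂ _} {inj₁ _} (twoLevels le) = contradiction (ℕ.≤-trans (ℕ.n≤1+n _) le) (ℕ.m+1+n≰m i)
below-head⁻ {b i r s H} {x = inj₂ _} {inj₂ _} (twoLevels le) = contradiction le (ℕ.m+1+n≰m (suc i))
below-head⁻ (partBefore _ ())
below-head⁻ (edge e) = e

below-later⁻ : ∀ {p L} {x y : Vertex L} → Below (p ∷ L) (later x) (later y) → Below L x y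
below-later⁻ (twoLevels le)              = twoLevels le
below-later⁻ (partBefore eq (s≤s i<j)) = partBefore eq i<j
below-later⁻ (edge e)                    = edge e

below-later⁺ : ∀ {p L} {x y : Vertex L} → Below L x y → Below (p ∷ L) (later x) (later y)
below-later⁺ (twoLevels le)       = twoLevels le
below-later⁺ (partBefore eq i<j) = partBefore eq (s≤s i<j)
below-later⁺ (edge e)             = edge e

module _ {p L} {x : PartVertex p} {y : Vertex L} where

  private
    i j : ℕ
    i = partLevel p x
    j = level L y

  -- Across parts only levels matter. The vertex `x` of the earlier part is below `y` exactly when
  -- `i < j`, and above `y` exactly when `j + 2 ≤ i`; what remains is the condition in `Clash`.
  incomparable-across : j ≤ i → i ≤ suc j → Incomparable (Below (p ∷ L)) (zero , x) (later y)
  incomparable-across j≤i i≤1+j = (λ ()) , before , after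
    where
    before : ¬ Below (p ∷ L) (zero , x) (later y)
    before (twoLevels le)    = ℕ.m+1+n≰m i (ℕ.≤-trans le j≤i)
    before (partBefore eq _) = ℕ.1+n≰n (subst (_≤ i) (sym eq) j≤i)
    after : ¬ Below (p ∷ L) (later y) (zero , x)
    after (twoLevels le)    = ℕ.m+1+n≰m (suc j) (subst (_≤ suc j) (ℕ.+-suc j 1) (ℕ.≤-trans le i≤1+j))
    after (partBefore _ ())

  incomparable-across⁻ : Incomparable (Below (p ∷ L)) (zero , x) (later y) → j ≤ i × i ≤ suc j
  incomparable-across⁻ (_ , ¬before , ¬after) =
      ℕ.≤-pred (ℕ.≤∧≢⇒< (ℕ.≮⇒≥ λ lt → ¬before (twoLevels (subst (_≤ j) (sym (ℕ.+-comm i 2)) lt)))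
        (λ eq → ¬before (partBefore (sym eq) (s≤s z≤n))))
    , ℕ.≮⇒≥ λ lt → ¬after (twoLevels (subst (_≤ i) (sym (ℕ.+-comm j 2)) lt))

private
  letters-∷ : ∀ p L g → map (letter (p ∷ L) g) (vertices (p ∷ L)) ≡
    map (partLetter p (λ x → g (zero , x))) (partVertices p) ++ map (letter L (g ∘ later)) (vertices L)
  letters-∷ p L g = trans (List.map-++ (letter (p ∷ L) g) (map (zero ,_) (partVertices p)) (map later (vertices L)))
    (cong₂ _++_ (sym (List.map-∘ (partVertices p))) (sym (List.map-∘ (vertices L))))

proper⇒colouring : ∀ L {g} → IsProperColouring L g → Colouring L (map (letter L g) (vertices L))
proper⇒colouring []      proper = ↭-refl
proper⇒colouring (p ∷ L) {g} proper = _ , _ , ↭-reflexive (letters-∷ p L g) ,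
  ( (λ x → g (zero , x))
  , (λ x y (x≢y , ¬xy , ¬yx) → proper (zero , x) (zero , y) ((λ { refl → x≢y refl }) , ¬xy ∘ below-head⁻ , ¬yx ∘ below-head⁻))
  , ↭-refl)
  , noClash ,
  proper⇒colouring L λ x y (x≢y , ¬xy , ¬yx) →
    proper (later x) (later y) ((λ { refl → x≢y refl }) , ¬xy ∘ below-later⁻ , ¬yx ∘ below-later⁻)
  where
  noClash : NoClash (map (partLetter p (λ x → g (zero , x))) (partVertices p)) (map (letter L (g ∘ later)) (vertices L))
  noClash x∈ y∈ (eq , le , le′) with ∈-map⁻ _ x∈ | ∈-map⁻ _ y∈
  ... | x , _ , refl | y , _ , refl = proper (zero , x) (later y) (incomparable-across le le′) eq

colouring⇒proper : ∀ L {A} → Colouring L A → ∃ λ g →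
  IsProperColouring L g × map (letter L g) (vertices L) ↭ A
colouring⇒proper []      A↭[] = (λ _ → 0) , (λ { (() , _) }) , ↭-sym A↭[]
colouring⇒proper (p ∷ L) {A} (B , C , A↭BC , (g₀ , proper₀ , g₀↭) , nc , col) with colouring⇒proper L col
... | g₁ , proper₁ , g₁↭ = g , proper ,
  ↭-trans (↭-reflexive (letters-∷ p L g)) (↭-trans (++⁺ g₀↭ g₁↭) (↭-sym A↭BC))
  where
  g : Vertex (p ∷ L) → ℕ
  g (zero  , x) = g₀ x
  g (suc i , x) = g₁ (i , x)
  across : ∀ x y → Incomparable (Below (p ∷ L)) (zero , x) (later y) → g₀ x ≢ g₁ y
  across x y inc eq = nc
    (∈-resp-↭ g₀↭ (∈-map⁺ _ (partVertices-complete p x)))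
    (∈-resp-↭ g₁↭ (∈-map⁺ _ (vertices-complete L y)))
    (eq , incomparable-across⁻ inc)
  proper : IsProperColouring (p ∷ L) g
  proper (zero , x)  (zero , y)  (x≢y , ¬xy , ¬yx) = proper₀ x y ((λ { refl → x≢y refl }) , ¬xy ∘ edge , ¬yx ∘ edge)
  proper (zero , x)  (suc j , y) inc               = across x (j , y) inc
  proper (suc i , x) (zero , y)  (x≢y , ¬xy , ¬yx) = across y (i , x) (≢-sym x≢y , ¬yx , ¬xy) ∘ sym
  proper (suc i , x) (suc j , y) (x≢y , ¬xy , ¬yx) =
    proper₁ (i , x) (j , y) ((λ { refl → x≢y refl }) , ¬xy ∘ below-later⁺ , ¬yx ∘ below-later⁺)

-- Weights and order isomorphisms

occurrences : List ℕ → ℕ → ℕ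
occurrences cs c = length (filter (_≟ c) cs)

occurrences-↭ : ∀ {cs ds} → cs ↭ ds → occurrences cs ≗ occurrences ds
occurrences-↭ p c = ↭-length (filter-↭ (_≟ c) p)

wt≡occurrences : ∀ {n} (f : Fin n → ℕ) c → wt f c ≡ occurrences (map f (allFin n)) c
wt≡occurrences {n} f c = trans (sym (List.length-map f (filter (λ x → f x ≟ c) (allFin n)))) (cong length (map-filter (allFin n)))
  where
  map-filter : ∀ xs → map f (filter (λ x → f x ≟ c) xs) ≡ filter (_≟ c) (map f xs)
  map-filter []       = refl
  map-filter (x ∷ xs) with f x ℕ.≡ᵇ c
  ... | true  = cong (f x ∷_) (map-filter xs)
  ... | false = map-filter xs

-- Maps in both directions are taken instead of an isomorphism, because the isomorphism for `G(P)`
-- starts at the graph and the one for `G(d)` ends there.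
module _ {n} (G : Graph n) (L : PartListing) (φ : Fin n → Vertex L) (ψ : Vertex L → Fin n)
  (φψ : ∀ x → φ (ψ x) ≡ x) (ψφ : ∀ u → ψ (φ u) ≡ u)
  (adj⇒inc : ∀ {u w} → Adj G u w → Incomparable (Below L) (φ u) (φ w))
  (inc⇒adj : ∀ {x y} → Incomparable (Below L) x y → Adj G (ψ x) (ψ y)) where

  private
    allFin↭ : allFin n ↭ map ψ (vertices L)
    allFin↭ = unique-set⇒↭ (Unique.allFin⁺ n)
      (Unique.map⁺ (λ {x} {y} eq → trans (sym (φψ x)) (trans (cong φ eq) (φψ y))) (vertices-unique L))
      (λ {u} _ → subst (_∈ map ψ (vertices L)) (ψφ u) (∈-map⁺ ψ (vertices-complete L (φ u))))
      (λ _ → ∈-allFin _)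

    colours : ∀ (f : Fin n → ℕ) → map f (allFin n) ↭ map (f ∘ ψ) (vertices L)
    colours f = ↭-trans (map⁺ f allFin↭) (↭-reflexive (sym (List.map-∘ (vertices L))))

  hasWeight⇒colouring : ∀ {γ} → HasWeight G γ → ∃ λ A → Colouring L A × occurrences (map proj₂ A) ≗ γ
  hasWeight⇒colouring (f , proper , weight) = map (letter L (f ∘ ψ)) (vertices L) ,
    proper⇒colouring L (λ x y inc → proper (ψ x) (ψ y) (inc⇒adj inc)) ,
    λ c → trans (cong (λ cs → occurrences cs c) (sym (List.map-∘ (vertices L))))
      (trans (occurrences-↭ (↭-sym (colours f)) c) (trans (sym (wt≡occurrences f c)) (weight c)))

  colouring⇒hasWeight : ∀ {γ A} → Colouring L A → occurrences (map proj₂ A) ≗ γ → HasWeight G γ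
  colouring⇒hasWeight {A = A} col weight with colouring⇒proper L col
  ... | g , proper , g↭A = g ∘ φ , (λ u w adj → proper (φ u) (φ w) (adj⇒inc adj)) ,
    λ c → trans (wt≡occurrences (g ∘ φ) c) (trans (occurrences-↭ same c) (weight c))
    where
    same : map (g ∘ φ) (allFin n) ↭ map proj₂ A
    same = begin
      map (g ∘ φ) (allFin n)                       ↭⟨ colours (g ∘ φ) ⟩
      map (g ∘ φ ∘ ψ) (vertices L)                 ≡⟨ List.map-cong (λ x → cong g (φψ x)) (vertices L) ⟩
      map g (vertices L)                           ≡⟨ List.map-∘ (vertices L) ⟩
      map proj₂ (map (letter L g) (vertices L))    ↭⟨ map⁺ proj₂ g↭A ⟩
      map proj₂ A                                  ∎
      where open PermutationReasoning

module Inverse {A B : Set} {R : Rel A 0ℓ} {S : Rel B 0ℓ} (R≅S : R ≅ S) where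

  to : A → B
  to = proj₁ R≅S

  open IsOrderIsomorphism (proj₂ R≅S) public using (mono; cancel; injective; surjective)

  from : B → A
  from y = proj₁ (surjective y)

  to∘from : ∀ y → to (from y) ≡ y
  to∘from y = proj₂ (surjective y) refl

  from∘to : ∀ x → from (to x) ≡ x
  from∘to x = injective (to∘from (to x))

  mono⁻¹ : ∀ {x y} → S x y → R (from x) (from y)
  mono⁻¹ {x} {y} s = cancel (subst₂ S (sym (to∘from x)) (sym (to∘from y)) s)

≅-incomparable : ∀ {A B : Set} {R : Rel A 0ℓ} {S : Rel B 0ℓ} → R ≅ S → Incomparable R ≅ Incomparable S
≅-incomparable {R = R} {S} R≅S@(f , iso) = f , record
  { isOrderMonomorphism = record
    { isOrderHomomorphism = record
      { cong = cong f
      ; mono = λ (x≢y , ¬xy , ¬yx) → x≢y ∘ injective , ¬xy ∘ cancel , ¬yx ∘ cancel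
      }
    ; injective = injective
    ; cancel    = λ (x≢y , ¬xy , ¬yx) → x≢y ∘ cong f , ¬xy ∘ mono , ¬yx ∘ mono
    }
  ; surjective = surjective
  }
  where open Inverse R≅S

module _ {n} (P : FinPoset n) (L : PartListing) (P≅L : FinPoset._≺_ P ≅ Below L)
  {m} (d : DyckPath m) (L≅d : Incomparable (Below (reduce L)) ≅ Adj (indifferenceGraph d)) where

  private
    P≅L′ : Adj (incGraph P) ≅ Incomparable (Below L)
    P≅L′ = ≅-incomparable {S = Below L} P≅L
    module P = Inverse P≅L′
    module D = Inverse {S = Adj (indifferenceGraph d)} L≅d

  -- The multiset of letters `A` is kept through the replacement, and its second components
  -- determine the weight.
  poset⇒indifference : ∀ {γ} → HasWeight (incGraph P) γ → HasWeight (indifferenceGraph d) γ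
  poset⇒indifference w with hasWeight⇒colouring (incGraph P) L (proj₁ P≅L′) P.from P.to∘from P.from∘to P.mono P.mono⁻¹ w
  ... | A , col , weight = colouring⇒hasWeight (indifferenceGraph d) (reduce L)
    D.from (proj₁ L≅d) D.from∘to D.to∘from D.mono⁻¹ D.mono (reduce-colouring⁺ L col) weight

  indifference⇒poset : ∀ {γ} → HasWeight (indifferenceGraph d) γ → HasWeight (incGraph P) γ
  indifference⇒poset w with hasWeight⇒colouring (indifferenceGraph d) (reduce L)
      D.from (proj₁ L≅d) D.from∘to D.to∘from D.mono⁻¹ D.mono w
  ... | A , col , weight = colouring⇒hasWeight (incGraph P) L (proj₁ P≅L′) P.from P.to∘from P.from∘to P.mono P.mono⁻¹
    (reduce-colouring⁻ L col) weight

-- Real numbers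

Eventually : (ℕ → Set) → Set
Eventually P = ∃ λ N → ∀ n → N ℕ.≤ n → P n

ev-map : ∀ {P Q : ℕ → Set} → (∀ {n} → P n → Q n) → Eventually P → Eventually Q
ev-map f (N , p) = N , λ n N≤n → f (p n N≤n)

ev-map₂ : ∀ {P Q R : ℕ → Set} → (∀ {n} → P n → Q n → R n) → Eventually P → Eventually Q → Eventually R
ev-map₂ f (M , p) (N , q) = M ℕ.+ N , λ n M+N≤n →
  f (p n (ℕ.m+n≤o⇒m≤o M M+N≤n)) (q n (ℕ.m+n≤o⇒n≤o M M+N≤n))

module _ where

  open ℚ.≤-Reasoning
  open ℚ-Solver using (solve; _:=_; _:+_; _:*_; _:-_; :-_)

  p≤∣p∣ : ∀ p → p ℚ.≤ ℚ.∣ p ∣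
  p≤∣p∣ p with ℚ.≤-total 0ℚ p
  ... | inj₁ 0≤p = ℚ.≤-reflexive (sym (ℚ.0≤p⇒∣p∣≡p 0≤p))
  ... | inj₂ p≤0 = ℚ.≤-trans p≤0 (ℚ.0≤∣p∣ p)

  *-positive : ∀ {p q} → 0ℚ ℚ.< p → 0ℚ ℚ.< q → 0ℚ ℚ.< p ℚ.* q
  *-positive {p} {q} 0<p 0<q = subst (ℚ._< p ℚ.* q) (ℚ.*-zeroˡ q) (ℚ.*-monoˡ-<-pos q {{ℚ.positive 0<q}} 0<p)

  half : ∀ {ε} → 0ℚ ℚ.< ε → ∃ λ δ → 0ℚ ℚ.< δ × δ ℚ.+ δ ≡ ε
  half {ε} 0<ε = ε ℚ.* ½ , *-positive 0<ε (ℚ.positive⁻¹ ½) ,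
    trans (sym (ℚ.*-distribˡ-+ ε ½ ½)) (ℚ.*-identityʳ ε)

  quotient : ∀ {ε B} → 0ℚ ℚ.< ε → 0ℚ ℚ.< B → ∃ λ δ → 0ℚ ℚ.< δ × B ℚ.* δ ≡ ε
  quotient {ε} {B} 0<ε 0<B = (ℚ.1/ B) ℚ.* ε
    , *-positive (ℚ.positive⁻¹ (ℚ.1/ B) {{ℚ.1/pos⇒pos B}}) 0<ε
    , trans (sym (ℚ.*-assoc B (ℚ.1/ B) ε)) (trans (cong (ℚ._* ε) (ℚ.*-inverseʳ B)) (ℚ.*-identityˡ ε))
    where
    instance
      B-pos : ℚ.Positive B
      B-pos = ℚ.positive 0<B
      B≢0 : ℚ.NonZero B
      B≢0 = ℚ.pos⇒nonZero B

  eventuallyBounded : ∀ x → ∃ λ B → 0ℚ ℚ.< B × Eventually (λ n → ℚ.∣ seq x n ∣ ℚ.≤ B)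
  eventuallyBounded x with cauchy x 1ℚ (ℚ.positive⁻¹ 1ℚ)
  ... | N , close = ℚ.∣ seq x N ∣ ℚ.+ 1ℚ , ℚ.+-mono-≤-< (ℚ.0≤∣p∣ (seq x N)) (ℚ.positive⁻¹ 1ℚ) , N , λ n N≤n → begin
    ℚ.∣ seq x n ∣                            ≡⟨ cong ℚ.∣_∣ (solve 2 (λ p q → p := q :+ (p :- q)) refl (seq x n) (seq x N)) ⟩
    ℚ.∣ seq x N ℚ.+ (seq x n ℚ.- seq x N) ∣      ≤⟨ ℚ.∣p+q∣≤∣p∣+∣q∣ (seq x N) (seq x n ℚ.- seq x N) ⟩
    ℚ.∣ seq x N ∣ ℚ.+ ℚ.∣ seq x n ℚ.- seq x N ∣    ≤⟨ ℚ.+-monoʳ-≤ ℚ.∣ seq x N ∣ (ℚ.<⇒≤ (close n N N≤n ℕ.≤-refl)) ⟩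
    ℚ.∣ seq x N ∣ ℚ.+ 1ℚ                       ∎

  pointwise⇒≈ : ∀ {x y} → (∀ n → seq x n ≡ seq y n) → x ≈ᴿ y
  pointwise⇒≈ {x} {y} eq ε 0<ε = 0 , λ n _ → subst (λ z → ℚ.∣ z ∣ ℚ.< ε)
    (sym (trans (cong (ℚ._- seq y n) (eq n)) (ℚ.+-inverseʳ (seq y n)))) 0<ε

  ≈-refl : ∀ {x} → x ≈ᴿ x
  ≈-refl {x} = pointwise⇒≈ {x} {x} λ _ → refl

  ≈-sym : ∀ {x y} → x ≈ᴿ y → y ≈ᴿ x
  ≈-sym {x} {y} x≈y ε 0<ε = ev-map (λ {n} → subst (ℚ._< ε) (flip n)) (x≈y ε 0<ε)
    where
    flip : ∀ n → ℚ.∣ seq x n ℚ.- seq y n ∣ ≡ ℚ.∣ seq y n ℚ.- seq x n ∣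
    flip n = trans (sym (ℚ.∣-p∣≡∣p∣ (seq x n ℚ.- seq y n)))
      (cong ℚ.∣_∣ (solve 2 (λ p q → :- (p :- q) := q :- p) refl (seq x n) (seq y n)))

  ≈-trans : ∀ {x y z} → x ≈ᴿ y → y ≈ᴿ z → x ≈ᴿ z
  ≈-trans {x} {y} {z} x≈y y≈z ε 0<ε with half 0<ε
  ... | δ , 0<δ , refl = ev-map₂ (λ {n} lt lt′ → begin-strict
    ℚ.∣ seq x n ℚ.- seq z n ∣                          ≡⟨ cong ℚ.∣_∣ (solve 3 (λ p q r → p :- r := (p :- q) :+ (q :- r)) refl (seq x n) (seq y n) (seq z n)) ⟩
    ℚ.∣ (seq x n ℚ.- seq y n) ℚ.+ (seq y n ℚ.- seq z n) ∣  ≤⟨ ℚ.∣p+q∣≤∣p∣+∣q∣ (seq x n ℚ.- seq y n) (seq y n ℚ.- seq z n) ⟩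
    ℚ.∣ seq x n ℚ.- seq y n ∣ ℚ.+ ℚ.∣ seq y n ℚ.- seq z n ∣  <⟨ ℚ.+-mono-< lt lt′ ⟩
    δ ℚ.+ δ                                          ∎) (x≈y δ 0<δ) (y≈z δ 0<δ)

  +-cong : ∀ {x x′ y y′} → x ≈ᴿ x′ → y ≈ᴿ y′ → x +ᴿ y ≈ᴿ x′ +ᴿ y′
  +-cong {x} {x′} {y} {y′} x≈x′ y≈y′ ε 0<ε with half 0<ε
  ... | δ , 0<δ , refl = ev-map₂ (λ {n} lt lt′ → begin-strict
    ℚ.∣ (seq x n ℚ.+ seq y n) ℚ.- (seq x′ n ℚ.+ seq y′ n) ∣    ≡⟨ cong ℚ.∣_∣ (solve 4 (λ p q r s → (p :+ q) :- (r :+ s) := (p :- r) :+ (q :- s)) refl (seq x n) (seq y n) (seq x′ n) (seq y′ n)) ⟩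
    ℚ.∣ (seq x n ℚ.- seq x′ n) ℚ.+ (seq y n ℚ.- seq y′ n) ∣    ≤⟨ ℚ.∣p+q∣≤∣p∣+∣q∣ (seq x n ℚ.- seq x′ n) (seq y n ℚ.- seq y′ n) ⟩
    ℚ.∣ seq x n ℚ.- seq x′ n ∣ ℚ.+ ℚ.∣ seq y n ℚ.- seq y′ n ∣    <⟨ ℚ.+-mono-< lt lt′ ⟩
    δ ℚ.+ δ                                              ∎) (x≈x′ δ 0<δ) (y≈y′ δ 0<δ)

  *-congˡ : ∀ x {y y′} → y ≈ᴿ y′ → x *ᴿ y ≈ᴿ x *ᴿ y′
  *-congˡ x {y} {y′} y≈y′ ε 0<ε = let
      (B , 0<B , bounded) = eventuallyBounded x
      (δ , 0<δ , Bδ≡ε) = quotient 0<ε 0<B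
    in ev-map₂ (λ {n} bd lt → begin-strict
    ℚ.∣ seq x n ℚ.* seq y n ℚ.- seq x n ℚ.* seq y′ n ∣    ≡⟨ cong ℚ.∣_∣ (solve 3 (λ p q r → p :* q :- p :* r := p :* (q :- r)) refl (seq x n) (seq y n) (seq y′ n)) ⟩
    ℚ.∣ seq x n ℚ.* (seq y n ℚ.- seq y′ n) ∣            ≡⟨ ℚ.∣p*q∣≡∣p∣*∣q∣ (seq x n) (seq y n ℚ.- seq y′ n) ⟩
    ℚ.∣ seq x n ∣ ℚ.* ℚ.∣ seq y n ℚ.- seq y′ n ∣          ≤⟨ ℚ.*-monoʳ-≤-nonNeg ℚ.∣ seq y n ℚ.- seq y′ n ∣ {{ℚ.nonNegative (ℚ.0≤∣p∣ (seq y n ℚ.- seq y′ n))}} bd ⟩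
    B ℚ.* ℚ.∣ seq y n ℚ.- seq y′ n ∣                    <⟨ ℚ.*-monoʳ-<-pos B {{ℚ.positive 0<B}} lt ⟩
    B ℚ.* δ                                         ≡⟨ Bδ≡ε ⟩
    ε                                             ∎) bounded (y≈y′ δ 0<δ)

  *-comm : ∀ x y → x *ᴿ y ≈ᴿ y *ᴿ x
  *-comm x y = pointwise⇒≈ {x *ᴿ y} {y *ᴿ x} λ n → ℚ.*-comm (seq x n) (seq y n)

  *-cong : ∀ {x x′ y y′} → x ≈ᴿ x′ → y ≈ᴿ y′ → x *ᴿ y ≈ᴿ x′ *ᴿ y′
  *-cong {x} {x′} {y} {y′} x≈x′ y≈y′ =
    ≈-trans {x *ᴿ y} {x *ᴿ y′} {x′ *ᴿ y′} (*-congˡ x {y} {y′} y≈y′)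
      (≈-trans {x *ᴿ y′} {y′ *ᴿ x} {x′ *ᴿ y′} (*-comm x y′)
        (≈-trans {y′ *ᴿ x} {y′ *ᴿ x′} {x′ *ᴿ y′} (*-congˡ y′ {x} {x′} x≈x′) (*-comm y′ x′)))

  ≈⇒≤ : ∀ {x y} → x ≈ᴿ y → x ≤ᴿ y
  ≈⇒≤ {x} {y} x≈y ε 0<ε = ev-map (λ {n} lt → begin-strict
    seq x n                          ≡⟨ solve 2 (λ p q → p := q :+ (p :- q)) refl (seq x n) (seq y n) ⟩
    seq y n ℚ.+ (seq x n ℚ.- seq y n)    ≤⟨ ℚ.+-monoʳ-≤ (seq y n) (p≤∣p∣ _) ⟩
    seq y n ℚ.+ ℚ.∣ seq x n ℚ.- seq y n ∣  <⟨ ℚ.+-monoʳ-< (seq y n) lt ⟩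
    seq y n ℚ.+ ε                      ∎) (x≈y ε 0<ε)

  ≤ᴿ-trans : ∀ {x y z} → x ≤ᴿ y → y ≤ᴿ z → x ≤ᴿ z
  ≤ᴿ-trans {x} {y} {z} x≤y y≤z ε 0<ε with half 0<ε
  ... | δ , 0<δ , refl = ev-map₂ (λ {n} lt lt′ → begin-strict
    seq x n            <⟨ lt ⟩
    seq y n ℚ.+ δ        <⟨ ℚ.+-monoˡ-< δ lt′ ⟩
    seq z n ℚ.+ δ ℚ.+ δ    ≡⟨ ℚ.+-assoc (seq z n) δ δ ⟩
    seq z n ℚ.+ (δ ℚ.+ δ)  ∎) (x≤y δ 0<δ) (y≤z δ 0<δ)

  +-mono-≤ᴿ : ∀ {x x′ y y′} → x ≤ᴿ x′ → y ≤ᴿ y′ → x +ᴿ y ≤ᴿ x′ +ᴿ y′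
  +-mono-≤ᴿ {x} {x′} {y} {y′} x≤x′ y≤y′ ε 0<ε with half 0<ε
  ... | δ , 0<δ , refl = ev-map₂ (λ {n} lt lt′ → begin-strict
    seq x n ℚ.+ seq y n                <⟨ ℚ.+-mono-< lt lt′ ⟩
    (seq x′ n ℚ.+ δ) ℚ.+ (seq y′ n ℚ.+ δ)  ≡⟨ solve 3 (λ p q r → (p :+ r) :+ (q :+ r) := (p :+ q) :+ (r :+ r)) refl (seq x′ n) (seq y′ n) δ ⟩
    (seq x′ n ℚ.+ seq y′ n) ℚ.+ (δ ℚ.+ δ)  ∎) (x≤x′ δ 0<δ) (y≤y′ δ 0<δ)

  fromℚ-mono : ∀ {p q} → p ℚ.≤ q → fromℚ p ≤ᴿ fromℚ q
  fromℚ-mono {p} {q} p≤q ε 0<ε = 0 , λ n _ → begin-strict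
    p       ≤⟨ p≤q ⟩
    q       ≡⟨ ℚ.+-identityʳ q ⟨
    q ℚ.+ 0ℚ  <⟨ ℚ.+-monoʳ-< q 0<ε ⟩
    q ℚ.+ ε   ∎

  fromℚ-cancel : ∀ {p q} → fromℚ p ≤ᴿ fromℚ q → p ℚ.≤ q
  fromℚ-cancel {p} {q} le = ℚ.≮⇒≥ λ q<p → let
      -- With `ε = p − q` the bound `p < q + ε` reads `p < p`.
      (N , lt) = le (p ℚ.- q) (subst (ℚ._< p ℚ.- q) (ℚ.+-inverseʳ q) (ℚ.+-monoˡ-< (ℚ.- q) q<p))
    in ℚ.<-irrefl (solve 2 (λ p q → p := q :+ (p :- q)) refl p q) (lt N ℕ.≤-refl)

  -- (w + δ)(t + δ) = wt + δ(w + t + δ) is positive, and δ is chosen such that the last term is at most ε.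
  *-nonneg : ∀ {w t} → 0ᴿ ≤ᴿ w → 0ᴿ ≤ᴿ t → 0ᴿ ≤ᴿ w *ᴿ t
  *-nonneg {w} {t} 0≤w 0≤t ε 0<ε = let
      (B , 0<B , w≤B) = eventuallyBounded w
      (C , 0<C , t≤C) = eventuallyBounded t
    in bound B C 0<B 0<C w≤B t≤C
    where
    bound : ∀ B C → 0ℚ ℚ.< B → 0ℚ ℚ.< C → Eventually (λ n → ℚ.∣ seq w n ∣ ℚ.≤ B) → Eventually (λ n → ℚ.∣ seq t n ∣ ℚ.≤ C) →
      Eventually (λ n → 0ℚ ℚ.< seq w n ℚ.* seq t n ℚ.+ ε)
    bound B C 0<B 0<C w≤B t≤C = let (δ , 0<δ , Kδ≡ε) = quotient 0<ε 0<K in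
      choose δ 0<δ Kδ≡ε
      where
      -- `K` bounds `w + t + δ` from some index on. The summand 1 makes `K ≥ 1`, so that `δ = ε / K`
      -- is at most `ε`.
      K : ℚ
      K = B ℚ.+ C ℚ.+ ε ℚ.+ 1ℚ
      0<B+C+ε : 0ℚ ℚ.< B ℚ.+ C ℚ.+ ε
      0<B+C+ε = ℚ.+-mono-< (ℚ.+-mono-< 0<B 0<C) 0<ε
      0<K : 0ℚ ℚ.< K
      0<K = ℚ.+-mono-< 0<B+C+ε (ℚ.positive⁻¹ 1ℚ)
      1≤K : 1ℚ ℚ.≤ K
      1≤K = subst (ℚ._≤ K) (ℚ.+-identityˡ 1ℚ) (ℚ.+-monoˡ-≤ 1ℚ (ℚ.<⇒≤ 0<B+C+ε))
      choose : ∀ δ → 0ℚ ℚ.< δ → K ℚ.* δ ≡ ε → Eventually (λ n → 0ℚ ℚ.< seq w n ℚ.* seq t n ℚ.+ ε)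
      choose δ 0<δ Kδ≡ε = ev-map₂ (λ {n} → estimate (seq w n) (seq t n))
        (ev-map₂ _,_ (0≤w δ 0<δ) (0≤t δ 0<δ)) (ev-map₂ _,_ w≤B t≤C)
        where
        instance
          δ-nonneg : ℚ.NonNegative δ
          δ-nonneg = ℚ.pos⇒nonNeg δ {{ℚ.positive 0<δ}}
        δ≤ε+1 : δ ℚ.≤ ε ℚ.+ 1ℚ
        δ≤ε+1 = begin
          δ         ≡⟨ ℚ.*-identityˡ δ ⟨
          1ℚ ℚ.* δ    ≤⟨ ℚ.*-monoʳ-≤-nonNeg δ 1≤K ⟩
          K ℚ.* δ     ≡⟨ Kδ≡ε ⟩
          ε         ≡⟨ ℚ.+-identityʳ ε ⟨
          ε ℚ.+ 0ℚ    ≤⟨ ℚ.+-monoʳ-≤ ε (ℚ.nonNegative⁻¹ 1ℚ) ⟩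
          ε ℚ.+ 1ℚ    ∎
        estimate : ∀ p q → (0ℚ ℚ.< p ℚ.+ δ) × (0ℚ ℚ.< q ℚ.+ δ) → (ℚ.∣ p ∣ ℚ.≤ B) × (ℚ.∣ q ∣ ℚ.≤ C) → 0ℚ ℚ.< p ℚ.* q ℚ.+ ε
        estimate p q (lt , lt′) (bd , bd′) = begin-strict
          0ℚ                               <⟨ *-positive lt lt′ ⟩
          (p ℚ.+ δ) ℚ.* (q ℚ.+ δ)                ≡⟨ solve 3 (λ p q r → (p :+ r) :* (q :+ r) := p :* q :+ (p :+ q :+ r) :* r) refl p q δ ⟩
          p ℚ.* q ℚ.+ (p ℚ.+ q ℚ.+ δ) ℚ.* δ          ≤⟨ ℚ.+-monoʳ-≤ (p ℚ.* q) (ℚ.*-monoʳ-≤-nonNeg δ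
                                                (ℚ.+-mono-≤ (ℚ.+-mono-≤ (ℚ.≤-trans (p≤∣p∣ p) bd) (ℚ.≤-trans (p≤∣p∣ q) bd′)) δ≤ε+1)) ⟩
          p ℚ.* q ℚ.+ (B ℚ.+ C ℚ.+ (ε ℚ.+ 1ℚ)) ℚ.* δ   ≡⟨ cong (λ z → p ℚ.* q ℚ.+ z ℚ.* δ) (ℚ.+-assoc (B ℚ.+ C) ε 1ℚ) ⟨
          p ℚ.* q ℚ.+ K ℚ.* δ                    ≡⟨ cong (p ℚ.* q ℚ.+_) Kδ≡ε ⟩
          p ℚ.* q ℚ.+ ε                        ∎

-- Wrapping the relations in records lets Agda infer the real numbers from a proof; they cannot be
-- recovered from the unfolded definitions.
record _≋_ (x y : ℝ) : Set where
  constructor wrap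
  field unwrap : x ≈ᴿ y
open _≋_

record _⊑_ (x y : ℝ) : Set where
  constructor wrap
  field unwrap : x ≤ᴿ y

infix 4 _≋_ _⊑_

pointwise : ∀ {x y} → (∀ n → seq x n ≡ seq y n) → x ≋ y
pointwise {x} {y} eq = wrap (pointwise⇒≈ {x} {y} eq)

≋⇒⊑ : ∀ {x y} → x ≋ y → x ⊑ y
≋⇒⊑ {x} {y} (wrap p) = wrap (≈⇒≤ {x} {y} p)

⊑-trans : ∀ {x y z} → x ⊑ y → y ⊑ z → x ⊑ z
⊑-trans {x} {y} {z} (wrap p) (wrap q) = wrap (≤ᴿ-trans {x} {y} {z} p q)

infixl 6 _⊕_
infixl 7 _⊗_

-- Kept from unfolding, lest the conversion checker compare Cauchy moduli.
opaque

  _⊕_ _⊗_ : ℝ → ℝ → ℝ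
  x ⊕ y = x +ᴿ y
  x ⊗ y = x *ᴿ y

  seq-⊕ : ∀ x y n → seq (x ⊕ y) n ≡ seq x n ℚ.+ seq y n
  seq-⊕ x y n = refl

  seq-⊗ : ∀ x y n → seq (x ⊗ y) n ≡ seq x n ℚ.* seq y n
  seq-⊗ x y n = refl

  ⊕-mono : ∀ {x x′ y y′} → x ⊑ x′ → y ⊑ y′ → x ⊕ y ⊑ x′ ⊕ y′
  ⊕-mono {x} {x′} {y} {y′} (wrap p) (wrap q) = wrap (+-mono-≤ᴿ {x} {x′} {y} {y′} p q)

  ⊗-nonneg : ∀ {x y} → 0ᴿ ⊑ x → 0ᴿ ⊑ y → 0ᴿ ⊑ x ⊗ y
  ⊗-nonneg {x} {y} (wrap p) (wrap q) = wrap (*-nonneg {x} {y} p q)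

  ℝ-isCommutativeSemiring : IsCommutativeSemiring _≋_ _⊕_ _⊗_ 0ᴿ 1ᴿ
  ℝ-isCommutativeSemiring = record
    { isSemiring = record
      { isSemiringWithoutAnnihilatingZero = record
        { +-isCommutativeMonoid = record
          { isMonoid = record
            { isSemigroup = record
              { isMagma = record
                { isEquivalence = record
                  { refl  = λ {x} → wrap (≈-refl {x})
                  ; sym   = λ {x} {y} (wrap p) → wrap (≈-sym {x} {y} p)
                  ; trans = λ {x} {y} {z} (wrap p) (wrap q) → wrap (≈-trans {x} {y} {z} p q)
                  }
                ; ∙-cong = λ {x} {x′} {y} {y′} (wrap p) (wrap q) → wrap (+-cong {x} {x′} {y} {y′} p q)
                }
              ; assoc = λ x y z → pointwise λ n → ℚ.+-assoc (seq x n) (seq y n) (seq z n)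
              }
            ; identity = (λ x → pointwise λ n → ℚ.+-identityˡ (seq x n))
                       , (λ x → pointwise λ n → ℚ.+-identityʳ (seq x n))
            }
          ; comm = λ x y → pointwise λ n → ℚ.+-comm (seq x n) (seq y n)
          }
        ; *-cong = λ {x} {x′} {y} {y′} (wrap p) (wrap q) → wrap (*-cong {x} {x′} {y} {y′} p q)
        ; *-assoc = λ x y z → pointwise λ n → ℚ.*-assoc (seq x n) (seq y n) (seq z n)
        ; *-identity = (λ x → pointwise λ n → ℚ.*-identityˡ (seq x n))
                     , (λ x → pointwise λ n → ℚ.*-identityʳ (seq x n))
        ; distrib = (λ x y z → pointwise λ n → ℚ.*-distribˡ-+ (seq x n) (seq y n) (seq z n))
                  , (λ x y z → pointwise λ n → ℚ.*-distribʳ-+ (seq x n) (seq y n) (seq z n))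
        }
      ; zero = (λ x → pointwise λ n → ℚ.*-zeroˡ (seq x n))
             , (λ x → pointwise λ n → ℚ.*-zeroʳ (seq x n))
      }
    ; *-comm = λ x y → wrap (*-comm x y)
    }

ℝ-commutativeSemiring : CommutativeSemiring 0ℓ 0ℓ
ℝ-commutativeSemiring = record { isCommutativeSemiring = ℝ-isCommutativeSemiring }

-- Convexity

open CommutativeSemiring ℝ-commutativeSemiring
  using (+-identityˡ; +-identityʳ; +-assoc; +-comm; *-assoc; *-identityˡ; *-identityʳ; zeroˡ; zeroʳ; distribˡ; distribʳ)
  renaming (refl to ≋-refl; sym to ≋-sym; trans to ≋-trans; reflexive to ≋-reflexive; +-cong to ⊕-cong; *-cong to ⊗-cong)
open Algebra.Properties.CommutativeSemigroup (CommutativeSemiring.+-commutativeSemigroup ℝ-commutativeSemiring)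
  using (interchange)

Σ⊕ : ∀ {m} → Vector ℝ m → ℝ
Σ⊕ {zero}  w = 0ᴿ
Σ⊕ {suc m} w = w zero ⊕ Σ⊕ (w ∘ suc)

-- The comparison goes through the rational sequences, where the transparent and the opaque addition
-- can be related by `seq-⊕`.
Σᴿ≋Σ⊕ : ∀ {m} (w u : Vector ℝ m) → (∀ i n → seq (w i) n ≡ seq (u i) n) → Σᴿ w ≋ Σ⊕ u
Σᴿ≋Σ⊕ w u eq = pointwise (go w u eq)
  where
  go : ∀ {m} (w u : Vector ℝ m) → (∀ i n → seq (w i) n ≡ seq (u i) n) → ∀ n → seq (Σᴿ w) n ≡ seq (Σ⊕ u) n
  go {zero}  w u eq n = refl
  go {suc m} w u eq n = trans (cong₂ ℚ._+_ (eq zero n) (go (w ∘ suc) (u ∘ suc) (eq ∘ suc) n))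
    (sym (seq-⊕ (u zero) (Σ⊕ (u ∘ suc)) n))

-- Non-negative combinations of points of `S`, with total weight `c` and sum `x`. Leaving `c` free
-- allows adding one point at a time and rescaling; the convex hull is the slice `c = 1`. The
-- equations in the constructors are up to `_≋_`, which suits inductions.
data Cone {k} (S : Pred (Vector ℝ k) 0ℓ) : ℝ → Vector ℝ k → Set where
  nil : ∀ {c x} → c ≋ 0ᴿ → (∀ j → x j ≋ 0ᴿ) → Cone S c x
  add : ∀ {w p c x c′ x′} → 0ᴿ ⊑ w → S p → Cone S c x →
    c′ ≋ w ⊕ c → (∀ j → x′ j ≋ w ⊗ p j ⊕ x j) → Cone S c′ x′

module _ {k} {S : Pred (Vector ℝ k) 0ℓ} where

  Cone-resp : ∀ {c c′ x x′} → c′ ≋ c → (∀ j → x′ j ≋ x j) → Cone S c x → Cone S c′ x′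
  Cone-resp c≋ x≋ (nil c≋0 x≋0)          = nil (≋-trans c≋ c≋0) λ j → ≋-trans (x≋ j) (x≋0 j)
  Cone-resp c≋ x≋ (add 0≤w Sp rest ceq xeq) = add 0≤w Sp rest (≋-trans c≋ ceq) λ j → ≋-trans (x≋ j) (xeq j)

  Cone-+ : ∀ {c c′ x x′} → Cone S c x → Cone S c′ x′ → Cone S (c ⊕ c′) (λ j → x j ⊕ x′ j)
  Cone-+ (nil c≋0 x≋0) cone = Cone-resp
    (≋-trans (⊕-cong c≋0 ≋-refl) (+-identityˡ _)) (λ j → ≋-trans (⊕-cong (x≋0 j) ≋-refl) (+-identityˡ _)) cone
  Cone-+ (add 0≤w Sp rest ceq xeq) cone = add 0≤w Sp (Cone-+ rest cone)
    (≋-trans (⊕-cong ceq ≋-refl) (+-assoc _ _ _)) (λ j → ≋-trans (⊕-cong (xeq j) ≋-refl) (+-assoc _ _ _))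

  Cone-scale : ∀ {t c x} → 0ᴿ ⊑ t → Cone S c x → Cone S (t ⊗ c) (λ j → t ⊗ x j)
  Cone-scale 0≤t (nil c≋0 x≋0) = nil (≋-trans (⊗-cong ≋-refl c≋0) (zeroʳ _)) λ j → ≋-trans (⊗-cong ≋-refl (x≋0 j)) (zeroʳ _)
  Cone-scale {t} 0≤t (add {w} 0≤w Sp rest ceq xeq) =
    add {w = t ⊗ w} (⊗-nonneg 0≤t 0≤w) Sp (Cone-scale 0≤t rest)
      (≋-trans (⊗-cong ≋-refl ceq) (distribˡ _ _ _))
      (λ j → ≋-trans (⊗-cong ≋-refl (xeq j)) (≋-trans (distribˡ _ _ _) (⊕-cong (≋-sym (*-assoc _ _ _)) ≋-refl)))

  private
    weightedSum : ∀ {m} (w : Vector ℝ m) (p : Vector (Vector ℝ k) m) j →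
      Σᴿ (λ i → w i *ᴿ p i j) ≋ Σ⊕ (λ i → w i ⊗ p i j)
    weightedSum w p j = Σᴿ≋Σ⊕ (λ i → w i *ᴿ p i j) (λ i → w i ⊗ p i j) λ i n → sym (seq-⊗ (w i) (p i j) n)

  conv⇒Cone : ∀ {x} → conv S x → Cone S 1ᴿ x
  conv⇒Cone {x} (m , w , p , 0≤w , total , Sp , eq) = Cone-resp
    (≋-trans (≋-sym (wrap {Σᴿ w} {1ᴿ} total)) (Σᴿ≋Σ⊕ w w λ _ _ → refl))
    (λ j → ≋-trans (wrap {x j} {Σᴿ (λ i → w i *ᴿ p i j)} (eq j)) (weightedSum w p j))
    (go m w p (λ i → wrap (0≤w i)) Sp)
    where
    go : ∀ m (w : Vector ℝ m) (p : Vector (Vector ℝ k) m) → (∀ i → 0ᴿ ⊑ w i) → (∀ i → S (p i)) →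
      Cone S (Σ⊕ w) (λ j → Σ⊕ λ i → w i ⊗ p i j)
    go zero    w p 0≤w Sp = nil ≋-refl λ _ → ≋-refl
    go (suc m) w p 0≤w Sp = add {w = w zero} {p zero} (0≤w zero) (Sp zero)
      (go m (w ∘ suc) (p ∘ suc) (0≤w ∘ suc) (Sp ∘ suc)) ≋-refl λ _ → ≋-refl

  Cone⇒conv : ∀ {x} → Cone S 1ᴿ x → conv S x
  Cone⇒conv {x} cone = let (m , w , p , 0≤w , total , Sp , eq) = go cone in
    m , w , p , (λ i → _⊑_.unwrap (0≤w i))
    , _≋_.unwrap (≋-trans (Σᴿ≋Σ⊕ w w λ _ _ → refl) total) , Sp
    , λ j → _≋_.unwrap (≋-trans (eq j) (≋-sym (weightedSum w p j)))
    where
    go : ∀ {c x} → Cone S c x → ∃ λ m → Σ (Vector ℝ m) λ w → Σ (Vector (Vector ℝ k) m) λ p →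
      (∀ i → 0ᴿ ⊑ w i) × Σ⊕ w ≋ c × (∀ i → S (p i)) × (∀ j → x j ≋ Σ⊕ (λ i → w i ⊗ p i j))
    go (nil c≋0 x≋0) = 0 , (λ ()) , (λ ()) , (λ ()) , ≋-sym c≋0 , (λ ()) , x≋0
    go (add {w} {p} 0≤w Sp rest ceq xeq) = let (m , ws , ps , 0≤ws , total , Sps , eq) = go rest in
      suc m , w Vec.∷ ws , p Vec.∷ ps
      , (λ { zero → 0≤w ; (suc i) → 0≤ws i })
      , ≋-trans (⊕-cong ≋-refl total) (≋-sym ceq)
      , (λ { zero → Sp ; (suc i) → Sps i })
      , λ j → ≋-trans (xeq j) (⊕-cong ≋-refl (eq j))

-- A point of weight `w` is replaced by `w` times its own combination, whose total weight is
-- `w ⊗ 1ᴿ`.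
conv-idempotent : ∀ {k} {S : Pred (Vector ℝ k) 0ℓ} {x} → conv (conv S) x → conv S x
conv-idempotent {S = S} {x} c = Cone⇒conv {S = S} {x} (flatten (conv⇒Cone {S = conv S} {x} c))
  where
  flatten : ∀ {c x} → Cone (conv S) c x → Cone S c x
  flatten (nil c≋0 x≋0) = nil c≋0 x≋0
  flatten (add {w} {p} 0≤w cp rest ceq xeq) = Cone-resp
    (≋-trans ceq (⊕-cong (≋-sym (*-identityʳ w)) ≋-refl)) xeq
    (Cone-+ (Cone-scale 0≤w (conv⇒Cone {S = S} {p} cp)) (flatten rest))

conv-mono : ∀ {k} {S T : Pred (Vector ℝ k) 0ℓ} → (∀ x → S x → T x) → ∀ {x} → conv S x → conv T x
conv-mono S⊆T (m , w , p , 0≤w , total , Sp , eq) = m , w , p , 0≤w , total , (λ i → S⊆T (p i) (Sp i)) , eq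

conv-permute : ∀ {k} {S : Pred (Vector ℝ k) 0ℓ} (π : Fin k → Fin k) → (∀ x → S x → S (x ∘ π)) →
  ∀ {x} → conv S x → conv S (x ∘ π)
conv-permute π closed (m , w , p , 0≤w , total , Sp , eq) =
  m , w , (λ i → p i ∘ π) , 0≤w , total , (λ i → closed (p i) (Sp i)) , λ j → eq (π j)

conv-resp : ∀ {k} {S : Pred (Vector ℝ k) 0ℓ} {x y} → (∀ j → y j ≋ x j) → conv S x → conv S y
conv-resp {S = S} {x} {y} y≋x c = Cone⇒conv {S = S} {y} (Cone-resp ≋-refl y≋x (conv⇒Cone {S = S} {x} c))

⊆conv : ∀ {k} {S : Pred (Vector ℝ k) 0ℓ} {x} → S x → conv S x
⊆conv {S = S} {x} Sx = Cone⇒conv {S = S} {x} (add {w = 1ᴿ} {x} (wrap (fromℚ-mono (ℚ.nonNegative⁻¹ 1ℚ))) Sx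
  (nil {c = 0ᴿ} {x = λ _ → 0ᴿ} ≋-refl λ _ → ≋-refl)
  (≋-sym (+-identityʳ 1ᴿ)) λ j → ≋-sym (≋-trans (+-identityʳ _) (*-identityˡ (x j))))

-- With no points the weights would add up to 0 instead of 1. For a Newton polytope the point found
-- is an exponent, and its colouring with `k` colours is the source of `ℓ ≤ k`.
conv-nonempty : ∀ {k} {S : Pred (Vector ℝ k) 0ℓ} {x} → conv S x → ∃ S
conv-nonempty (zero , _ , _ , _ , total , _) = contradiction
  (fromℚ-cancel {1ℚ} {0ℚ} (≈⇒≤ {1ᴿ} {0ᴿ} (≈-sym {0ᴿ} {1ᴿ} total)))
  λ 1≤0 → ℚ.<-irrefl refl (ℚ.<-≤-trans (ℚ.positive⁻¹ 1ℚ) 1≤0)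
conv-nonempty (suc m , _ , p , _ , _ , Sp , _) = p zero , Sp zero

-- Functionals of a point of a cone and of its total weight; over points of total weight 1 they
-- are the affine ones.
record Functional (k : ℕ) : Set where
  field
    apply : ℝ → Vector ℝ k → ℝ
    apply-zero : ∀ {c x} → c ≋ 0ᴿ → (∀ j → x j ≋ 0ᴿ) → apply c x ≋ 0ᴿ
    apply-add  : ∀ {w p c x c′ x′} → c′ ≋ w ⊕ c → (∀ j → x′ j ≋ w ⊗ p j ⊕ x j) →
      apply c′ x′ ≋ w ⊗ apply 1ᴿ p ⊕ apply c x

open Functional

zeroᶠ : ∀ {k} → Functional k
zeroᶠ .apply _ _ = 0ᴿ
zeroᶠ .apply-zero _ _ = ≋-refl
zeroᶠ .apply-add {w} _ _ = ≋-sym (≋-trans (+-identityʳ _) (zeroʳ w))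

constᶠ : ∀ {k} → ℝ → Functional k
constᶠ B .apply c _ = c ⊗ B
constᶠ B .apply-zero c≋0 _ = ≋-trans (⊗-cong c≋0 ≋-refl) (zeroˡ B)
constᶠ B .apply-add {w} {p} {c} ceq _ = ≋-trans (⊗-cong ceq ≋-refl) (≋-trans (distribʳ B w c)
  (⊕-cong (⊗-cong ≋-refl (≋-sym (*-identityˡ B))) ≋-refl))

coordinateᶠ : ∀ {k} → Fin k → Functional k
coordinateᶠ i .apply _ x = x i
coordinateᶠ i .apply-zero _ x≋0 = x≋0 i
coordinateᶠ i .apply-add _ xeq = xeq i

prefix : ∀ {k} → ℕ → Vector ℝ k → ℝ
prefix         zero    x = 0ᴿ
prefix {zero}  (suc m) x = 0ᴿ
prefix {suc k} (suc m) x = x zero ⊕ prefix m (x ∘ suc)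

prefixᶠ : ∀ {k} → ℕ → Functional k
prefixᶠ m .apply _ x = prefix m x
prefixᶠ m .apply-zero _ x≋0 = go m x≋0
  where
  go : ∀ {k} m {x : Vector ℝ k} → (∀ j → x j ≋ 0ᴿ) → prefix m x ≋ 0ᴿ
  go         zero    x≋0 = ≋-refl
  go {zero}  (suc m) x≋0 = ≋-refl
  go {suc k} (suc m) x≋0 = ≋-trans (⊕-cong (x≋0 zero) (go m (x≋0 ∘ suc))) (+-identityʳ 0ᴿ)
prefixᶠ m .apply-add _ xeq = go m xeq
  where
  go : ∀ {k} m {w} {p x x′ : Vector ℝ k} → (∀ j → x′ j ≋ w ⊗ p j ⊕ x j) →
    prefix m x′ ≋ w ⊗ prefix m p ⊕ prefix m x
  go         zero    {w} xeq = ≋-sym (≋-trans (+-identityʳ _) (zeroʳ w))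
  go {zero}  (suc m) {w} xeq = ≋-sym (≋-trans (+-identityʳ _) (zeroʳ w))
  go {suc k} (suc m) {w} {p} {x} xeq = ≋-trans (⊕-cong (xeq zero) (go m (xeq ∘ suc)))
    (≋-trans (interchange _ _ _ _)
      (⊕-cong (≋-sym (distribˡ w (p zero) (prefix m (p ∘ suc)))) ≋-refl))

-- Multiplication by `w` is applied to the non-negative difference of `y` and `x`. In the semiring
-- this difference is formed with the constant -1.
⊑-*ˡ : ∀ {w x y} → 0ᴿ ⊑ w → x ⊑ y → w ⊗ x ⊑ w ⊗ y
⊑-*ˡ {w} {x} {y} 0≤w x⊑y = ⊑-trans (≋⇒⊑ (≋-sym (+-identityʳ (w ⊗ x))))
  (⊑-trans (⊕-mono (≋⇒⊑ ≋-refl) (⊗-nonneg 0≤w 0⊑gap)) (≋⇒⊑ (≋-trans (≋-sym (distribˡ w x gap)) (⊗-cong ≋-refl x+gap))))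
  where
  -1ᴿ gap : ℝ
  -1ᴿ = fromℚ (ℚ.- 1ℚ)
  gap = y ⊕ -1ᴿ ⊗ x
  x-x : x ⊕ -1ᴿ ⊗ x ≋ 0ᴿ
  x-x = ≋-trans (⊕-cong (≋-sym (*-identityˡ x)) ≋-refl) (≋-trans (≋-sym (distribʳ x 1ᴿ -1ᴿ))
    (≋-trans (⊗-cong (pointwise λ n → seq-⊕ 1ᴿ -1ᴿ n) ≋-refl) (zeroˡ x)))
  0⊑gap : 0ᴿ ⊑ gap
  0⊑gap = ⊑-trans (≋⇒⊑ (≋-sym x-x)) (⊕-mono x⊑y (≋⇒⊑ ≋-refl))
  x+gap : x ⊕ gap ≋ y
  x+gap = ≋-trans (≋-sym (+-assoc x y _)) (≋-trans (⊕-cong (+-comm x y) ≋-refl)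
    (≋-trans (+-assoc y x _) (≋-trans (⊕-cong ≋-refl x-x) (+-identityʳ y))))

-- Both functionals are linear in weight and point together, so an inequality at the generators
-- propagates through the cone.
conv-⊑ : ∀ {k} (φ ψ : Functional k) {S} → (∀ p → S p → apply φ 1ᴿ p ⊑ apply ψ 1ᴿ p) →
  ∀ {x} → conv S x → apply φ 1ᴿ x ⊑ apply ψ 1ᴿ x
conv-⊑ φ ψ {S} le {x} c = go (conv⇒Cone {S = S} {x} c)
  where
  go : ∀ {c x} → Cone S c x → apply φ c x ⊑ apply ψ c x
  go (nil c≋0 x≋0) = ≋⇒⊑ (≋-trans (apply-zero φ c≋0 x≋0) (≋-sym (apply-zero ψ c≋0 x≋0)))
  go (add {p = p} 0⊑w Sp rest ceq xeq) = ⊑-trans (≋⇒⊑ (apply-add φ ceq xeq))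
    (⊑-trans (⊕-mono (⊑-*ˡ 0⊑w (le p Sp)) (go rest)) (≋⇒⊑ (≋-sym (apply-add ψ ceq xeq))))

-- Integer points and their prefix sums

/1-≃ : ∀ a → ℚ.toℚᵘ (a ℚ./ 1) ℚᵘ.≃ mkℚᵘ a 0
/1-≃ a = ℚ.toℚᵘ-fromℚᵘ (mkℚᵘ a 0)

/1-+ : ∀ a a′ → (a ℤ.+ a′) ℚ./ 1 ≡ (a ℚ./ 1) ℚ.+ (a′ ℚ./ 1)
/1-+ a a′ = ℚ.toℚᵘ-injective (ℚᵘ.≃-trans (/1-≃ (a ℤ.+ a′)) (ℚᵘ.≃-trans step
  (ℚᵘ.≃-sym (ℚᵘ.≃-trans (ℚ.toℚᵘ-homo-+ (a ℚ./ 1) (a′ ℚ./ 1)) (ℚᵘ.+-cong (/1-≃ a) (/1-≃ a′))))))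
  where
  step : mkℚᵘ (a ℤ.+ a′) 0 ℚᵘ.≃ mkℚᵘ a 0 ℚᵘ.+ mkℚᵘ a′ 0
  step = *≡* (cong (ℤ._* ℤ.+ 1) (cong₂ ℤ._+_ (sym (ℤ.*-identityʳ a)) (sym (ℤ.*-identityʳ a′))))

/1-mono : ∀ {a a′} → a ℤ.≤ a′ → a ℚ./ 1 ℚ.≤ a′ ℚ./ 1
/1-mono {a} {a′} a≤b = ℚ.toℚᵘ-cancel-≤ (ℚᵘ.≤-respˡ-≃ (ℚᵘ.≃-sym (/1-≃ a)) (ℚᵘ.≤-respʳ-≃ (ℚᵘ.≃-sym (/1-≃ a′))
  (*≤* (ℤ.*-monoʳ-≤-nonNeg (ℤ.+ 1) a≤b))))

/1-cancel : ∀ {a a′} → a ℚ./ 1 ℚ.≤ a′ ℚ./ 1 → a ℤ.≤ a′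
/1-cancel {a} {a′} le with ℚᵘ.≤-respˡ-≃ (/1-≃ a) (ℚᵘ.≤-respʳ-≃ (/1-≃ a′) (ℚ.toℚᵘ-mono-≤ le))
... | *≤* le′ = subst₂ ℤ._≤_ (ℤ.*-identityʳ a) (ℤ.*-identityʳ a′) le′

fromℤ-cancel : ∀ {a a′} → fromℤ a ⊑ fromℤ a′ → a ℤ.≤ a′
fromℤ-cancel {a} {a′} (wrap le) = /1-cancel (fromℚ-cancel {a ℚ./ 1} {a′ ℚ./ 1} le)

fromℕ : ℕ → ℝ
fromℕ n = fromℤ (ℤ.+ n)

fromℕ-mono : ∀ {a a′} → a ℕ.≤ a′ → fromℕ a ⊑ fromℕ a′
fromℕ-mono a≤b = wrap (fromℚ-mono (/1-mono (ℤ.+≤+ a≤b)))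

fromℕ-cancel : ∀ {a a′} → fromℕ a ⊑ fromℕ a′ → a ℕ.≤ a′
fromℕ-cancel {a} {a′} le = ℤ.drop‿+≤+ (fromℤ-cancel {ℤ.+ a} {ℤ.+ a′} le)

fromℕ-+ : ∀ a a′ → fromℕ (a ℕ.+ a′) ≋ fromℕ a ⊕ fromℕ a′
fromℕ-+ a a′ = pointwise λ n → trans (cong (ℚ._/ 1) (ℤ.pos-+ a a′))
  (trans (/1-+ (ℤ.+ a) (ℤ.+ a′)) (sym (seq-⊕ (fromℕ a) (fromℕ a′) n)))

prefix-embed : ∀ {k} m (β : Vector ℕ k) → prefix m (embedℕ β) ≋ fromℕ (Σ< (ext β) m)
prefix-embed         zero    β = ≋-refl
prefix-embed {zero}  (suc m) β = zero≋ (zeros (suc m))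
  where
  zero≋ : ∀ {a} → a ≡ 0 → 0ᴿ ≋ fromℕ a
  zero≋ refl = ≋-refl
  zeros : ∀ m → Σ< (λ _ → 0) m ≡ 0
  zeros zero    = refl
  zeros (suc m) = trans (ℕ.+-identityʳ _) (zeros m)
prefix-embed {suc k} (suc m) β = ≋-trans (⊕-cong ≋-refl (prefix-embed m (β ∘ suc)))
  (≋-trans (≋-sym (fromℕ-+ (β zero) (Σ< (ext (β ∘ suc)) m)))
    (≋-reflexive (cong fromℕ (sym (Σ<-front (ext β) m)))))

prefix-cong : ∀ {k} m {x y : Vector ℝ k} → (∀ j → x j ≋ y j) → prefix m x ≋ prefix m y
prefix-cong         zero    eq = ≋-refl
prefix-cong {zero}  (suc m) eq = ≋-refl
prefix-cong {suc k} (suc m) eq = ⊕-cong (eq zero) (prefix-cong m (eq ∘ suc))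

module _ {k} {T : Vector ℕ k → Set} where

  conv-nonneg : ∀ {α} → conv (image T) (embed α) → ∀ j → ℤ.+ 0 ℤ.≤ α j
  conv-nonneg {α} c j = fromℤ-cancel {ℤ.+ 0} {α j} (conv-⊑ zeroᶠ (coordinateᶠ j) {image T}
    (λ p (γ , _ , eq) → ⊑-trans (fromℕ-mono {0} {γ j} ℕ.z≤n) (≋⇒⊑ (≋-sym (wrap {p j} {fromℕ (γ j)} (eq j))))) {embed α} c)

  private
    prefix-image : ∀ m (p : Vector ℝ k) (γ : Vector ℕ k) → (∀ i → p i ≈ᴿ embedℕ γ i) → prefix m p ≋ fromℕ (Σ< (ext γ) m)
    prefix-image m p γ eq = ≋-trans (prefix-cong m {p} {embedℕ γ} λ j → wrap {p j} {embedℕ γ j} (eq j)) (prefix-embed m γ)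

  -- A prefix sum is linear on real vectors, so the bound passes from the generators to the hull. At
  -- an integer point both sides are naturals, and `fromℕ-cancel` brings the inequality back.
  conv-prefix≤ : ∀ m {B} → (∀ γ → T γ → Σ< (ext γ) m ℕ.≤ B) →
    ∀ β → conv (image T) (embedℕ β) → Σ< (ext β) m ℕ.≤ B
  conv-prefix≤ m {B} le β c = fromℕ-cancel {Σ< (ext β) m} {B}
    (⊑-trans (≋⇒⊑ (≋-sym (prefix-embed m β))) (⊑-trans bound (≋⇒⊑ (*-identityˡ (fromℕ B)))))
    where
    vertex : ∀ p → image T p → prefix m p ⊑ 1ᴿ ⊗ fromℕ B
    vertex p (γ , Tγ , eq) = ⊑-trans (≋⇒⊑ (prefix-image m p γ eq))
      (⊑-trans (fromℕ-mono {Σ< (ext γ) m} {B} (le γ Tγ)) (≋⇒⊑ (≋-sym (*-identityˡ (fromℕ B)))))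
    bound : prefix m (embedℕ β) ⊑ 1ᴿ ⊗ fromℕ B
    bound = conv-⊑ (prefixᶠ m) (constᶠ (fromℕ B)) {image T} vertex {embedℕ β} c

  conv-prefix≥ : ∀ m {B} → (∀ γ → T γ → B ℕ.≤ Σ< (ext γ) m) →
    ∀ β → conv (image T) (embedℕ β) → B ℕ.≤ Σ< (ext β) m
  conv-prefix≥ m {B} le β c = fromℕ-cancel {B} {Σ< (ext β) m}
    (⊑-trans (≋⇒⊑ (≋-sym (*-identityˡ (fromℕ B)))) (⊑-trans bound (≋⇒⊑ (prefix-embed m β))))
    where
    vertex : ∀ p → image T p → 1ᴿ ⊗ fromℕ B ⊑ prefix m p
    vertex p (γ , Tγ , eq) = ⊑-trans (≋⇒⊑ (*-identityˡ (fromℕ B)))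
      (⊑-trans (fromℕ-mono {B} {Σ< (ext γ) m} (le γ Tγ)) (≋⇒⊑ (≋-sym (prefix-image m p γ eq))))
    bound : 1ᴿ ⊗ fromℕ B ⊑ prefix m (embedℕ β)
    bound = conv-⊑ (constᶠ (fromℕ B)) (prefixᶠ m) {image T} vertex {embedℕ β} c

conv-segment : ∀ {k} {S : Pred (Vector ℝ k) 0ℓ} {x y z} t → 0ℚ ℚ.≤ t → 0ℚ ℚ.≤ 1ℚ ℚ.- t →
  conv S x → conv S y → (∀ l → z l ≋ fromℚ (1ℚ ℚ.- t) ⊗ x l ⊕ fromℚ t ⊗ y l) → conv S z
conv-segment {S = S} {x} {y} {z} t 0≤t 0≤1-t cx cy eq = Cone⇒conv {S = S} {z} (Cone-resp total eq
  (Cone-+ (Cone-scale (wrap (fromℚ-mono 0≤1-t)) (conv⇒Cone {S = S} {x} cx)) (Cone-scale (wrap (fromℚ-mono 0≤t)) (conv⇒Cone {S = S} {y} cy))))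
  where
  open ℚ-Solver
  total : 1ᴿ ≋ fromℚ (1ℚ ℚ.- t) ⊗ 1ᴿ ⊕ fromℚ t ⊗ 1ᴿ
  total = ≋-trans (pointwise λ n → trans (solve 1 (λ t → con 1ℚ := (con 1ℚ :- t) :+ t) refl t)
      (sym (seq-⊕ (fromℚ (1ℚ ℚ.- t)) (fromℚ t) n)))
    (⊕-cong (≋-sym (*-identityʳ _)) (≋-sym (*-identityʳ _)))

module _ {n} (i j : Fin n) where

  transpose-left : Permutation.transpose i j ⟨$⟩ʳ i ≡ j
  transpose-left with i Fin.≟ i
  ... | yes _  = refl
  ... | no i≢i = contradiction refl i≢i

  transpose-right : Permutation.transpose i j ⟨$⟩ʳ j ≡ i
  transpose-right with j Fin.≟ i
  ... | yes j≡i = j≡i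
  ... | no _ with j Fin.≟ j
  ...   | yes _  = refl
  ...   | no j≢j = contradiction refl j≢j

  transpose-other : ∀ {l} → l ≢ i → l ≢ j → Permutation.transpose i j ⟨$⟩ʳ l ≡ l
  transpose-other {l} l≢i l≢j with l Fin.≟ i
  ... | yes l≡i = contradiction l≡i l≢i
  ... | no _ with l Fin.≟ j
  ...   | yes l≡j = contradiction l≡j l≢j
  ...   | no _    = refl

module _ {k} {S : Pred (Vector ℝ k) 0ℓ} (closed : ∀ (π : Permutation′ k) x → S x → S (x ∘ (π ⟨$⟩ʳ_)))
  {γ : Vector ℕ k} {i j} (i≢j : i ≢ j) (gap : 2 ℕ.+ γ j ℕ.≤ γ i) (γ∈ : conv S (embedℕ γ)) where

  private
    γ′ : Vector ℕ k
    γ′ c = transfer (toℕ i) (toℕ j) (ext γ) (toℕ c)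

    τ : Permutation′ k
    τ = Permutation.transpose i j

    ι : ℕ → ℚ
    ι n = ℤ.+ n ℚ./ 1

    ι-+ : ∀ m n → ι (m ℕ.+ n) ≡ ι m ℚ.+ ι n
    ι-+ m n = trans (cong (ℚ._/ 1) (ℤ.pos-+ m n)) (/1-+ (ℤ.+ m) (ℤ.+ n))

    -- Thus `γ i = g + d + 1`, and the transposed vector gets the weight `t = 1/(d + 1)`; `t ≤ 1`
    -- since `d` is a natural.
    g d : ℕ
    g = γ j
    d = γ i ℕ.∸ suc g

    γi≡ : γ i ≡ g ℕ.+ d ℕ.+ 1
    γi≡ = trans (sym (ℕ.m+[n∸m]≡n (ℕ.≤-trans (ℕ.n≤1+n _) gap))) (ℕ.+-comm 1 _)

    at-i : ∀ t x y → (y ℚ.+ 1ℚ) ℚ.* t ≡ 1ℚ → x ℚ.+ y ≡ (1ℚ ℚ.- t) ℚ.* (x ℚ.+ y ℚ.+ 1ℚ) ℚ.+ t ℚ.* x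
    at-i t x y eq = trans (trans (solve 2 (λ x y → x :+ y := x :+ y :+ con 1ℚ :- con 1ℚ) refl x y)
        (cong (λ z → x ℚ.+ y ℚ.+ 1ℚ ℚ.- z) (sym eq)))
      (solve 3 (λ x y t → x :+ y :+ con 1ℚ :- (y :+ con 1ℚ) :* t := (con 1ℚ :- t) :* (x :+ y :+ con 1ℚ) :+ t :* x) refl x y t)
      where open ℚ-Solver

    at-j : ∀ t x y → (y ℚ.+ 1ℚ) ℚ.* t ≡ 1ℚ → x ℚ.+ 1ℚ ≡ (1ℚ ℚ.- t) ℚ.* x ℚ.+ t ℚ.* (x ℚ.+ y ℚ.+ 1ℚ)
    at-j t x y eq = trans (cong (x ℚ.+_) (sym eq))
      (solve 3 (λ x y t → x :+ (y :+ con 1ℚ) :* t := (con 1ℚ :- t) :* x :+ t :* (x :+ y :+ con 1ℚ)) refl x y t)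
      where open ℚ-Solver

    elsewhere : ∀ t x → x ≡ (1ℚ ℚ.- t) ℚ.* x ℚ.+ t ℚ.* x
    elsewhere = solve 2 (λ t x → x := (con 1ℚ :- t) :* x :+ t :* x) refl
      where open ℚ-Solver

    pointwise′ : ∀ t → (ι d ℚ.+ 1ℚ) ℚ.* t ≡ 1ℚ → ∀ l → Dec (l ≡ i) → Dec (l ≡ j) →
      ι (γ′ l) ≡ (1ℚ ℚ.- t) ℚ.* ι (γ l) ℚ.+ t ℚ.* ι (γ (τ ⟨$⟩ʳ l))
    pointwise′ t Dt≡1 l (yes refl) _ = trans (trans (cong ι γ′i) (ι-+ g d)) (trans (at-i t (ι g) (ι d) Dt≡1)
      (cong₂ (λ y z → (1ℚ ℚ.- t) ℚ.* y ℚ.+ t ℚ.* ι (γ z)) (sym ιγi) (sym (transpose-left i j))))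
      where
      γ′i : γ′ i ≡ g ℕ.+ d
      γ′i = trans (transfer-left (toℕ i) (toℕ j) (ext γ))
        (cong ℕ.pred (trans (ext-toℕ γ i) (trans γi≡ (ℕ.+-comm _ 1))))
      ιγi : ι (γ i) ≡ ι g ℚ.+ ι d ℚ.+ 1ℚ
      ιγi = trans (cong ι γi≡) (trans (ι-+ (g ℕ.+ d) 1) (cong (ℚ._+ 1ℚ) (ι-+ g d)))
    pointwise′ t Dt≡1 l (no l≢i) (yes refl) = trans (trans (cong ι γ′j) (ι-+ g 1)) (trans (at-j t (ι g) (ι d) Dt≡1)
      (cong (λ z → (1ℚ ℚ.- t) ℚ.* ι g ℚ.+ t ℚ.* z) (trans (sym ιγi) (cong (ι ∘ γ) (sym (transpose-right i j))))))
      where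
      γ′j : γ′ j ≡ g ℕ.+ 1
      γ′j = trans (transfer-right (ext γ) (l≢i ∘ Fin.toℕ-injective))
        (trans (cong suc (ext-toℕ γ j)) (ℕ.+-comm 1 _))
      ιγi : ι (γ i) ≡ ι g ℚ.+ ι d ℚ.+ 1ℚ
      ιγi = trans (cong ι γi≡) (trans (ι-+ (g ℕ.+ d) 1) (cong (ℚ._+ 1ℚ) (ι-+ g d)))
    pointwise′ t Dt≡1 l (no l≢i) (no l≢j) = trans (cong ι (trans (transfer-other (ext γ)
        (l≢i ∘ Fin.toℕ-injective) (l≢j ∘ Fin.toℕ-injective)) (ext-toℕ γ l)))
      (trans (elsewhere t (ι (γ l))) (cong (λ z → (1ℚ ℚ.- t) ℚ.* ι (γ l) ℚ.+ t ℚ.* ι (γ z)) (sym (transpose-other i j l≢i l≢j))))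

    0≤ι : ∀ n → 0ℚ ℚ.≤ ι n
    0≤ι n = /1-mono {ℤ.+ 0} {ℤ.+ n} (ℤ.+≤+ ℕ.z≤n)

    combine : ∀ t → 0ℚ ℚ.< t → (ι d ℚ.+ 1ℚ) ℚ.* t ≡ 1ℚ → conv S (embedℕ γ′)
    combine t 0<t Dt≡1 = conv-segment {S = S} {embedℕ γ} {embedℕ γ ∘ (τ ⟨$⟩ʳ_)} {embedℕ γ′} t (ℚ.<⇒≤ 0<t) 0≤1-t
      γ∈ (conv-permute {S = S} (τ ⟨$⟩ʳ_) (closed τ) {embedℕ γ} γ∈)
      λ l → pointwise λ n → trans (pointwise′ t Dt≡1 l (l Fin.≟ i) (l Fin.≟ j)) (sym
        (trans (seq-⊕ (fromℚ (1ℚ ℚ.- t) ⊗ fromℕ (γ l)) (fromℚ t ⊗ fromℕ (γ (τ ⟨$⟩ʳ l))) n)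
          (cong₂ ℚ._+_ (seq-⊗ (fromℚ (1ℚ ℚ.- t)) (fromℕ (γ l)) n) (seq-⊗ (fromℚ t) (fromℕ (γ (τ ⟨$⟩ʳ l))) n))))
      where
      open ℚ-Solver
      0≤dt : 0ℚ ℚ.≤ ι d ℚ.* t
      0≤dt = subst (ℚ._≤ ι d ℚ.* t) (ℚ.*-zeroˡ t) (ℚ.*-monoʳ-≤-nonNeg t {{ℚ.nonNegative (ℚ.<⇒≤ 0<t)}} (0≤ι d))
      0≤1-t : 0ℚ ℚ.≤ 1ℚ ℚ.- t
      0≤1-t = subst (0ℚ ℚ.≤_) (trans (solve 2 (λ d t → d :* t := (d :+ con 1ℚ) :* t :- t) refl (ι d) t)
        (cong (ℚ._- t) Dt≡1)) 0≤dt

  -- With D = γ i − γ j, moving a unit from i to j divides the segment from γ to its image under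
  -- the transposition of i and j in the ratio 1 : D − 1.
  conv-transfer : conv S (embedℕ γ′)
  conv-transfer = let (t , 0<t , Dt≡1) = quotient (ℚ.positive⁻¹ 1ℚ) (ℚ.+-mono-≤-< (0≤ι d) (ℚ.positive⁻¹ 1ℚ))
    in combine t 0<t Dt≡1

-- The support of the chromatic polynomial

wt-cong : ∀ {n} {f g : Fin n → ℕ} → f ≗ g → wt f ≗ wt g
wt-cong {n} {f} {g} f≗g c = trans (wt≡count f c)
  (trans (Σ<-cong n λ u _ → cong (λ z → 𝟙 (z ≟ c)) (ext-cong f≗g u)) (sym (wt≡count g c)))

toℕ-surjective : ∀ {n u} → u < n → ∃ λ (w : Fin n) → toℕ w ≡ u
toℕ-surjective u<n = fromℕ< u<n , Fin.toℕ-fromℕ< u<n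

HasWeight< : ∀ {n} → Graph n → ∀ {k} → Vector ℕ k → Set
HasWeight< {n} G {k} α = Σ (Fin n → Fin k) λ f → Proper G f × ∀ i → wt (toℕ ∘ f) (toℕ i) ≡ α i

module _ {n} {G : Graph n} {k} {α : Vector ℕ k} where

  HasWeight<⇒HasWeight : HasWeight< G α → HasWeight G (ext α)
  HasWeight<⇒HasWeight (f , proper , weight) = toℕ ∘ f , (λ u w adj → proper u w adj ∘ Fin.toℕ-injective) , weight′
    where
    weight′ : wt (toℕ ∘ f) ≗ ext α
    weight′ c with c ℕ.<? k
    ... | yes c<k with toℕ-surjective c<k
    ...   | i , refl = trans (weight i) (sym (ext-toℕ α i))
    weight′ c | no c≮k = trans (wt≡count (toℕ ∘ f) c) (trans (count-avoid (ext (toℕ ∘ f)) c {0} z≤n avoid) (sym (ext-beyond α (ℕ.≮⇒≥ c≮k))))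
      where
      avoid : ∀ u → 0 ≤ u → u < n → ext (toℕ ∘ f) u ≢ c
      avoid u _ u<n eq with toℕ-surjective u<n
      ... | w , refl = c≮k (subst (_< k) (trans (sym (ext-toℕ (toℕ ∘ f) w)) eq) (Fin.toℕ<n (f w)))

  -- `ext α` vanishes from `k` on, so no vertex can have a colour there.
  HasWeight⇒HasWeight< : HasWeight G (ext α) → HasWeight< G α
  HasWeight⇒HasWeight< (f , proper , weight) = f′ , (λ u w adj eq → proper u w adj (trans (sym (f′≗f u)) (trans (cong toℕ eq) (f′≗f w)))) ,
    λ i → trans (wt-cong f′≗f (toℕ i)) (trans (weight (toℕ i)) (ext-toℕ α i))
    where
    f<k : ∀ u → f u < k
    f<k u = ℕ.≰⇒> λ k≤fu → ℕ.n≮0 (subst (0 <_)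
      (trans (sym (wt≡count f (f u))) (trans (weight (f u)) (ext-beyond α k≤fu)))
      (count-hit (ext f) {M = 0} z≤n (Fin.toℕ<n u) (ext-toℕ f u)))
    f′ : Fin n → Fin k
    f′ u = fromℕ< (f<k u)
    f′≗f : toℕ ∘ f′ ≗ f
    f′≗f u = Fin.toℕ-fromℕ< (f<k u)

  -- Recolouring by the inverse of `π` turns the class of `π i` into the class of `i`.
  HasWeight<-permute : ∀ (π : Permutation′ k) → HasWeight< G α → HasWeight< G (α ∘ (π ⟨$⟩ʳ_))
  HasWeight<-permute π (f , proper , weight) = g ,
    (λ u w adj eq → proper u w adj (trans (sym (Permutation.inverseʳ π)) (trans (cong (π ⟨$⟩ʳ_) eq) (Permutation.inverseʳ π)))) ,
    λ i → trans (wt≡count (toℕ ∘ g) (toℕ i)) (trans (Σ<-cong n (same i))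
      (trans (sym (wt≡count (toℕ ∘ f) (toℕ (π ⟨$⟩ʳ i)))) (weight (π ⟨$⟩ʳ i))))
    where
    g : Fin n → Fin k
    g u = π ⟨$⟩ˡ f u
    same : ∀ i u → u < n → 𝟙 (ext (toℕ ∘ g) u ≟ toℕ i) ≡ 𝟙 (ext (toℕ ∘ f) u ≟ toℕ (π ⟨$⟩ʳ i))
    same i u u<n with toℕ-surjective u<n
    ... | w , refl = 𝟙-cong (ext (toℕ ∘ g) (toℕ w) ≟ toℕ i) (ext (toℕ ∘ f) (toℕ w) ≟ toℕ (π ⟨$⟩ʳ i))
      (λ eq → trans (ext-toℕ (toℕ ∘ f) w) (cong toℕ (trans (sym (Permutation.inverseʳ π))
        (cong (π ⟨$⟩ʳ_) (Fin.toℕ-injective (trans (sym (ext-toℕ (toℕ ∘ g) w)) eq))))))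
      (λ eq → trans (ext-toℕ (toℕ ∘ g) w) (cong toℕ (trans
        (cong (π ⟨$⟩ˡ_) (Fin.toℕ-injective (trans (sym (ext-toℕ (toℕ ∘ f) w)) eq))) (Permutation.inverseˡ π))))

-- A coefficient seen at one index of its Cauchy sequence, where it is a finite sum of rationals.
total : ∀ {A : Set} → (A → Bool) → (A → ℚ) → List A → ℚ
total cond w []       = 0ℚ
total cond w (t ∷ ts) = if cond t then w t ℚ.+ total cond w ts else total cond w ts

module _ {A : Set} (cond : A → Bool) (w : A → ℚ) where

  total-none : ∀ ts → (∀ {t} → t ∈ ts → cond t ≡ false) → total cond w ts ≡ 0ℚ
  total-none []       none = refl
  total-none (t ∷ ts) none = trans
    (cong (λ d → if d then w t ℚ.+ total cond w ts else total cond w ts) (none (here refl)))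
    (total-none ts (none ∘ there))

  total-nonneg : ∀ ts → (∀ t → 0ℚ ℚ.≤ w t) → 0ℚ ℚ.≤ total cond w ts
  total-nonneg []       nonneg = ℚ.≤-refl
  total-nonneg (t ∷ ts) nonneg with cond t
  ... | true  = ℚ.+-mono-≤ (nonneg t) (total-nonneg ts nonneg)
  ... | false = total-nonneg ts nonneg

  -- All summands are non-negative, so a single matching term cannot be cancelled.
  ≤total : ∀ {t} ts → (∀ t → 0ℚ ℚ.≤ w t) → t ∈ ts → cond t ≡ true → w t ℚ.≤ total cond w ts
  ≤total {t} (t ∷ ts) nonneg (here refl) eq with true ← cond t | refl ← eq = begin
    w t                        ≡⟨ ℚ.+-identityʳ (w t) ⟨
    w t ℚ.+ 0ℚ                 ≤⟨ ℚ.+-monoʳ-≤ (w t) (total-nonneg ts nonneg) ⟩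
    w t ℚ.+ total cond w ts    ∎
    where open ℚ.≤-Reasoning
  ≤total {t} (s ∷ ts) nonneg (there t∈) eq with cond s | ≤total ts nonneg t∈ eq
  ... | false | le = le
  ... | true  | le = begin
    w t                        ≤⟨ le ⟩
    total cond w ts            ≡⟨ ℚ.+-identityˡ _ ⟨
    0ℚ ℚ.+ total cond w ts     ≤⟨ ℚ.+-monoˡ-≤ (total cond w ts) (nonneg s) ⟩
    w s ℚ.+ total cond w ts    ∎
    where open ℚ.≤-Reasoning

seq-if : ∀ (d : Bool) (x y : ℝ) N → seq (if d then x else y) N ≡ (if d then seq x N else seq y N)
seq-if true  x y N = refl
seq-if false x y N = refl

-- The operation is a parameter because unfolding _+ᴿ_ makes the conversion checker compare Cauchy
-- moduli.
module _ {B : Set} (_⊞_ : ℝ → ℝ → ℝ) (0⊞ : ℝ) (seq-⊞ : ∀ x y N → seq (x ⊞ y) N ≡ seq x N ℚ.+ seq y N)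
  (seq-0⊞ : ∀ N → seq 0⊞ N ≡ 0ℚ) (cond : ℝ × B → Bool) where

  seq-foldr : ∀ ts N → seq (foldr (λ t c → if cond t then proj₁ t ⊞ c else c) 0⊞ ts) N ≡
    total cond (λ t → seq (proj₁ t) N) ts
  seq-foldr []       N = seq-0⊞ N
  seq-foldr (t ∷ ts) N = trans (seq-if (cond t) _ _ N) (trans
    (cong (λ z → if cond t then z else seq (foldr (λ t c → if cond t then proj₁ t ⊞ c else c) 0⊞ ts) N)
      (seq-⊞ (proj₁ t) _ N))
    (cong (λ z → if cond t then seq (proj₁ t) N ℚ.+ z else z) (seq-foldr ts N)))

module _ {k : ℕ} where

  Term : Set
  Term = ℝ × Vector ℕ k

  _·_ : Term → Term → Term
  s · t = proj₁ s *ᴿ proj₁ t , λ i → proj₂ s i + proj₂ t i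

  varTerm : Fin k → Term
  varTerm i = 1ᴿ , λ j → 𝟙 (i Fin.≟ j)

  product : ∀ {n} → (Fin n → Fin k) → Term
  product {zero}  f = 1ᴿ , λ _ → 0
  product {suc n} f = varTerm (f zero) · product (f ∘ suc)

  singleton-* : ∀ (s t : Term) → (s ∷ []) *ᴾ (t ∷ []) ≡ s · t ∷ []
  singleton-* s t = refl

  var-term : ∀ i → var i ≡ varTerm i ∷ []
  var-term i = refl

  ∏ᴾ-suc : ∀ {n} (ps : Vector (Poly k) (suc n)) → ∏ᴾ ps ≡ ps zero *ᴾ ∏ᴾ (ps ∘ suc)
  ∏ᴾ-suc ps = refl

  ∏ᴾ-var : ∀ {n} (f : Fin n → Fin k) → ∏ᴾ (λ u → var (f u)) ≡ product f ∷ []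
  ∏ᴾ-var {zero}  f = refl
  ∏ᴾ-var {suc n} f = trans (∏ᴾ-suc (λ u → var (f u)))
    (trans (cong₂ _*ᴾ_ (var-term (f zero)) (∏ᴾ-var (f ∘ suc))) (singleton-* (varTerm (f zero)) (product (f ∘ suc))))

  seq-product : ∀ {n} (f : Fin n → Fin k) N → seq (proj₁ (product f)) N ≡ 1ℚ
  seq-product {zero}  f N = refl
  seq-product {suc n} f N = trans (cong (1ℚ ℚ.*_) (seq-product (f ∘ suc) N)) (ℚ.*-identityˡ 1ℚ)

  product-exponent : ∀ {n} (f : Fin n → Fin k) i → proj₂ (product f) i ≡ wt (toℕ ∘ f) (toℕ i)
  product-exponent f i = trans (go f) (sym (wt≡count (toℕ ∘ f) (toℕ i)))
    where
    go : ∀ {n} (f : Fin n → Fin k) → proj₂ (product f) i ≡ count (ext (toℕ ∘ f)) n (toℕ i)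
    go {zero}  f = refl
    go {suc n} f = trans (cong₂ _+_ (𝟙-cong (f zero Fin.≟ i) (toℕ (f zero) ≟ toℕ i) (cong toℕ) Fin.toℕ-injective) (go (f ∘ suc)))
      (sym (Σ<-front (λ u → 𝟙 (ext (toℕ ∘ f) u ≟ toℕ i)) n))

  product-nonneg : ∀ {n} (f : Fin n → Fin k) N → 0ℚ ℚ.≤ seq (proj₁ (product f)) N
  product-nonneg f N = subst (0ℚ ℚ.≤_) (sym (seq-product f N)) (ℚ.nonNegative⁻¹ 1ℚ)

  seq-coeff : ∀ p (α : Vector ℕ k) N → seq (coeff p α) N ≡
    total (λ t → does (Fin.all? (λ i → proj₂ t i ≟ α i))) (λ t → seq (proj₁ t) N) p
  seq-coeff p α N = seq-foldr _+ᴿ_ 0ᴿ (λ _ _ _ → refl) (λ _ → refl)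
    (λ t → does (Fin.all? (λ i → proj₂ t i ≟ α i))) p N

  sum≡map : ∀ {n} (fs : List (Fin n → Fin k)) →
    foldr (λ f p → ∏ᴾ (λ u → var (f u)) +ᴾ p) 0ᴾ fs ≡ map product fs
  sum≡map []       = refl
  sum≡map (f ∷ fs) = cong₂ _++_ (∏ᴾ-var f) (sum≡map fs)

  total-map : ∀ {A B : Set} (g : A → B) cond w ts → total cond w (map g ts) ≡ total (cond ∘ g) (w ∘ g) ts
  total-map g cond w []       = refl
  total-map g cond w (t ∷ ts) = cong (λ z → if cond (g t) then w (g t) ℚ.+ z else z) (total-map g cond w ts)

  module _ {n} (G : Graph n) {α : Vector ℕ k} where

    private
      fs : List (Fin n → Fin k)
      fs = filter (proper? G) (functions n (allFin k))

      matches? : ∀ (f : Fin n → Fin k) → Dec (∀ i → proj₂ (product f) i ≡ α i)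
      matches? f = Fin.all? λ i → proj₂ (product f) i ≟ α i

      seq-coeff-X : ∀ N → seq (coeff (X G k) α) N ≡ total (λ f → does (matches? f)) (λ f → seq (proj₁ (product f)) N) fs
      seq-coeff-X N = trans (seq-coeff (X G k) α N) (trans
        (cong (total _ (λ t → seq (proj₁ t) N)) (sum≡map fs))
        (total-map product _ (λ t → seq (proj₁ t) N) fs))

    -- The hypothesis is only a negation, so the witness comes from searching the finite list of
    -- proper colourings: if none matched, the coefficient would be 0 at every index.
    supp⇒HasWeight< : supp (X G k) α → HasWeight< G α
    supp⇒HasWeight< nonzero = decide (Any.any? matches? fs)
      where
      decide : Dec (Any (λ f → ∀ i → proj₂ (product f) i ≡ α i) fs) → HasWeight< G α
      decide (no none) = ⊥-elim (nonzero vanishes)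
        where
        seq≡0 : ∀ N → seq (coeff (X G k) α) N ≡ 0ℚ
        seq≡0 N = trans (seq-coeff-X N) (total-none (λ f → does (matches? f)) (λ f → seq (proj₁ (product f)) N) fs
          λ {f} f∈ → dec-false (matches? f) λ match → none (lose f∈ match))
        vanishes : coeff (X G k) α ≈ᴿ 0ᴿ
        vanishes = pointwise⇒≈ {coeff (X G k) α} {0ᴿ} seq≡0
      decide (yes any) = let (f , f∈ , match) = find any in f , proj₂ (∈-filter⁻ (proper? G) {xs = functions n (allFin k)} f∈) ,
        λ i → trans (sym (product-exponent f i)) (match i)

    -- Each matching colouring contributes 1, so the coefficient is at least 1 at every index and is
    -- not within 1 of zero.
    HasWeight<⇒supp : HasWeight< G α → supp (X G k) α
    HasWeight<⇒supp (f , proper , weight) zero≈ = ℚ.<-irrefl refl (ℚ.<-≤-trans (proj₂ close (proj₁ close) ℕ.≤-refl) 1≤∣value∣)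
      where
      listed : ∃ λ f′ → f′ ∈ functions n (allFin k) × f′ ≗ f
      listed = find (functions-complete {R = _≡_} {allFin k} n f λ i → Any.map sym (∈-allFin (f i)))
      f′ : Fin n → Fin k
      f′ = proj₁ listed
      f′∈ : f′ ∈ functions n (allFin k)
      f′∈ = proj₁ (proj₂ listed)
      f′≗f : f′ ≗ f
      f′≗f = proj₂ (proj₂ listed)
      f′∈fs : f′ ∈ fs
      f′∈fs = ∈-filter⁺ (proper? G) f′∈ λ u w adj eq → proper u w adj (trans (sym (f′≗f u)) (trans eq (f′≗f w)))
      match : ∀ i → proj₂ (product f′) i ≡ α i
      match i = trans (product-exponent f′ i) (trans (wt-cong (λ u → cong toℕ (f′≗f u)) (toℕ i)) (weight i))
      close : ∃ λ N → ∀ m → N ≤ m → ℚ.∣ seq (coeff (X G k) α) m ℚ.- 0ℚ ∣ ℚ.< 1ℚ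
      close = zero≈ 1ℚ (ℚ.positive⁻¹ 1ℚ)
      value : ℚ
      value = seq (coeff (X G k) α) (proj₁ close)
      1≤value : 1ℚ ℚ.≤ value
      1≤value = subst₂ ℚ._≤_ (seq-product f′ (proj₁ close)) (sym (seq-coeff-X (proj₁ close)))
        (≤total (λ f → does (matches? f)) (λ f → seq (proj₁ (product f)) (proj₁ close)) fs (λ f → product-nonneg f (proj₁ close)) f′∈fs (dec-true (matches? f′) match))
      1≤∣value∣ : 1ℚ ℚ.≤ ℚ.∣ value ℚ.- 0ℚ ∣
      1≤∣value∣ = ℚ.≤-trans 1≤value
        (ℚ.≤-trans (ℚ.≤-reflexive (sym (ℚ.+-identityʳ value))) (p≤∣p∣ (value ℚ.- 0ℚ)))

-- The Newton polytope

embed-cong : ∀ {a a′ : ℤ} → a ≡ a′ → fromℤ a ≈ᴿ fromℤ a′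
embed-cong {a} refl = ≈-refl {fromℤ a}

-- Restates the local predicate `permutationOfν` of `Permutohedron`, so that its convex hull can be
-- named.
PermutationOf : ∀ {k} → (ℕ → ℕ) → Vector ℕ k → Set
PermutationOf {k} ν α = Σ (Permutation′ k) λ σ → ∀ i → α i ≡ ν (toℕ (σ ⟨$⟩ʳ i))

image-permute : ∀ {k} {T : Vector ℕ k → Set} (π : Permutation′ k) → (∀ {α} → T α → T (α ∘ (π ⟨$⟩ʳ_))) →
  ∀ x → image T x → image T (x ∘ (π ⟨$⟩ʳ_))
image-permute π closed x (α , Tα , eq) = α ∘ (π ⟨$⟩ʳ_) , closed Tα , λ i → eq (π ⟨$⟩ʳ i)

ext-restrict : ∀ {k} (γ : ℕ → ℕ) → (∀ c → k ≤ c → γ c ≡ 0) → ext (λ (i : Fin k) → γ (toℕ i)) ≗ γ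
ext-restrict {zero}  γ zeros c       = sym (zeros c z≤n)
ext-restrict {suc k} γ zeros zero    = refl
ext-restrict {suc k} γ zeros (suc c) = ext-restrict (γ ∘ suc) (λ c k≤c → zeros (suc c) (s≤s k≤c)) c

module _ {n} (P : FinPoset n) (L : PartListing) (P≅L : FinPoset._≺_ P ≅ Below L)
  {m} (d : DyckPath m) (L≅d : Incomparable (Below (reduce L)) ≅ Adj (indifferenceGraph d)) (k : ℕ) where

  open Indifference d

  private
    G : Graph n
    G = incGraph P

    ν : ℕ → ℕ
    ν = λᵍʳ d

    Weight : Vector ℕ k → Set
    Weight α = HasWeight< G α

    weight⇒colouring : ∀ {α} → Weight α → HasColouring (ext α)
    weight⇒colouring w = HasWeight⇒HasColouring (poset⇒indifference P L P≅L d L≅d (HasWeight<⇒HasWeight {G = G} w))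

    colouring⇒weight : ∀ {α} → HasColouring (ext α) → Weight α
    colouring⇒weight c = HasWeight⇒HasWeight< {G = G} (indifference⇒poset P L P≅L d L≅d (HasColouring⇒HasWeight c))

    HasColouring-resp : ∀ {γ δ} → γ ≗ δ → HasColouring γ → HasColouring δ
    HasColouring-resp eq (f , proper , weight) = f , proper , λ c → trans (weight c) (eq c)

    weight-total : ∀ {α} → Weight α → Σ< (ext α) k ≡ m
    weight-total {α} w = colouring-total (weight⇒colouring w) λ c → ext-beyond α

    weight-prefix : ∀ {α} → Weight α → ∀ l → Σ< (ext α) l ≤ Σ< ν l
    weight-prefix w = λᵍʳ-dominates (weight⇒colouring w)

    weight⇒length≤ : ∀ {ℓ α} → IsPartition ν ℓ → Weight α → ℓ ≤ k
    weight⇒length≤ {α = α} part w = length≤colours part (weight⇒colouring w) λ c → ext-beyond α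

    -- The descent needs a nonincreasing target. The bounds are therefore assumed for all
    -- rearrangements of `β`; the sorted one is reached, and the closure of `Q` under permutations
    -- undoes the sorting.
    dominated∈ : ∀ {ℓ} → IsPartition ν ℓ → ℓ ≤ k → (Q : Vector ℕ k → Set) →
      (∀ {γ δ} → γ ≗ δ → Q γ → Q δ) →
      (∀ {γ} (π : Permutation′ k) → Q γ → Q (γ ∘ (π ⟨$⟩ʳ_))) →
      (∀ {γ} {i j : Fin k} → i ≢ j → 2 + γ j ≤ γ i → Q γ → Q (λ c → transfer (toℕ i) (toℕ j) (ext γ) (toℕ c))) →
      Q (λ c → ν (toℕ c)) →
      ∀ β → (∀ (π : Permutation′ k) → Σ< (ext (β ∘ (π ⟨$⟩ʳ_))) k ≡ m) →
      (∀ (π : Permutation′ k) l → Σ< (ext (β ∘ (π ⟨$⟩ʳ_))) l ≤ Σ< ν l) → Q β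
    dominated∈ part ℓ≤k Q resp permute step Qν β total prefix =
      let (σ , sorted) = sorting β in
      resp (λ i → cong β (Permutation.inverseʳ σ)) (permute (Permutation.flip σ)
        (dominated⇒vector∈ part ℓ≤k Q resp step Qν (β ∘ (σ ⟨$⟩ʳ_)) sorted (total σ) (λ l _ → prefix σ l)))

    ν-weight : ∀ {ℓ} → IsPartition ν ℓ → ℓ ≤ k → Weight (λ c → ν (toℕ c))
    ν-weight part ℓ≤k = colouring⇒weight (HasColouring-resp
      (λ c → sym (ext-restrict ν (λ c k≤c → IsPartition.zeroAfter part c (ℕ.≤-trans ℓ≤k k≤c)) c)) λᵍʳ-colouring)

    weight-resp : ∀ {α β} → α ≗ β → Weight α → Weight β
    weight-resp eq (f , proper , weight) = f , proper , λ i → trans (weight i) (eq i)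

    weight-transfer : ∀ {γ} {i j : Fin k} → i ≢ j → 2 + γ j ≤ γ i → Weight γ →
      Weight (λ c → transfer (toℕ i) (toℕ j) (ext γ) (toℕ c))
    weight-transfer {γ} {i} {j} i≢j gap w = colouring⇒weight (HasColouring-resp
      (λ c → sym (ext-restrict _ beyond c))
      (transfer-colouring (i≢j ∘ Fin.toℕ-injective) (subst₂ (λ y z → 2 + y ≤ z) (sym (ext-toℕ γ j)) (sym (ext-toℕ γ i)) gap)
        (weight⇒colouring w)))
      where
      beyond : ∀ c → k ≤ c → transfer (toℕ i) (toℕ j) (ext γ) c ≡ 0
      beyond c k≤c = trans (transfer-other (ext γ)
        (≢-sym (ℕ.<⇒≢ (ℕ.<-≤-trans (Fin.toℕ<n i) k≤c))) (≢-sym (ℕ.<⇒≢ (ℕ.<-≤-trans (Fin.toℕ<n j) k≤c))))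
        (ext-beyond γ k≤c)

    supp-permute : ∀ (π : Permutation′ k) {α} → supp (X G k) α → supp (X G k) (α ∘ (π ⟨$⟩ʳ_))
    supp-permute π {α} s = HasWeight<⇒supp G {α ∘ (π ⟨$⟩ʳ_)} (HasWeight<-permute {G = G} π (supp⇒HasWeight< G {α} s))

    Perms : Pred (Vector ℝ k) 0ℓ
    Perms = image (PermutationOf ν)

    Hull : Vector ℕ k → Set
    Hull γ = conv Perms (embedℕ γ)

    perms-permute : ∀ (π : Permutation′ k) x → Perms x → Perms (x ∘ (π ⟨$⟩ʳ_))
    perms-permute π = image-permute π λ (σ , eq) → π ∘ₚ σ , λ i → eq (π ⟨$⟩ʳ i)

    -- The descent with `Q` the hull: `λᵍʳ` itself is a generator, by the identity permutation, and
    -- `conv-transfer` is the step.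
    weight⇒hull : ∀ {ℓ} → IsPartition ν ℓ → ∀ {α} → Weight α → Hull α
    weight⇒hull part {α} w = dominated∈ part (weight⇒length≤ part w) Hull
      (λ {γ} {δ} eq → conv-resp {S = Perms} {embedℕ γ} {embedℕ δ} λ j → wrap (embed-cong (cong ℤ.+_ (sym (eq j)))))
      (λ {γ} π → conv-permute {S = Perms} (π ⟨$⟩ʳ_) (perms-permute π) {embedℕ γ})
      (λ {γ} i≢j gap → conv-transfer {S = Perms} perms-permute {γ} i≢j gap)
      (⊆conv {S = Perms} {embedℕ λ c → ν (toℕ c)} ((λ c → ν (toℕ c)) , (Permutation.id , λ _ → refl) , λ i → ≈-refl {fromℕ (ν (toℕ i))}))
      α
      (λ π → weight-total (HasWeight<-permute {G = G} π w))
      (λ π → weight-prefix (HasWeight<-permute {G = G} π w))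

  -- The descent with `Q` the set of weights. The prefix bounds and the total hold at all exponents,
  -- hence on their hull; the total, being an equality, is passed on as two inequalities.
  newton⇒supp : ∀ (β : Vector ℕ k) → Newton (X G k) (embedℕ β) → supp (X G k) β
  newton⇒supp β c = let
      (ℓ , part) = λᵍʳ-partition
      (_ , α , suppα , _) = conv-nonempty {S = image (supp (X G k))} {embedℕ β} c
      ℓ≤k = weight⇒length≤ part (supp⇒HasWeight< G {α} suppα)
    in HasWeight<⇒supp G {β} (dominated∈ part ℓ≤k Weight weight-resp (HasWeight<-permute {G = G}) weight-transfer
      (ν-weight part ℓ≤k) β
      (λ π → ℕ.≤-antisym
        (conv-prefix≤ {T = supp (X G k)} k (λ γ s → ℕ.≤-reflexive (weight-total (supp⇒HasWeight< G {γ} s))) (β ∘ (π ⟨$⟩ʳ_)) (permuted π))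
        (conv-prefix≥ {T = supp (X G k)} k (λ γ s → ℕ.≤-reflexive (sym (weight-total (supp⇒HasWeight< G {γ} s)))) (β ∘ (π ⟨$⟩ʳ_)) (permuted π)))
      (λ π l → conv-prefix≤ {T = supp (X G k)} l (λ γ s → weight-prefix (supp⇒HasWeight< G {γ} s) l) (β ∘ (π ⟨$⟩ʳ_)) (permuted π)))
    where
    permuted : ∀ (π : Permutation′ k) → Newton (X G k) (embedℕ (β ∘ (π ⟨$⟩ʳ_)))
    permuted π = conv-permute {S = image (supp (X G k))} (π ⟨$⟩ʳ_) (image-permute {T = supp (X G k)} π (λ {α} → supp-permute π {α})) {embedℕ β} c

  snp : SNP (X G k)
  snp α = mk⇔
    (λ (β , s , eq) → ⊆conv {S = image (supp (X G k))} {embed α} (β , s , λ i → embed-cong (eq i)))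
    λ c → let
        -- The hull lies in the non-negative orthant, so taking absolute values does not change `α`.
        β = λ i → ℤ.∣ α i ∣
        eq = λ i → sym (ℤ.0≤i⇒+∣i∣≡i (conv-nonneg {T = supp (X G k)} {α} c i))
      in β , newton⇒supp β (conv-resp {S = image (supp (X G k))} {embed α} {embedℕ β} (λ i → wrap (embed-cong (sym (eq i)))) c) , eq

  -- Every exponent lies in the hull of the rearrangements, and nested hulls flatten; conversely the
  -- rearrangements of `λᵍʳ` are weights themselves. For `k < ℓ` both sides are empty, since a
  -- colouring with `k` colours forces `ℓ ≤ k`.
  newton⇔permutohedron : ∀ x → Newton (X G k) x ⇔ Permutohedron k ν x
  newton⇔permutohedron x = mk⇔ to from
    where
    to : Newton (X G k) x → Permutohedron k ν x
    to c = let
        (ℓ , part) = λᵍʳ-partition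
        (_ , α , suppα , _) = conv-nonempty {S = image (supp (X G k))} {x} c
        hull : ∀ p → image (supp (X G k)) p → conv Perms p
        hull = λ p (γ , s , eq) → conv-resp {S = Perms} {embedℕ γ} {p} (λ j → wrap (eq j)) (weight⇒hull part (supp⇒HasWeight< G {γ} s))
      in ℓ , part , weight⇒length≤ part (supp⇒HasWeight< G {α} suppα) ,
        conv-idempotent {S = Perms} {x} (conv-mono {S = image (supp (X G k))} {conv Perms} hull {x} c)
    from : Permutohedron k ν x → Newton (X G k) x
    from (ℓ , part , ℓ≤k , c) = conv-mono {S = Perms} {image (supp (X G k))} (λ p (γ , (σ , eq) , p≈) → γ ,
      HasWeight<⇒supp G {γ} (weight-resp (sym ∘ eq) (HasWeight<-permute {G = G} σ (ν-weight part ℓ≤k))) , p≈) {x} c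

theorem5p8 : ∀ {n : ℕ} (P : FinPoset n) →
    ThreePlusOneFree (FinPoset._≺_ P) →
    ∀ (L : PartListing) →
    FinPoset._≺_ P ≅ Below L →
    ∀ {m : ℕ} (d : DyckPath m) →
    Incomparable (Below (reduce L)) ≅ Adj (indifferenceGraph d) →
    ∀ (k : ℕ) → 1 ≤ k →
    SNP (X (incGraph P) k)
    × (∀ (x : Vector ℝ k) → Newton (X (incGraph P) k) x ⇔ Permutohedron k (λᵍʳ d) x)
    × (∀ (f : Fin n → ℕ) → Proper (incGraph P) f → wt f ≼ λᵍʳ d)
theorem5p8 P _ L P≅L d L≅d k _ =
    snp P L P≅L d L≅d k
  , newton⇔permutohedron P L P≅L d L≅d k
  , λ f proper l → subst₂ _≤_ (sym (sum-applyUpTo (wt f) l)) (sym (sum-applyUpTo (λᵍʳ d) l))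
      (λᵍʳ-dominates (HasWeight⇒HasColouring (poset⇒indifference P L P≅L d L≅d (f , proper , λ _ → refl))) l)
  where open Indifference d
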